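{- Let $n\ge1$ and let $\mu$ be a partition of $n$. The coefficient of the monomial symmetric function $m_{1^n}$ in $\tilde{J}_\mu^{(\alpha)}(X)$ is $$\langle \tilde{J}_\mu^{(\alpha)}(X), h_{1^n}\rangle = n!\,\alpha^n = \sum_{k=0}^{n-1} n!\, A(n,k) \binom{\alpha + k}{n} = \sum_{k=1}^{n} n!\, S(n,k)\binom{\alpha}{k} k!.$$
   Context: Jack polynomials: over $\mathbb{Q}(\alpha)$, with $\alpha$ an indeterminate, let $\langle p_\lambda,p_\nu\rangle_\alpha=\delta_{\lambda\nu}z_\lambda\alpha^{\ell(\lambda)}$, where $z_\lambda=\prod_i i^{m_i}m_i!$ and $m_i$ is the number of parts of $\lambda$ equal to $i$. The integral form Jack symmetric functions $J_\mu^{(\alpha)}(X)$ are the unique family, indexed by partitions $\mu$, of symmetric functions that are pairwise orthogonal for $\langle\cdot,\cdot\rangle_\alpha$, are triangular (only monomial symmetric functions $m_\lambda$ with $\lambda\le\mu$ in dominance order appear in $J_\mu^{(\alpha)}$), and are normalized so that the coefficient of $m_{1^n}$ in $J_\mu^{(\alpha)}$ is $n!$ where $n=|\mu|$. For $\mu$ a partition of $n$, define $\tilde J_\mu^{(\alpha)}(X)=\alpha^nJ_\mu^{(1/\alpha)}(X)$. The bracket $\langle\cdot,\cdot\rangle$ (without subscript) is the Hall scalar product, for which Schur functions are orthonormal (extended linearly over $\mathbb{Q}(\alpha)$); $h_{1^n}=h_1^n$ is a complete homogeneous symmetric function. Binomial coefficients in $\alpha$ are polynomials in $\alpha$. $A(n,k)$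 is the Eulerian number, the number of permutations in $S_n$ with exactly $k$ descents (positions $i$ with $\pi_i>\pi_{i+1}$). $S(n,k)$ is the Stirling number of the second kind, the number of partitions of an $n$-element set into $k$ nonempty blocks. -}

module Defs where

open import Algebra.Bundles using (CommutativeRing)
open import Data.Bool.Base using (if_then_else_)
open import Data.Empty using (⊥-elim)
open import Data.Integer.Base using (+_)
open import Data.List.Base
  using ( List; []; _∷_; _∷ʳ_; _++_; map; foldr; length; reverse; replicate; take; upTo; downFrom
        ; filter; concatMap; cartesianProductWith)
open import Data.List.Membership.Propositional using (_∈_)
open import Data.List.Membership.Propositional.Properties using (∈-upTo⁻)
import Data.List.Properties as Listₚ
open import Data.List.Relation.Binary.Permutation.Propositional as Perm using (_↭_)
import Data.List.Relation.Binary.Permutation.Propositional.Properties as Permₚ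
import Data.List.Relation.Binary.Equality.Propositional as ListEq
open import Data.List.Relation.Unary.All as All using (All; []; _∷_)
import Data.List.Relation.Unary.All.Properties as Allₚ
open import Data.List.Relation.Unary.Any using (here; there)
open import Data.List.Relation.Unary.Linked using (Linked; []; [-]; _∷_)
import Data.List.Relation.Unary.Sorted.TotalOrder.Properties as Sortedₚ
import Data.List.Sort as Sort
open import Data.Nat.Base as ℕ using (ℕ; zero; suc; _≤_; _<_; _≥_; _!; _<ᵇ_; _∸_; z≤n; s≤s)
open import Data.Nat.ListAction using (sum; product)
open import Data.Nat.ListAction.Properties using (sum-↭)
import Data.Nat.Properties as ℕₚ
open import Data.Product using (_×_; _,_)
open import Data.Rational.Base as ℚ using (ℚ; 0ℚ; 1ℚ)
import Data.Rational.Properties as ℚₚ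
open import Data.Sum using (_⊎_; inj₁; inj₂)
open import Function.Base using (_∘_; case_of_)
open import Level using (0ℓ)
open import Relation.Binary.Bundles using (DecTotalOrder)
import Relation.Binary.Construct.Flip.EqAndOrd as Flip
open import Relation.Binary.PropositionalEquality as ≡ using (_≡_; _≢_; refl)
open import Relation.Nullary using (¬_; Dec; yes; no; does)
open import Relation.Nullary.Decidable using (dec-false)

-- ℚ[α]: lists of coefficients, constant term first; trailing zeros are allowed.
Poly : Set
Poly = List ℚ

coeff : Poly → ℕ → ℚ
coeff []      _       = 0ℚ
coeff (a ∷ p) zero    = a
coeff (a ∷ p) (suc i) = coeff p i

infix 4 _≈ₚ_
record _≈ₚ_ (p q : Poly) : Set where
  constructor coeffs
  field at : ∀ i → coeff p i ≡ coeff q i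
open _≈ₚ_

infixl 6 _+ₚ_
infixl 7 _·ₚ_ _*ₚ_
infix  8 -ₚ_

_+ₚ_ : Poly → Poly → Poly
[]      +ₚ q       = q
(a ∷ p) +ₚ []      = a ∷ p
(a ∷ p) +ₚ (b ∷ q) = (a ℚ.+ b) ∷ (p +ₚ q)

-ₚ_ : Poly → Poly
-ₚ p = map (λ a → ℚ.- a) p

_·ₚ_ : ℚ → Poly → Poly
c ·ₚ p = map (c ℚ.*_) p

_*ₚ_ : Poly → Poly → Poly
[]      *ₚ q = []
(a ∷ p) *ₚ q = a ·ₚ q +ₚ (0ℚ ∷ p *ₚ q)

0ₚ 1ₚ Xₚ : Poly
0ₚ = []
1ₚ = 1ℚ ∷ []
Xₚ = 0ℚ ∷ 1ℚ ∷ []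

≈ₚ-refl : ∀ {p} → p ≈ₚ p
≈ₚ-refl = coeffs λ _ → refl

≈ₚ-sym : ∀ {p q} → p ≈ₚ q → q ≈ₚ p
≈ₚ-sym e = coeffs λ i → ≡.sym (at e i)

≈ₚ-trans : ∀ {p q r} → p ≈ₚ q → q ≈ₚ r → p ≈ₚ r
≈ₚ-trans e f = coeffs λ i → ≡.trans (at e i) (at f i)

∷-cong : ∀ {a b p q} → a ≡ b → p ≈ₚ q → a ∷ p ≈ₚ b ∷ q
∷-cong a≡b e = coeffs λ { zero → a≡b ; (suc i) → at e i }

tail-≈ : ∀ {a b p q} → a ∷ p ≈ₚ b ∷ q → p ≈ₚ q
tail-≈ e = coeffs λ i → at e (suc i)

tail-≈[] : ∀ {a p} → a ∷ p ≈ₚ [] → p ≈ₚ []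
tail-≈[] e = coeffs λ i → at e (suc i)

0∷≈[] : ∀ {a p} → a ≡ 0ℚ → p ≈ₚ [] → a ∷ p ≈ₚ []
0∷≈[] a≡0 e = coeffs λ { zero → a≡0 ; (suc i) → at e i }

coeff-+ : ∀ p q i → coeff (p +ₚ q) i ≡ coeff p i ℚ.+ coeff q i
coeff-+ []      q       i       = ≡.sym (ℚₚ.+-identityˡ _)
coeff-+ (a ∷ p) []      i       = ≡.sym (ℚₚ.+-identityʳ _)
coeff-+ (a ∷ p) (b ∷ q) zero    = refl
coeff-+ (a ∷ p) (b ∷ q) (suc i) = coeff-+ p q i

coeff-neg : ∀ p i → coeff (-ₚ p) i ≡ ℚ.- coeff p i
coeff-neg []      i       = refl
coeff-neg (a ∷ p) zero    = refl
coeff-neg (a ∷ p) (suc i) = coeff-neg p i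

coeff-· : ∀ c p i → coeff (c ·ₚ p) i ≡ c ℚ.* coeff p i
coeff-· c []      i       = ≡.sym (ℚₚ.*-zeroʳ c)
coeff-· c (a ∷ p) zero    = refl
coeff-· c (a ∷ p) (suc i) = coeff-· c p i

+ₚ-cong : ∀ {p p′ q q′} → p ≈ₚ p′ → q ≈ₚ q′ → p +ₚ q ≈ₚ p′ +ₚ q′
+ₚ-cong {p} {p′} {q} {q′} e f = coeffs λ i → begin
  coeff (p +ₚ q) i            ≡⟨ coeff-+ p q i ⟩
  coeff p i ℚ.+ coeff q i     ≡⟨ ≡.cong₂ ℚ._+_ (at e i) (at f i) ⟩
  coeff p′ i ℚ.+ coeff q′ i   ≡⟨ coeff-+ p′ q′ i ⟨
  coeff (p′ +ₚ q′) i          ∎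
  where open ≡.≡-Reasoning

+ₚ-assoc : ∀ p q r → (p +ₚ q) +ₚ r ≈ₚ p +ₚ (q +ₚ r)
+ₚ-assoc []      q       r       = ≈ₚ-refl
+ₚ-assoc (a ∷ p) []      r       = ≈ₚ-refl
+ₚ-assoc (a ∷ p) (b ∷ q) []      = ≈ₚ-refl
+ₚ-assoc (a ∷ p) (b ∷ q) (c ∷ r) = ∷-cong (ℚₚ.+-assoc a b c) (+ₚ-assoc p q r)

+ₚ-comm : ∀ p q → p +ₚ q ≈ₚ q +ₚ p
+ₚ-comm []      []      = ≈ₚ-refl
+ₚ-comm []      (b ∷ q) = ≈ₚ-refl
+ₚ-comm (a ∷ p) []      = ≈ₚ-refl
+ₚ-comm (a ∷ p) (b ∷ q) = ∷-cong (ℚₚ.+-comm a b) (+ₚ-comm p q)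

+ₚ-identityʳ : ∀ p → p +ₚ [] ≈ₚ p
+ₚ-identityʳ p = +ₚ-comm p []

-ₚ-cong : ∀ {p q} → p ≈ₚ q → -ₚ p ≈ₚ -ₚ q
-ₚ-cong {p} {q} e = coeffs λ i →
  ≡.trans (coeff-neg p i) (≡.trans (≡.cong (λ a → ℚ.- a) (at e i)) (≡.sym (coeff-neg q i)))

-ₚ-inverseˡ : ∀ p → -ₚ p +ₚ p ≈ₚ []
-ₚ-inverseˡ p = coeffs λ i →
  ≡.trans (coeff-+ (-ₚ p) p i)
    (≡.trans (≡.cong (ℚ._+ coeff p i) (coeff-neg p i)) (ℚₚ.+-inverseˡ (coeff p i)))

·ₚ-cong : ∀ {c d p q} → c ≡ d → p ≈ₚ q → c ·ₚ p ≈ₚ d ·ₚ q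
·ₚ-cong {c} {d} {p} {q} c≡d e = coeffs λ i →
  ≡.trans (coeff-· c p i) (≡.trans (≡.cong₂ ℚ._*_ c≡d (at e i)) (≡.sym (coeff-· d q i)))

·ₚ-distribˡ : ∀ c p q → c ·ₚ (p +ₚ q) ≈ₚ c ·ₚ p +ₚ c ·ₚ q
·ₚ-distribˡ c []      q       = ≈ₚ-refl
·ₚ-distribˡ c (a ∷ p) []      = ≈ₚ-refl
·ₚ-distribˡ c (a ∷ p) (b ∷ q) = ∷-cong (ℚₚ.*-distribˡ-+ c a b) (·ₚ-distribˡ c p q)

·ₚ-assoc : ∀ c d p → (c ℚ.* d) ·ₚ p ≈ₚ c ·ₚ (d ·ₚ p)
·ₚ-assoc c d []      = ≈ₚ-refl
·ₚ-assoc c d (a ∷ p) = ∷-cong (ℚₚ.*-assoc c d a) (·ₚ-assoc c d p)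

·ₚ-zeroˡ : ∀ p → 0ℚ ·ₚ p ≈ₚ []
·ₚ-zeroˡ []      = ≈ₚ-refl
·ₚ-zeroˡ (a ∷ p) = 0∷≈[] (ℚₚ.*-zeroˡ a) (·ₚ-zeroˡ p)

·ₚ-identityˡ : ∀ p → 1ℚ ·ₚ p ≈ₚ p
·ₚ-identityˡ []      = ≈ₚ-refl
·ₚ-identityˡ (a ∷ p) = ∷-cong (ℚₚ.*-identityˡ a) (·ₚ-identityˡ p)

+ₚ-interchange : ∀ p q r s → (p +ₚ q) +ₚ (r +ₚ s) ≈ₚ (p +ₚ r) +ₚ (q +ₚ s)
+ₚ-interchange p q r s =
  ≈ₚ-trans (+ₚ-assoc p q (r +ₚ s))
  (≈ₚ-trans (+ₚ-cong (≈ₚ-refl {p})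
    (≈ₚ-trans (≈ₚ-sym (+ₚ-assoc q r s))
    (≈ₚ-trans (+ₚ-cong (+ₚ-comm q r) ≈ₚ-refl) (+ₚ-assoc r q s))))
  (≈ₚ-sym (+ₚ-assoc p r (q +ₚ s))))

*ₚ-congʳ : ∀ p {q q′} → q ≈ₚ q′ → p *ₚ q ≈ₚ p *ₚ q′
*ₚ-congʳ []      e = ≈ₚ-refl
*ₚ-congʳ (a ∷ p) e = +ₚ-cong (·ₚ-cong {c = a} refl e) (∷-cong refl (*ₚ-congʳ p e))

*ₚ-zeroʳ : ∀ p → p *ₚ [] ≈ₚ []
*ₚ-zeroʳ []      = ≈ₚ-refl
*ₚ-zeroʳ (a ∷ p) = 0∷≈[] refl (*ₚ-zeroʳ p)

*ₚ-∷ : ∀ p b q → p *ₚ (b ∷ q) ≈ₚ b ·ₚ p +ₚ (0ℚ ∷ p *ₚ q)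
*ₚ-∷ []      b q = coeffs λ { zero → refl ; (suc i) → refl }
*ₚ-∷ (a ∷ p) b q = ∷-cong (≡.cong (ℚ._+ 0ℚ) (ℚₚ.*-comm a b))
  (≈ₚ-trans (+ₚ-cong (≈ₚ-refl {a ·ₚ q}) (*ₚ-∷ p b q))
  (≈ₚ-trans (≈ₚ-sym (+ₚ-assoc (a ·ₚ q) (b ·ₚ p) _))
  (≈ₚ-trans (+ₚ-cong (+ₚ-comm (a ·ₚ q) (b ·ₚ p)) ≈ₚ-refl)
  (+ₚ-assoc (b ·ₚ p) (a ·ₚ q) _))))

*ₚ-comm : ∀ p q → p *ₚ q ≈ₚ q *ₚ p
*ₚ-comm []      q = ≈ₚ-sym (*ₚ-zeroʳ q)
*ₚ-comm (a ∷ p) q =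
  ≈ₚ-trans (+ₚ-cong (≈ₚ-refl {a ·ₚ q}) (∷-cong refl (*ₚ-comm p q))) (≈ₚ-sym (*ₚ-∷ q a p))

*ₚ-cong : ∀ {p p′ q q′} → p ≈ₚ p′ → q ≈ₚ q′ → p *ₚ q ≈ₚ p′ *ₚ q′
*ₚ-cong {p} {p′} {q} {q′} e f =
  ≈ₚ-trans (*ₚ-congʳ p f)
  (≈ₚ-trans (*ₚ-comm p q′) (≈ₚ-trans (*ₚ-congʳ q′ e) (*ₚ-comm q′ p′)))

*ₚ-distribˡ : ∀ p q r → p *ₚ (q +ₚ r) ≈ₚ p *ₚ q +ₚ p *ₚ r
*ₚ-distribˡ []      q r = ≈ₚ-refl
*ₚ-distribˡ (a ∷ p) q r =
  ≈ₚ-trans (+ₚ-cong (·ₚ-distribˡ a q r) (∷-cong refl (*ₚ-distribˡ p q r)))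
           (+ₚ-interchange (a ·ₚ q) (a ·ₚ r) (0ℚ ∷ p *ₚ q) (0ℚ ∷ p *ₚ r))

*ₚ-distribʳ : ∀ p q r → (q +ₚ r) *ₚ p ≈ₚ q *ₚ p +ₚ r *ₚ p
*ₚ-distribʳ p q r =
  ≈ₚ-trans (*ₚ-comm (q +ₚ r) p)
  (≈ₚ-trans (*ₚ-distribˡ p q r) (+ₚ-cong (*ₚ-comm p q) (*ₚ-comm p r)))

·ₚ-*ₚ : ∀ c p q → (c ·ₚ p) *ₚ q ≈ₚ c ·ₚ (p *ₚ q)
·ₚ-*ₚ c []      q = ≈ₚ-refl
·ₚ-*ₚ c (a ∷ p) q =
  ≈ₚ-trans (+ₚ-cong (·ₚ-assoc c a q) (∷-cong (≡.sym (ℚₚ.*-zeroʳ c)) (·ₚ-*ₚ c p q)))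
           (≈ₚ-sym (·ₚ-distribˡ c (a ·ₚ q) (0ℚ ∷ p *ₚ q)))

0∷-*ₚ : ∀ p q → (0ℚ ∷ p) *ₚ q ≈ₚ 0ℚ ∷ p *ₚ q
0∷-*ₚ p q = +ₚ-cong (·ₚ-zeroˡ q) ≈ₚ-refl

*ₚ-assoc : ∀ p q r → (p *ₚ q) *ₚ r ≈ₚ p *ₚ (q *ₚ r)
*ₚ-assoc []      q r = ≈ₚ-refl
*ₚ-assoc (a ∷ p) q r =
  ≈ₚ-trans (*ₚ-distribʳ r (a ·ₚ q) (0ℚ ∷ p *ₚ q))
  (+ₚ-cong (·ₚ-*ₚ a q r)
           (≈ₚ-trans (0∷-*ₚ (p *ₚ q) r) (∷-cong refl (*ₚ-assoc p q r))))

*ₚ-identityˡ : ∀ p → 1ₚ *ₚ p ≈ₚ p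
*ₚ-identityˡ p =
  ≈ₚ-trans (+ₚ-cong (·ₚ-identityˡ p) (0∷≈[] refl ≈ₚ-refl)) (+ₚ-identityʳ p)

ℚ[α] : CommutativeRing 0ℓ 0ℓ
ℚ[α] = record
  { Carrier = Poly ; _≈_ = _≈ₚ_ ; _+_ = _+ₚ_ ; _*_ = _*ₚ_ ; -_ = -ₚ_ ; 0# = 0ₚ ; 1# = 1ₚ
  ; isCommutativeRing = record
    { isRing = record
      { +-isAbelianGroup = record
        { isGroup = record
          { isMonoid = record
            { isSemigroup = record
              { isMagma = record
                { isEquivalence = record { refl = ≈ₚ-refl ; sym = ≈ₚ-sym ; trans = ≈ₚ-trans }
                ; ∙-cong        = +ₚ-cong }
              ; assoc = +ₚ-assoc }
            ; identity = (λ _ → ≈ₚ-refl) , +ₚ-identityʳ }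
          ; inverse = -ₚ-inverseˡ , λ p → ≈ₚ-trans (+ₚ-comm p (-ₚ p)) (-ₚ-inverseˡ p)
          ; ⁻¹-cong = -ₚ-cong }
        ; comm = +ₚ-comm }
      ; *-cong     = *ₚ-cong
      ; *-assoc    = *ₚ-assoc
      ; *-identity = *ₚ-identityˡ , λ p → ≈ₚ-trans (*ₚ-comm p 1ₚ) (*ₚ-identityˡ p)
      ; distrib    = *ₚ-distribˡ , *ₚ-distribʳ }
    ; *-comm = *ₚ-comm } }

private
  module P = CommutativeRing ℚ[α]

*ₚ-zero-product : ∀ p q → p *ₚ q ≈ₚ 0ₚ → p ≈ₚ 0ₚ ⊎ q ≈ₚ 0ₚ
*ₚ-zero-product []      q e = inj₁ ≈ₚ-refl
*ₚ-zero-product (a ∷ p) q e with a ℚₚ.≟ 0ℚ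
... | yes refl = case *ₚ-zero-product p q (tail-≈[] (≈ₚ-trans (≈ₚ-sym (0∷-*ₚ p q)) e)) of λ where
  (inj₁ p≈0) → inj₁ (0∷≈[] refl p≈0)
  (inj₂ q≈0) → inj₂ q≈0
... | no a≢0 = inj₂ (cancel q e)
  where
  head-zero : ∀ b → a ℚ.* b ℚ.+ 0ℚ ≡ 0ℚ → b ≡ 0ℚ
  head-zero b eq = begin
    b                       ≡⟨ ℚₚ.*-identityˡ b ⟨
    1ℚ ℚ.* b                ≡⟨ ≡.cong (ℚ._* b) (ℚₚ.*-inverseˡ a) ⟨
    (ℚ.1/ a) ℚ.* a ℚ.* b    ≡⟨ ℚₚ.*-assoc (ℚ.1/ a) a b ⟩
    (ℚ.1/ a) ℚ.* (a ℚ.* b)  ≡⟨ ≡.cong ((ℚ.1/ a) ℚ.*_) (≡.trans (≡.sym (ℚₚ.+-identityʳ _)) eq) ⟩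
    (ℚ.1/ a) ℚ.* 0ℚ         ≡⟨ ℚₚ.*-zeroʳ (ℚ.1/ a) ⟩
    0ℚ                      ∎
    where
    open ≡.≡-Reasoning
    instance
      a-nonZero : ℚ.NonZero a
      a-nonZero = ℚ.≢-nonZero a≢0

  cancel : ∀ q → (a ∷ p) *ₚ q ≈ₚ 0ₚ → q ≈ₚ 0ₚ
  cancel []      e = ≈ₚ-refl
  cancel (b ∷ q) e with head-zero b (at e 0)
  ... | refl = 0∷≈[] refl (cancel q (tail-≈[]
          (≈ₚ-trans (≈ₚ-sym (≈ₚ-trans (*ₚ-∷ (a ∷ p) 0ℚ q) (+ₚ-cong (·ₚ-zeroˡ (a ∷ p)) ≈ₚ-refl))) e)))

*ₚ-cancelʳ : ∀ p q r → ¬ r ≈ₚ 0ₚ → p *ₚ r ≈ₚ q *ₚ r → p ≈ₚ q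
*ₚ-cancelʳ p q r r≉0 e with *ₚ-zero-product (p P.- q) r difference
  where
  open import Algebra.Properties.Ring P.ring using (-‿distribˡ-*)
  difference : (p P.- q) *ₚ r ≈ₚ 0ₚ
  difference = P.trans (P.distribʳ r p (-ₚ q))
    (P.trans (P.+-cong e (P.sym (-‿distribˡ-* q r))) (P.-‿inverseʳ (q *ₚ r)))
... | inj₁ d≈0 = x∙y⁻¹≈ε⇒x≈y p q d≈0
  where open import Algebra.Properties.Group P.+-group using (x∙y⁻¹≈ε⇒x≈y)
... | inj₂ r≈0 = ⊥-elim (r≉0 r≈0)

-- ℚ(α), as fractions up to cross-multiplication.
record RatFun : Set where
  constructor mkRat
  field
    num den : Poly
    den≉0   : ¬ den ≈ₚ 0ₚ
open RatFun

infix 4 _≈_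
record _≈_ (x y : RatFun) : Set where
  constructor cross
  field uncross : num x *ₚ den y ≈ₚ num y *ₚ den x
open _≈_

infixl 6 _+_
infixl 7 _*_
infix  8 -_

*ₚ-≉0 : ∀ {p q} → ¬ p ≈ₚ 0ₚ → ¬ q ≈ₚ 0ₚ → ¬ p *ₚ q ≈ₚ 0ₚ
*ₚ-≉0 {p} {q} p≉0 q≉0 e with *ₚ-zero-product p q e
... | inj₁ p≈0 = p≉0 p≈0
... | inj₂ q≈0 = q≉0 q≈0

1ₚ≉0 : ¬ 1ₚ ≈ₚ 0ₚ
1ₚ≉0 e with at e 0
... | ()

-- Opaque so that unification treats _+_, _*_ and -_ as neutral.
opaque
  _+_ : RatFun → RatFun → RatFun
  x + y = mkRat (num x *ₚ den y +ₚ num y *ₚ den x) (den x *ₚ den y) (*ₚ-≉0 (den≉0 x) (den≉0 y))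

  _*_ : RatFun → RatFun → RatFun
  x * y = mkRat (num x *ₚ num y) (den x *ₚ den y) (*ₚ-≉0 (den≉0 x) (den≉0 y))

  -_ : RatFun → RatFun
  - x = mkRat (-ₚ num x) (den x) (den≉0 x)

polynomial : Poly → RatFun
polynomial p = mkRat p 1ₚ 1ₚ≉0

constant : ℚ → RatFun
constant c = polynomial (c ∷ [])

0# 1# α : RatFun
0# = polynomial 0ₚ
1# = polynomial 1ₚ
α  = polynomial Xₚ

private
  module PolySolver where
    open import Algebra.Solver.Ring.NaturalCoefficients.Default P.commutativeSemiring public
      using (solve; _:=_; _:+_; _:*_)
  open PolySolver

≈-refl : ∀ {x} → x ≈ x
≈-refl = cross P.refl

≈-sym : ∀ {x y} → x ≈ y → y ≈ x
≈-sym e = cross (P.sym (uncross e))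

≈-trans : ∀ {x y z} → x ≈ y → y ≈ z → x ≈ z
≈-trans {mkRat a b _} {mkRat c d d≉0} {mkRat e f _} (cross p) (cross q) =
  cross (*ₚ-cancelʳ (a *ₚ f) (e *ₚ b) d d≉0 (begin
    (a *ₚ f) *ₚ d  ≈⟨ solve 3 (λ a f d → (a :* f) :* d := (a :* d) :* f) P.refl a f d ⟩
    (a *ₚ d) *ₚ f  ≈⟨ P.*-congʳ p ⟩
    (c *ₚ b) *ₚ f  ≈⟨ solve 3 (λ c b f → (c :* b) :* f := (c :* f) :* b) P.refl c b f ⟩
    (c *ₚ f) *ₚ b  ≈⟨ P.*-congʳ q ⟩
    (e *ₚ d) *ₚ b  ≈⟨ solve 3 (λ e d b → (e :* d) :* b := (e :* b) :* d) P.refl e d b ⟩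
    (e *ₚ b) *ₚ d  ∎))
  where open import Relation.Binary.Reasoning.Setoid P.setoid

opaque
  unfolding _+_ _*_ -_

  +-cong : ∀ {x x′ y y′} → x ≈ x′ → y ≈ y′ → x + y ≈ x′ + y′
  +-cong {mkRat a b _} {mkRat a′ b′ _} {mkRat c d _} {mkRat c′ d′ _} (cross p) (cross q) = cross (begin
    (a *ₚ d +ₚ c *ₚ b) *ₚ (b′ *ₚ d′)
      ≈⟨ solve 6 (λ a b c d b′ d′ → (a :* d :+ c :* b) :* (b′ :* d′)
                    := (a :* b′) :* (d :* d′) :+ (c :* d′) :* (b :* b′)) P.refl a b c d b′ d′ ⟩
    (a *ₚ b′) *ₚ (d *ₚ d′) +ₚ (c *ₚ d′) *ₚ (b *ₚ b′)
      ≈⟨ P.+-cong (P.*-congʳ p) (P.*-congʳ q) ⟩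
    (a′ *ₚ b) *ₚ (d *ₚ d′) +ₚ (c′ *ₚ d) *ₚ (b *ₚ b′)
      ≈⟨ solve 6 (λ a′ b′ c′ d′ b d → (a′ :* b) :* (d :* d′) :+ (c′ :* d) :* (b :* b′)
                    := (a′ :* d′ :+ c′ :* b′) :* (b :* d)) P.refl a′ b′ c′ d′ b d ⟩
    (a′ *ₚ d′ +ₚ c′ *ₚ b′) *ₚ (b *ₚ d) ∎)
    where open import Relation.Binary.Reasoning.Setoid P.setoid

  *-cong : ∀ {x x′ y y′} → x ≈ x′ → y ≈ y′ → x * y ≈ x′ * y′
  *-cong {mkRat a b _} {mkRat a′ b′ _} {mkRat c d _} {mkRat c′ d′ _} (cross p) (cross q) = cross (begin
    (a *ₚ c) *ₚ (b′ *ₚ d′)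
      ≈⟨ solve 4 (λ a c b′ d′ → (a :* c) :* (b′ :* d′) := (a :* b′) :* (c :* d′)) P.refl a c b′ d′ ⟩
    (a *ₚ b′) *ₚ (c *ₚ d′)    ≈⟨ P.*-cong p q ⟩
    (a′ *ₚ b) *ₚ (c′ *ₚ d)
      ≈⟨ solve 4 (λ a′ b c′ d → (a′ :* b) :* (c′ :* d) := (a′ :* c′) :* (b :* d)) P.refl a′ b c′ d ⟩
    (a′ *ₚ c′) *ₚ (b *ₚ d) ∎)
    where open import Relation.Binary.Reasoning.Setoid P.setoid

  -‿cong : ∀ {x y} → x ≈ y → - x ≈ - y
  -‿cong {mkRat a b _} {mkRat c d _} (cross p) = cross
    (P.trans (P.sym (-‿distribˡ-* a d)) (P.trans (P.-‿cong p) (-‿distribˡ-* c b)))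
    where open import Algebra.Properties.Ring P.ring using (-‿distribˡ-*)

  +-assoc : ∀ x y z → (x + y) + z ≈ x + (y + z)
  +-assoc (mkRat a b _) (mkRat c d _) (mkRat e f _) = cross (solve 6 (λ a b c d e f →
    ((a :* d :+ c :* b) :* f :+ e :* (b :* d)) :* (b :* (d :* f))
      := (a :* (d :* f) :+ (c :* f :+ e :* d) :* b) :* ((b :* d) :* f)) P.refl a b c d e f)

  +-comm : ∀ x y → x + y ≈ y + x
  +-comm (mkRat a b _) (mkRat c d _) = cross (solve 4 (λ a b c d →
    (a :* d :+ c :* b) :* (d :* b) := (c :* b :+ a :* d) :* (b :* d)) P.refl a b c d)

  +-identityˡ : ∀ x → 0# + x ≈ x
  +-identityˡ (mkRat a b _) = cross (P.*-cong (P.*-identityʳ a) (P.sym (P.*-identityˡ b)))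

  -‿inverseˡ : ∀ x → - x + x ≈ 0#
  -‿inverseˡ (mkRat a b _) = cross (P.trans (P.*-identityʳ (-ₚ a *ₚ b +ₚ a *ₚ b))
    (P.trans (P.sym (P.distribʳ b (-ₚ a) a)) (P.trans (P.*-congʳ (P.-‿inverseˡ a)) (P.zeroˡ b))))

  *-assoc : ∀ x y z → (x * y) * z ≈ x * (y * z)
  *-assoc (mkRat a b _) (mkRat c d _) (mkRat e f _) = cross (solve 6 (λ a b c d e f →
    ((a :* c) :* e) :* (b :* (d :* f)) := (a :* (c :* e)) :* ((b :* d) :* f)) P.refl a b c d e f)

  *-comm : ∀ x y → x * y ≈ y * x
  *-comm (mkRat a b _) (mkRat c d _) = cross (solve 4 (λ a b c d →
    (a :* c) :* (d :* b) := (c :* a) :* (b :* d)) P.refl a b c d)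

  *-identityˡ : ∀ x → 1# * x ≈ x
  *-identityˡ (mkRat a b _) = cross (P.*-cong (P.*-identityˡ a) (P.sym (P.*-identityˡ b)))

  *-distribˡ : ∀ x y z → x * (y + z) ≈ x * y + x * z
  *-distribˡ (mkRat a b _) (mkRat c d _) (mkRat e f _) = cross (solve 6 (λ a b c d e f →
    (a :* (c :* f :+ e :* d)) :* ((b :* d) :* (b :* f))
      := ((a :* c) :* (b :* f) :+ (a :* e) :* (b :* d)) :* (b :* (d :* f))) P.refl a b c d e f)

ℚ⟨α⟩ : CommutativeRing 0ℓ 0ℓ
ℚ⟨α⟩ = record
  { Carrier = RatFun ; _≈_ = _≈_ ; _+_ = _+_ ; _*_ = _*_ ; -_ = -_ ; 0# = 0# ; 1# = 1#
  ; isCommutativeRing = record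
    { isRing = record
      { +-isAbelianGroup = record
        { isGroup = record
          { isMonoid = record
            { isSemigroup = record
              { isMagma = record
                { isEquivalence = record { refl = ≈-refl ; sym = ≈-sym ; trans = ≈-trans }
                ; ∙-cong        = +-cong }
              ; assoc = +-assoc }
            ; identity = +-identityˡ , λ x → ≈-trans (+-comm x 0#) (+-identityˡ x) }
          ; inverse = -‿inverseˡ , λ x → ≈-trans (+-comm x (- x)) (-‿inverseˡ x)
          ; ⁻¹-cong = -‿cong }
        ; comm = +-comm }
      ; *-cong     = *-cong
      ; *-assoc    = *-assoc
      ; *-identity = *-identityˡ , λ x → ≈-trans (*-comm x 1#) (*-identityˡ x)
      ; distrib    = *-distribˡ , λ x y z → ≈-trans (*-comm (y + z) x)
          (≈-trans (*-distribˡ x y z) (+-cong (*-comm x y) (*-comm x z))) }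
    ; *-comm = *-comm } }

private
  module K = CommutativeRing ℚ⟨α⟩
  module K-Reasoning where
    open import Relation.Binary.Reasoning.Setoid K.setoid public

infixl 6 _-_
_-_ : RatFun → RatFun → RatFun
_-_ = K._-_

open import Algebra.Properties.Semiring.Exp K.semiring public using (_^_)
open import Algebra.Properties.Semiring.Mult K.semiring using () renaming (_×_ to _times_)

fromℕ : ℕ → RatFun
fromℕ n = n times 1#

num≉0 : ∀ x → ¬ x ≈ 0# → ¬ num x ≈ₚ 0ₚ
num≉0 x x≉0 e = x≉0 (cross (P.trans (P.*-identityʳ (num x)) e))

inverse : (x : RatFun) → ¬ x ≈ 0# → RatFun
inverse x x≉0 = mkRat (den x) (num x) (num≉0 x x≉0)

opaque
  unfolding _*_

  *-inverse : ∀ x x≉0 → x * inverse x x≉0 ≈ 1#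
  *-inverse (mkRat a b _) _ = cross (P.trans (P.*-identityʳ (a *ₚ b))
    (P.trans (P.*-comm a b) (P.sym (P.*-identityˡ (b *ₚ a)))))

α≉0 : ¬ α ≈ 0#
α≉0 e with at (uncross e) 1
... | ()

α⁻¹ : RatFun
α⁻¹ = inverse α α≉0

-- The value p(1/α) of the polynomial p, by Horner's rule.
at-α⁻¹ : Poly → RatFun
at-α⁻¹ []      = 0#
at-α⁻¹ (a ∷ p) = constant a + α⁻¹ * at-α⁻¹ p

polynomial-cong : ∀ {p q} → p ≈ₚ q → polynomial p ≈ polynomial q
polynomial-cong e = cross (P.*-congʳ e)

opaque
  unfolding _+_ _*_

  polynomial-+ : ∀ p q → polynomial (p +ₚ q) ≈ polynomial p + polynomial q
  polynomial-+ p q = cross (P.*-cong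
    (P.sym (P.+-cong (P.*-identityʳ p) (P.*-identityʳ q))) (P.*-identityˡ 1ₚ))

  polynomial-* : ∀ p q → polynomial (p *ₚ q) ≈ polynomial p * polynomial q
  polynomial-* p q = cross (P.*-congˡ {p *ₚ q} (P.*-identityˡ 1ₚ))

polynomial-injective : ∀ {p q} → polynomial p ≈ polynomial q → p ≈ₚ q
polynomial-injective {p} {q} (cross e) =
  P.trans (P.sym (P.*-identityʳ p)) (P.trans e (P.*-identityʳ q))

α*polynomial : ∀ p → α * polynomial p ≈ polynomial (0ℚ ∷ p)
α*polynomial p = K.trans (K.sym (polynomial-* Xₚ p))
  (polynomial-cong (P.trans (0∷-*ₚ 1ₚ p) (∷-cong refl (P.*-identityˡ p))))

α*α⁻¹ : ∀ x → α * (α⁻¹ * x) ≈ x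
α*α⁻¹ x = K.trans (K.sym (K.*-assoc α α⁻¹ x))
  (K.trans (K.*-congʳ (*-inverse α α≉0)) (K.*-identityˡ x))

constant-* : ∀ a b → constant (a ℚ.* b) ≈ constant a * constant b
constant-* a b = K.trans (polynomial-cong (∷-cong (≡.sym (ℚₚ.+-identityʳ _)) P.refl))
  (polynomial-* (a ∷ []) (b ∷ []))

private
  module RatSolver where
    open import Algebra.Solver.Ring.NaturalCoefficients.Default K.commutativeSemiring public
      using () renaming (solve to solveK; _:=_ to _⊜_; _:+_ to _⊕_; _:*_ to _⊗_)
  open RatSolver

at-≈[] : ∀ p → p ≈ₚ [] → at-α⁻¹ p ≈ 0#
at-≈[] []      e = K.refl
at-≈[] (a ∷ p) e = K.trans
  (K.+-cong (polynomial-cong (0∷≈[] (at e 0) P.refl))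
            (K.trans (K.*-congˡ {α⁻¹} (at-≈[] p (tail-≈[] e))) (K.zeroʳ α⁻¹)))
  (K.+-identityˡ 0#)

at-cong : ∀ {p q} → p ≈ₚ q → at-α⁻¹ p ≈ at-α⁻¹ q
at-cong {[]}    {q}     e = K.sym (at-≈[] q (P.sym e))
at-cong {a ∷ p} {[]}    e = at-≈[] (a ∷ p) e
at-cong {a ∷ p} {b ∷ q} e =
  K.+-cong (polynomial-cong (∷-cong (at e 0) P.refl)) (K.*-congˡ (at-cong (tail-≈ e)))

at-+ : ∀ p q → at-α⁻¹ (p +ₚ q) ≈ at-α⁻¹ p + at-α⁻¹ q
at-+ []      q       = K.sym (K.+-identityˡ _)
at-+ (a ∷ p) []      = K.sym (K.+-identityʳ _)
at-+ (a ∷ p) (b ∷ q) = K.trans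
  (K.+-cong (polynomial-+ (a ∷ []) (b ∷ [])) (K.*-congˡ {α⁻¹} (at-+ p q)))
  (solveK 5 (λ a b x u v → (a ⊕ b) ⊕ x ⊗ (u ⊕ v) ⊜ (a ⊕ x ⊗ u) ⊕ (b ⊕ x ⊗ v))
   K.refl (constant a) (constant b) α⁻¹ (at-α⁻¹ p) (at-α⁻¹ q))

at-· : ∀ c p → at-α⁻¹ (c ·ₚ p) ≈ constant c * at-α⁻¹ p
at-· c []      = K.sym (K.zeroʳ (constant c))
at-· c (a ∷ p) = K.trans
  (K.+-cong (constant-* c a) (K.*-congˡ {α⁻¹} (at-· c p)))
  (solveK 4 (λ c a x u → c ⊗ a ⊕ x ⊗ (c ⊗ u) ⊜ c ⊗ (a ⊕ x ⊗ u))
   K.refl (constant c) (constant a) α⁻¹ (at-α⁻¹ p))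

at-0∷ : ∀ p → at-α⁻¹ (0ℚ ∷ p) ≈ α⁻¹ * at-α⁻¹ p
at-0∷ p = K.trans (K.+-congʳ (polynomial-cong (0∷≈[] refl P.refl))) (K.+-identityˡ _)

at-* : ∀ p q → at-α⁻¹ (p *ₚ q) ≈ at-α⁻¹ p * at-α⁻¹ q
at-* []      q = K.sym (K.zeroˡ _)
at-* (a ∷ p) q = K.trans (at-+ (a ·ₚ q) (0ℚ ∷ p *ₚ q))
  (K.trans (K.+-cong (at-· a q) (K.trans (at-0∷ (p *ₚ q)) (K.*-congˡ (at-* p q))))
  (solveK 4 (λ a x u v → a ⊗ v ⊕ x ⊗ (u ⊗ v) ⊜ (a ⊕ x ⊗ u) ⊗ v)
   K.refl (constant a) α⁻¹ (at-α⁻¹ p) (at-α⁻¹ q)))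

monomial : ℚ → ℕ → Poly
monomial a n = replicate n 0ℚ ++ a ∷ []

α^*constant : ∀ n a → α ^ n * constant a ≈ polynomial (monomial a n)
α^*constant zero    a = K.*-identityˡ _
α^*constant (suc n) a = K.trans (K.*-assoc α (α ^ n) (constant a))
  (K.trans (K.*-congˡ (α^*constant n a)) (α*polynomial (monomial a n)))

∷ʳ-monomial : ∀ p a → monomial a (length p) +ₚ p ≈ₚ p ∷ʳ a
∷ʳ-monomial []      a = ∷-cong refl P.refl
∷ʳ-monomial (b ∷ p) a = ∷-cong (ℚₚ.+-identityˡ b) (∷ʳ-monomial p a)

α^*at : ∀ p → α ^ length p * at-α⁻¹ p ≈ polynomial (0ℚ ∷ reverse p)
α^*at []      = K.trans (K.zeroʳ 1#) (polynomial-cong (P.sym (0∷≈[] refl P.refl)))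
α^*at (a ∷ p) = begin
  α ^ n′ * (constant a + α⁻¹ * v)
    ≈⟨ K.distribˡ (α ^ n′) (constant a) (α⁻¹ * v) ⟩
  α ^ n′ * constant a + α ^ n′ * (α⁻¹ * v)
    ≈⟨ K.+-cong (α^*constant n′ a) (begin
         (α * α ^ n) * (α⁻¹ * v)   ≈⟨ solveK 4 (λ x y z w → (x ⊗ y) ⊗ (z ⊗ w) ⊜ y ⊗ (x ⊗ (z ⊗ w)))
                                      K.refl α (α ^ n) α⁻¹ v ⟩
         α ^ n * (α * (α⁻¹ * v))   ≈⟨ K.*-congˡ (α*α⁻¹ v) ⟩
         α ^ n * v                 ≈⟨ α^*at p ⟩
         polynomial (0ℚ ∷ reverse p) ∎) ⟩
  polynomial (monomial a n′) + polynomial (0ℚ ∷ reverse p)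
    ≈⟨ polynomial-+ (monomial a n′) (0ℚ ∷ reverse p) ⟨
  polynomial (monomial a n′ +ₚ (0ℚ ∷ reverse p))
    ≈⟨ polynomial-cong (∷-cong refl rev) ⟩
  polynomial (0ℚ ∷ reverse (a ∷ p)) ∎
  where
  open K-Reasoning
  n  = length p
  n′ = suc n
  v  = at-α⁻¹ p
  rev : monomial a n +ₚ reverse p ≈ₚ reverse (a ∷ p)
  rev rewrite ≡.sym (Listₚ.length-reverse p) | Listₚ.unfold-reverse a p = ∷ʳ-monomial (reverse p) a

∷ʳ-≈[] : ∀ p a → p ∷ʳ a ≈ₚ [] → a ≡ 0ℚ × p ≈ₚ []
∷ʳ-≈[] []      a e = at e 0 , P.refl
∷ʳ-≈[] (b ∷ p) a e with ∷ʳ-≈[] p a (tail-≈[] e)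
... | a≡0 , p≈0 = a≡0 , 0∷≈[] (at e 0) p≈0

reverse-≈[] : ∀ p → reverse p ≈ₚ [] → p ≈ₚ []
reverse-≈[] []      e = P.refl
reverse-≈[] (a ∷ p) e rewrite Listₚ.unfold-reverse a p with ∷ʳ-≈[] (reverse p) a e
... | a≡0 , r≈0 = 0∷≈[] a≡0 (reverse-≈[] p r≈0)

at-≉0 : ∀ {p} → ¬ p ≈ₚ 0ₚ → ¬ at-α⁻¹ p ≈ 0#
at-≉0 {p} p≉0 e = p≉0 (reverse-≈[] p (tail-≈[] (polynomial-injective
  (K.trans (K.sym (α^*at p)) (K.trans (K.*-congˡ {α ^ length p} e) (K.zeroʳ _))))))

invert-α : RatFun → RatFun
invert-α x = at-α⁻¹ (num x) * inverse (at-α⁻¹ (den x)) (at-≉0 (den≉0 x))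

invert-α-cong : ∀ {x y} → x ≈ y → invert-α x ≈ invert-α y
invert-α-cong {mkRat a b b≉0} {mkRat c d d≉0} (cross e) = begin
  A * B⁻¹              ≈⟨ K.*-identityʳ _ ⟨
  (A * B⁻¹) * 1#       ≈⟨ K.*-congˡ (*-inverse D (at-≉0 d≉0)) ⟨
  (A * B⁻¹) * (D * D⁻¹)  ≈⟨ solveK 4 (λ a b d d′ → (a ⊗ b) ⊗ (d ⊗ d′) ⊜ (a ⊗ d) ⊗ (b ⊗ d′))
                            K.refl A B⁻¹ D D⁻¹ ⟩
  (A * D) * (B⁻¹ * D⁻¹)  ≈⟨ K.*-congʳ (K.trans (K.sym (at-* a d)) (K.trans (at-cong e) (at-* c b))) ⟩
  (C * B) * (B⁻¹ * D⁻¹)  ≈⟨ solveK 4 (λ c b b′ d′ → (c ⊗ b) ⊗ (b′ ⊗ d′) ⊜ (c ⊗ d′) ⊗ (b ⊗ b′))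
                            K.refl C B B⁻¹ D⁻¹ ⟩
  (C * D⁻¹) * (B * B⁻¹)  ≈⟨ K.*-congˡ (*-inverse B (at-≉0 b≉0)) ⟩
  (C * D⁻¹) * 1#       ≈⟨ K.*-identityʳ _ ⟩
  C * D⁻¹              ∎
  where
  open K-Reasoning
  A = at-α⁻¹ a
  B = at-α⁻¹ b
  C = at-α⁻¹ c
  D = at-α⁻¹ d
  B⁻¹ = inverse B (at-≉0 b≉0)
  D⁻¹ = inverse D (at-≉0 d≉0)

invert-α-0# : ∀ {x} → x ≈ 0# → invert-α x ≈ 0#
invert-α-0# e = K.trans (invert-α-cong e) (K.zeroˡ _)

record Partition : Set where
  field
    parts      : List ℕ
    decreasing : Linked _≥_ parts
    positive   : All (0 <_) parts
open Partition public

∣_∣ : Partition → ℕ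
∣ μ ∣ = sum (parts μ)

ℓ : Partition → ℕ
ℓ μ = length (parts μ)

infix 4 _⊴_
_⊴_ : Partition → Partition → Set
ν ⊴ μ = ∣ ν ∣ ≡ ∣ μ ∣ × (∀ i → sum (take i (parts ν)) ≤ sum (take i (parts μ)))

multiplicity : ℕ → Partition → ℕ
multiplicity i μ = length (filter (i ℕₚ.≟_) (parts μ))

z : Partition → ℕ
z μ = product (map (λ i → i ℕ.^ multiplicity i μ ℕ.* multiplicity i μ !) (map suc (upTo ∣ μ ∣)))

1^_ : ℕ → Partition
1^ n = record { parts = replicate n 1 ; decreasing = ones n ; positive = Allₚ.replicate⁺ n (s≤s z≤n) }
  where
  ones : ∀ n → Linked _≥_ (replicate n 1)
  ones zero          = []
  ones (suc zero)    = [-]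
  ones (suc (suc n)) = s≤s z≤n ∷ ones (suc n)

indicator : {P : Set} → Dec P → RatFun
indicator P? = if does P? then 1# else 0#

indicator-no : {P : Set} (P? : Dec P) → ¬ P → indicator P? ≈ 0#
indicator-no (yes p) ¬p = ⊥-elim (¬p p)
indicator-no (no _)  ¬p = K.refl

δ : List ℕ → List ℕ → RatFun
δ a b = indicator (Listₚ.≡-dec ℕₚ._≟_ a b)

∑ : {A : Set} → List A → (A → RatFun) → RatFun
∑ xs f = foldr (λ x s → f x + s) 0# xs

∑-cong : {A : Set} (xs : List A) {f g : A → RatFun} → (∀ x → f x ≈ g x) → ∑ xs f ≈ ∑ xs g
∑-cong []       e = K.refl
∑-cong (x ∷ xs) e = K.+-cong (e x) (∑-cong xs e)

∑-zero : {A : Set} (xs : List A) {f : A → RatFun} → (∀ x → x ∈ xs → f x ≈ 0#) → ∑ xs f ≈ 0#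
∑-zero []       e = K.refl
∑-zero (x ∷ xs) e = K.trans (K.+-cong (e x (here refl)) (∑-zero xs λ y y∈ → e y (there y∈)))
                            (K.+-identityˡ 0#)

∑-+ : {A : Set} (xs : List A) (f g : A → RatFun) → ∑ xs (λ x → f x + g x) ≈ ∑ xs f + ∑ xs g
∑-+ []       f g = K.sym (K.+-identityˡ 0#)
∑-+ (x ∷ xs) f g = K.trans (K.+-congˡ (∑-+ xs f g))
  (solveK 4 (λ a b u v → (a ⊕ b) ⊕ (u ⊕ v) ⊜ (a ⊕ u) ⊕ (b ⊕ v)) K.refl (f x) (g x) (∑ xs f) (∑ xs g))

∑-swap : {A B : Set} (xs : List A) (ys : List B) (f : A → B → RatFun) →
         ∑ xs (λ x → ∑ ys (f x)) ≈ ∑ ys (λ y → ∑ xs (λ x → f x y))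
∑-swap []       ys f = K.sym (∑-zero ys λ _ _ → K.refl)
∑-swap (x ∷ xs) ys f = K.trans (K.+-congˡ (∑-swap xs ys f))
  (K.sym (∑-+ ys (f x) (λ y → ∑ xs (λ x → f x y))))

-- The exponent vector (a₁, …, aᵣ) stands for x₁^a₁ ⋯ xᵣ^aᵣ; a series gives the coefficient of
-- each monomial.
Series : Set
Series = List ℕ → RatFun

-- The Cauchy product: (f ⊛ g) a is the sum of f b * g c over all b, c with a = b + c entrywise.
infixl 7 _⊛_
_⊛_ : Series → Series → Series
(f ⊛ g) []      = f [] * g []
(f ⊛ g) (a ∷ e) = ∑ (upTo (suc a)) λ i → ((λ b → f (i ∷ b)) ⊛ (λ c → g (a ∸ i ∷ c))) e

⊛-cong : ∀ {f f′ g g′} → (∀ a → f a ≈ f′ a) → (∀ a → g a ≈ g′ a) → ∀ a → (f ⊛ g) a ≈ (f′ ⊛ g′) a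
⊛-cong p q []      = K.*-cong (p []) (q [])
⊛-cong p q (a ∷ e) = ∑-cong (upTo (suc a)) λ i → ⊛-cong (λ b → p (i ∷ b)) (λ c → q (a ∸ i ∷ c)) e

Symmetric : Series → Set
Symmetric f = ∀ {a b} → a ↭ b → f a ≈ f b

Stable : Series → Set
Stable f = ∀ a → f (a ∷ʳ 0) ≈ f a

VanishesAbove : ℕ → Series → Set
VanishesAbove d f = ∀ a → d < sum a → f a ≈ 0#

⊛-symmetric : ∀ {f g} → Symmetric f → Symmetric g → Symmetric (f ⊛ g)
⊛-symmetric p q Perm.refl = K.refl
⊛-symmetric p q (Perm.prep x r) = ∑-cong (upTo (suc x)) λ i →
  ⊛-symmetric (λ s → p (Perm.prep i s)) (λ s → q (Perm.prep (x ∸ i) s)) r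
⊛-symmetric p q (Perm.swap {xs = xs} x y r) = K.trans
  (∑-swap (upTo (suc x)) (upTo (suc y)) _)
  (∑-cong (upTo (suc y)) λ j → ∑-cong (upTo (suc x)) λ i → K.trans
    (⊛-cong (λ b → p (Perm.swap i j Perm.refl)) (λ c → q (Perm.swap (x ∸ i) (y ∸ j) Perm.refl)) xs)
    (⊛-symmetric (λ s → p (Perm.prep j (Perm.prep i s)))
                 (λ s → q (Perm.prep (y ∸ j) (Perm.prep (x ∸ i) s))) r))
⊛-symmetric p q (Perm.trans r s) = K.trans (⊛-symmetric p q r) (⊛-symmetric p q s)

⊛-stable : ∀ {f g} → Stable f → Stable g → Stable (f ⊛ g)
⊛-stable p q []      = K.trans (K.+-identityʳ _) (K.*-cong (p []) (q []))
⊛-stable p q (a ∷ e) = ∑-cong (upTo (suc a)) λ i →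
  ⊛-stable (λ b → p (i ∷ b)) (λ c → q (a ∸ i ∷ c)) e

⊛-zero : ∀ {f g} a → (∀ b c → sum b ℕ.+ sum c ≡ sum a → f b ≈ 0# ⊎ g c ≈ 0#) → (f ⊛ g) a ≈ 0#
⊛-zero {f} {g} [] p with p [] [] refl
... | inj₁ e = K.trans (K.*-congʳ e) (K.zeroˡ _)
... | inj₂ e = K.trans (K.*-congˡ e) (K.zeroʳ _)
⊛-zero (a ∷ e) p = ∑-zero (upTo (suc a)) λ i i∈ → ⊛-zero e λ b c eq →
  p (i ∷ b) (a ∸ i ∷ c) (begin
    (i ℕ.+ sum b) ℕ.+ (a ∸ i ℕ.+ sum c)  ≡⟨ interchange i (sum b) (a ∸ i) (sum c) ⟩
    (i ℕ.+ (a ∸ i)) ℕ.+ (sum b ℕ.+ sum c) ≡⟨ ≡.cong₂ ℕ._+_ (ℕₚ.m+[n∸m]≡n (ℕ.s≤s⁻¹ (∈-upTo⁻ i∈))) eq ⟩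
    a ℕ.+ sum e ∎)
  where
  open ≡.≡-Reasoning
  open import Algebra.Properties.CommutativeSemigroup ℕₚ.+-commutativeSemigroup using (interchange)

⊛-vanishes : ∀ {d d′ f g} → VanishesAbove d f → VanishesAbove d′ g → VanishesAbove (d ℕ.+ d′) (f ⊛ g)
⊛-vanishes {d} {d′} p q a d+d′<a = ⊛-zero a λ b c eq → case d ℕₚ.<? sum b of λ where
  (yes d<b) → inj₁ (p b d<b)
  (no d≮b)  → inj₂ (q c (ℕₚ.+-cancelˡ-< d _ _ (ℕₚ.<-≤-trans d+d′<a
                 (ℕₚ.≤-trans (ℕₚ.≤-reflexive (≡.sym eq)) (ℕₚ.+-monoˡ-≤ (sum c) (ℕₚ.≮⇒≥ d≮b))))))

record Sym : Set where
  field
    series    : Series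
    symmetric : Symmetric series
    stable    : Stable series
    bound     : ℕ
    bounded   : VanishesAbove bound series
open Sym public

infix 4 _≈ₛ_
_≈ₛ_ : Sym → Sym → Set
f ≈ₛ g = ∀ a → series f a ≈ series g a

-- The coefficient of m_λ is the coefficient of x^λ: no other monomial symmetric function
-- contains x^λ.
[m_]_ : Partition → Sym → RatFun
[m μ ] f = series f (parts μ)

infixl 6 _+ₛ_
infixl 7 _*ₛ_ _·ₛ_

_+ₛ_ : Sym → Sym → Sym
f +ₛ g = record
  { series    = λ a → series f a + series g a
  ; symmetric = λ r → K.+-cong (symmetric f r) (symmetric g r)
  ; stable    = λ a → K.+-cong (stable f a) (stable g a)
  ; bound     = bound f ℕ.⊔ bound g
  ; bounded   = λ a d<a → K.trans
      (K.+-cong (bounded f a (ℕₚ.≤-<-trans (ℕₚ.m≤m⊔n (bound f) (bound g)) d<a))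
                (bounded g a (ℕₚ.≤-<-trans (ℕₚ.m≤n⊔m (bound f) (bound g)) d<a)))
      (K.+-identityˡ 0#) }

_·ₛ_ : RatFun → Sym → Sym
c ·ₛ f = record
  { series    = λ a → c * series f a
  ; symmetric = λ r → K.*-congˡ (symmetric f r)
  ; stable    = λ a → K.*-congˡ (stable f a)
  ; bound     = bound f
  ; bounded   = λ a d<a → K.trans (K.*-congˡ (bounded f a d<a)) (K.zeroʳ c) }

_*ₛ_ : Sym → Sym → Sym
f *ₛ g = record
  { series    = series f ⊛ series g
  ; symmetric = ⊛-symmetric (symmetric f) (symmetric g)
  ; stable    = ⊛-stable {series f} {series g} (stable f) (stable g)
  ; bound     = bound f ℕ.+ bound g
  ; bounded   = ⊛-vanishes (bounded f) (bounded g) }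

≥-decTotalOrder : DecTotalOrder 0ℓ 0ℓ 0ℓ
≥-decTotalOrder = Flip.decTotalOrder ℕₚ.≤-decTotalOrder

open Sort ≥-decTotalOrder using (sort; sort-↭; sort-↗)

-- The parts of the partition whose monomial symmetric function contains x^a.
type : List ℕ → List ℕ
type a = sort (filter (0 ℕₚ.<?_) a)

type-↭ : ∀ {a b} → a ↭ b → type a ≡ type b
type-↭ {a} {b} r = ListEq.≋⇒≡ (Sortedₚ.↗↭↗⇒≋ (DecTotalOrder.totalOrder ≥-decTotalOrder)
  (sort-↗ _) (sort-↗ _) (Perm.↭⇒↭ₛ (begin
    sort (filter (0 ℕₚ.<?_) a)  ↭⟨ sort-↭ _ ⟩
    filter (0 ℕₚ.<?_) a         ↭⟨ Permₚ.filter-↭ (0 ℕₚ.<?_) r ⟩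
    filter (0 ℕₚ.<?_) b         ↭⟨ sort-↭ _ ⟨
    sort (filter (0 ℕₚ.<?_) b)  ∎)))
  where open Perm.PermutationReasoning

type-stable : ∀ a → type (a ∷ʳ 0) ≡ type a
type-stable a = ≡.cong sort
  (≡.trans (Listₚ.filter-++ (0 ℕₚ.<?_) a (0 ∷ [])) (Listₚ.++-identityʳ _))

sum-type : ∀ a → sum (type a) ≡ sum a
sum-type a = ≡.trans (sum-↭ (sort-↭ _)) (sum-filter a)
  where
  sum-filter : ∀ a → sum (filter (0 ℕₚ.<?_) a) ≡ sum a
  sum-filter []          = refl
  sum-filter (zero  ∷ a) = sum-filter a
  sum-filter (suc x ∷ a) = ≡.cong (suc x ℕ.+_) (sum-filter a)

-- The linear combination ∑ c(λ) m_λ of monomial symmetric functions.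
combination : (c : List ℕ → RatFun) (d : ℕ) → VanishesAbove d c → Sym
combination c d v = record
  { series    = λ a → c (type a)
  ; symmetric = λ r → K.reflexive (≡.cong c (type-↭ r))
  ; stable    = λ a → K.reflexive (≡.cong c (type-stable a))
  ; bound     = d
  ; bounded   = λ a d<a → v (type a) (≡.subst (d <_) (≡.sym (sum-type a)) d<a) }

δ-vanishes : ∀ a → VanishesAbove (sum a) (δ a)
δ-vanishes a b a<b = indicator-no (Listₚ.≡-dec ℕₚ._≟_ a b)
  λ a≡b → ℕₚ.<-irrefl (≡.cong sum a≡b) a<b

1ₛ : Sym
1ₛ = combination (δ []) 0 (δ-vanishes [])

-- pₖ = m_(k)
power : ℕ → Sym
power k = combination (δ (k ∷ [])) (sum (k ∷ [])) (δ-vanishes (k ∷ []))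

p : Partition → Sym
p μ = foldr (λ k f → power k *ₛ f) 1ₛ (parts μ)

-- hₖ is the sum of all m_λ with |λ| = k.
complete : ℕ → Sym
complete k = combination (λ μ → indicator (sum μ ℕₚ.≟ k)) k
  λ μ k<μ → indicator-no (sum μ ℕₚ.≟ k) λ μ≡k → ℕₚ.<-irrefl (≡.sym μ≡k) k<μ

h : Partition → Sym
h μ = foldr (λ k f → complete k *ₛ f) 1ₛ (parts μ)

-- Given λ₁ ≥ λ₂ ≥ … ≥ λₙ, all μ with λ₁ ≥ μ₁ ≥ λ₂ ≥ μ₂ ≥ … ≥ λₙ ≥ μₙ ≥ 0,
-- that is, those for which λ/μ is a horizontal strip.
interlacing : List ℕ → List (List ℕ)
interlacing []       = [] ∷ []
interlacing (l ∷ ls) = cartesianProductWith _∷_ (range (first ls) l) (interlacing ls)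
  where
  range : ℕ → ℕ → List ℕ
  range lo hi = map (lo ℕ.+_) (upTo (suc hi ∸ lo))
  first : List ℕ → ℕ
  first []      = 0
  first (m ∷ _) = m

-- A column-strict (semistandard) tableau of shape λ and weight (w₁, …, wᵣ) is a chain of
-- partitions ∅ = λ⁰ ⊆ λ¹ ⊆ … ⊆ λʳ = λ in which λⁱ/λⁱ⁻¹ (the cells with entry i) is a horizontal
-- strip of size wᵢ.  The chain is listed from λʳ down to λ⁰, each λⁱ padded with zeros, and
-- accordingly the weight is given in reverse, as (wᵣ, …, w₁).
chains : List ℕ → List ℕ → List (List (List ℕ))
chains l []      = if does (sum l ℕₚ.≟ 0) then (l ∷ []) ∷ [] else []
chains l (w ∷ v) = concatMap (λ m → map (l ∷_) (chains m v))
  (filter (λ m → sum m ℕ.+ w ℕₚ.≟ sum l) (interlacing l))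

Kostka : Partition → List ℕ → ℕ
Kostka μ w = length (chains (parts μ) (reverse w))

chains-size : ∀ l v → sum l ≢ sum v → chains l v ≡ []
chains-size l []      l≢v =
  ≡.cong (λ b → if b then (l ∷ []) ∷ [] else []) (dec-false (sum l ℕₚ.≟ 0) l≢v)
chains-size l (w ∷ v) l≢v = go _ (Allₚ.all-filter (λ m → sum m ℕ.+ w ℕₚ.≟ sum l) (interlacing l))
  where
  go : ∀ ms → All (λ m → sum m ℕ.+ w ≡ sum l) ms → concatMap (λ m → map (l ∷_) (chains m v)) ms ≡ []
  go []       []       = refl
  go (m ∷ ms) (e ∷ es)
    rewrite chains-size m v (λ m≡v → l≢v (≡.trans (≡.sym e)
              (≡.trans (ℕₚ.+-comm (sum m) w) (≡.cong (w ℕ.+_) m≡v)))) = go ms es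

Kostka-vanishes : ∀ μ → VanishesAbove ∣ μ ∣ (λ w → fromℕ (Kostka μ w))
Kostka-vanishes μ w μ<w = K.reflexive (≡.cong (fromℕ ∘ length) (chains-size (parts μ) (reverse w)
  λ eq → ℕₚ.<-irrefl (≡.trans eq (sum-↭ (Permₚ.↭-reverse w))) μ<w))

s : Partition → Sym
s μ = combination (λ w → fromℕ (Kostka μ w)) ∣ μ ∣ (Kostka-vanishes μ)

record ScalarProduct : Set where
  field
    ⟪_,_⟫      : Sym → Sym → RatFun
    ⟪⟫-cong    : ∀ {f f′ g g′} → f ≈ₛ f′ → g ≈ₛ g′ → ⟪ f , g ⟫ ≈ ⟪ f′ , g′ ⟫
    ⟪⟫-comm    : ∀ f g → ⟪ f , g ⟫ ≈ ⟪ g , f ⟫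
    ⟪⟫-+       : ∀ f f′ g → ⟪ f +ₛ f′ , g ⟫ ≈ ⟪ f , g ⟫ + ⟪ f′ , g ⟫
    ⟪⟫-·       : ∀ c f g → ⟪ c ·ₛ f , g ⟫ ≈ c * ⟪ f , g ⟫
open ScalarProduct public using (⟪⟫-cong; ⟪⟫-comm; ⟪⟫-+; ⟪⟫-·)

⟨_,_⟩[_] : Sym → Sym → ScalarProduct → RatFun
⟨ f , g ⟩[ B ] = ScalarProduct.⟪_,_⟫ B f g

IsHall : ScalarProduct → Set
IsHall B = ∀ μ ν → ⟨ s μ , s ν ⟩[ B ] ≈ δ (parts μ) (parts ν)

IsAlphaProduct : ScalarProduct → Set
IsAlphaProduct B = ∀ μ ν →
  ⟨ p μ , p ν ⟩[ B ] ≈ δ (parts μ) (parts ν) * (fromℕ (z μ) * α ^ ℓ μ)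

record IsIntegralJack (B : ScalarProduct) (J : Partition → Sym) : Set where
  field
    orthogonal : ∀ μ ν → parts μ ≢ parts ν → ⟨ J μ , J ν ⟩[ B ] ≈ 0#
    triangular : ∀ μ ν → ¬ ν ⊴ μ → [m ν ] (J μ) ≈ 0#
    normalized : ∀ μ → [m 1^ ∣ μ ∣ ] (J μ) ≈ fromℕ (∣ μ ∣ !)

-- substitute (J_μ^(α)) = J_μ^(1/α); the variables x₁, x₂, … are unaffected.
substitute : Sym → Sym
substitute f = record
  { series    = λ a → invert-α (series f a)
  ; symmetric = λ r → invert-α-cong (symmetric f r)
  ; stable    = λ a → invert-α-cong (stable f a)
  ; bound     = bound f
  ; bounded   = λ a d<a → invert-α-0# (bounded f a d<a) }

J̃ : (Partition → Sym) → Partition → Sym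
J̃ J μ = α ^ ∣ μ ∣ ·ₛ substitute (J μ)

falling : RatFun → ℕ → RatFun
falling x zero    = 1#
falling x (suc n) = falling x n * (x - fromℕ n)

binomial : RatFun → ℕ → RatFun
binomial x n = constant (ℚ._/_ (+ 1) (n !) {{n ℕₚ.!≢0}}) * falling x n

insertions : {A : Set} → A → List A → List (List A)
insertions x []       = (x ∷ []) ∷ []
insertions x (y ∷ ys) = (x ∷ y ∷ ys) ∷ map (y ∷_) (insertions x ys)

permutations : {A : Set} → List A → List (List A)
permutations []       = [] ∷ []
permutations (x ∷ xs) = concatMap (insertions x) (permutations xs)

descents : List ℕ → ℕ
descents (x ∷ y ∷ π) = (if y <ᵇ x then 1 else 0) ℕ.+ descents (y ∷ π)
descents _           = 0

eulerian : ℕ → ℕ → ℕ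
eulerian n k = length (filter (λ π → descents π ℕₚ.≟ k) (permutations (downFrom n)))

additions : {A : Set} → A → List (List A) → List (List (List A))
additions x []       = []
additions x (b ∷ bs) = ((x ∷ b) ∷ bs) ∷ map (b ∷_) (additions x bs)

-- A set partition is listed as its nonempty blocks, each set partition exactly once.
setPartitions : {A : Set} → List A → List (List (List A))
setPartitions []       = [] ∷ []
setPartitions (x ∷ xs) = concatMap (λ bs → ((x ∷ []) ∷ bs) ∷ additions x bs) (setPartitions xs)

stirling : ℕ → ℕ → ℕ
stirling n k = length (filter (λ bs → length bs ℕₚ.≟ k) (setPartitions (downFrom n)))

{-# OPTIONS --safe #-}
module Submission where

-- Under the Hall product, f ↦ ⟨ f , h₁ⁿ ⟩ and f ↦ [m_{1ⁿ}] f agree on symmetric functions of degree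
-- n: the Kostka matrix is triangular for dominance, so they need only be compared on Schur
-- functions, and there it suffices that h₁ⁿ = ∑ f^λ s_λ, where f^λ counts the ways to build λ box by
-- box and is also the Kostka number of weight 1ⁿ.  That expansion follows from U D = D U + D, where
-- D removes a horizontal strip and U adds a box: both sides have coefficient
-- (w + |v| choose w) X(v) at x^(w,v), where X(v) is the coefficient at x^v.
-- Worpitzky's identity comes from inserting the largest letter into a permutation, and the identity
-- with Stirling numbers from adding an element to a set partition; in both cases the sum of the
-- falling factorials over all objects is multiplied by α (and by n + 1 in the first case).

open import Defs
open import Algebra.Bundles using (CommutativeRing)
open import Data.Bool.Base using (T; if_then_else_; true; false)
open import Data.Integer.Base as ℤ using (+_)
import Data.Integer.Properties as ℤₚ
open import Data.List.Base hiding (sum; find)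
open import Data.List.Membership.Propositional using (_∈_; find; lose)
open import Data.List.Membership.Propositional.Properties
import Data.List.Properties as Listₚ
import Data.List.Relation.Binary.Equality.Propositional as ListEq
open import Data.List.Relation.Binary.Permutation.Propositional as Perm using ()
import Data.List.Relation.Binary.Permutation.Propositional.Properties as Permₚ
open import Data.List.Relation.Unary.All as All using (All; []; _∷_)
import Data.List.Relation.Unary.All.Properties as Allₚ
open import Data.List.Relation.Unary.AllPairs using ([]; _∷_)
open import Data.List.Relation.Unary.Any using (here; there)
open import Data.List.Relation.Unary.Linked using (Linked; []; [-]; _∷_)
import Data.List.Relation.Unary.Sorted.TotalOrder.Properties as Sortedₚ
open import Data.List.Relation.Unary.Unique.Propositional using (Unique)
open import Data.List.Relation.Unary.Unique.DecPropositional.Properties using (deduplicate-!)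
open import Data.List.Sort ≥-decTotalOrder using (sort-↭; sort-↗)
open import Data.Nat.Base as ℕ
  using (ℕ; zero; suc; pred; _≤_; _<_; _≥_; _!; _∸_; _<ᵇ_; z≤n; s≤s; NonZero)
open import Data.Nat.Combinatorics using (_C_; nCk+nC[k+1]≡[n+1]C[k+1]; k>n⇒nCk≡0; nCk≡nC[n∸k])
open import Data.Nat.ListAction using (sum)
open import Data.Nat.ListAction.Properties using (sum-++; sum-↭)
import Data.Nat.Properties as ℕₚ
open import Data.Product using (∃; _×_; _,_; proj₂)
open import Data.Rational.Base as ℚ using (fromℚᵘ)
import Data.Rational.Properties as ℚₚ
open import Data.Rational.Unnormalised.Base as ℚᵘ using (mkℚᵘ; *≡*)
import Data.Rational.Unnormalised.Properties as ℚᵘₚ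
open import Data.Sum.Base using (inj₁; inj₂)
open import Data.Unit.Base using (⊤; tt)
open import Function.Base using (_∘_)
open import Relation.Binary.Bundles using (DecTotalOrder)
open import Relation.Binary.PropositionalEquality as ≡ using (_≡_; _≢_; refl)
open import Relation.Nullary using (¬_; Dec; yes; no; does; contradiction)
open import Relation.Nullary.Decidable using (dec-true)
open import Relation.Unary using (Pred; Decidable)

-- The Hall product is known only by its values on Schur functions, so every comparison is one of
-- linear functionals: a functional that kills all s_μ of degree n kills all of degree n. Likewise
-- `U` and `D` act on functions of shapes instead of formal sums of shapes, and h₁ⁿ becomes the
-- functional `E n`. Two obstacles shape the commutation of `U` and `D`. A strip is removed without
-- changing the length of the list, whereas a box may open a new row; shapes therefore count only up
-- to trailing zeros, whence `Stable` and `δ₀`. And a row may grow only as far as the row above it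
-- allows, so an induction on rows needs a bound `b` on the first row. The extra summand D is
-- present exactly when the first row may still grow.

module K = CommutativeRing ℚ⟨α⟩
open import Algebra.Properties.AbelianGroup K.+-abelianGroup using (⁻¹-∙-comm; ∙-cancelʳ; x∙y⁻¹≈ε⇒x≈y)
open import Algebra.Properties.Ring K.ring using (-‿distribʳ-*)
open import Algebra.Properties.Semiring.Mult K.semiring using (×-homo-+; ×1-homo-*)
open import Algebra.Solver.Ring.NaturalCoefficients.Default K.commutativeSemiring
  using (solve; _:=_; _:+_; _:*_)
open import Relation.Binary.Reasoning.Setoid K.setoid

private variable X Y : Set

-- Finite sums, indicators and natural numbers in ℚ(α)

∑-cong-∈ : (xs : List X) {f g : X → RatFun} → (∀ x → x ∈ xs → f x ≈ g x) → ∑ xs f ≈ ∑ xs g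
∑-cong-∈ []       e = K.refl
∑-cong-∈ (x ∷ xs) e = K.+-cong (e x (here refl)) (∑-cong-∈ xs λ y y∈ → e y (there y∈))

∑-++ : (xs ys : List X) (f : X → RatFun) → ∑ (xs ++ ys) f ≈ ∑ xs f + ∑ ys f
∑-++ []       ys f = K.sym (K.+-identityˡ _)
∑-++ (x ∷ xs) ys f = K.trans (K.+-congˡ (∑-++ xs ys f)) (K.sym (K.+-assoc _ _ _))

∑-map : (g : X → Y) (xs : List X) (f : Y → RatFun) → ∑ (map g xs) f ≡ ∑ xs (f ∘ g)
∑-map g []       f = refl
∑-map g (x ∷ xs) f = ≡.cong (λ s → f (g x) + s) (∑-map g xs f)

∑-concatMap : (g : X → List Y) (xs : List X) (f : Y → RatFun) →
              ∑ (concatMap g xs) f ≈ ∑ xs (λ x → ∑ (g x) f)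
∑-concatMap g []       f = K.refl
∑-concatMap g (x ∷ xs) f = K.trans (∑-++ (g x) _ f) (K.+-congˡ (∑-concatMap g xs f))

∑-cartesianProductWith : {C : Set} (g : X → Y → C) (xs : List X) (ys : List Y) (f : C → RatFun) →
  ∑ (cartesianProductWith g xs ys) f ≈ ∑ xs (λ x → ∑ ys (λ y → f (g x y)))
∑-cartesianProductWith g []       ys f = K.refl
∑-cartesianProductWith g (x ∷ xs) ys f = K.trans (∑-++ (map (g x) ys) _ f)
  (K.+-cong (K.reflexive (∑-map (g x) ys f)) (∑-cartesianProductWith g xs ys f))

*-∑ : (c : RatFun) (xs : List X) (f : X → RatFun) → c * ∑ xs f ≈ ∑ xs (λ x → c * f x)
*-∑ c []       f = K.zeroʳ c
*-∑ c (x ∷ xs) f = K.trans (K.distribˡ c _ _) (K.+-congˡ (*-∑ c xs f))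

∑-filter : {P : Pred X _} (P? : Decidable P) (xs : List X) (f : X → RatFun) →
           ∑ (filter P? xs) f ≈ ∑ xs (λ x → indicator (P? x) * f x)
∑-filter P? []       f = K.refl
∑-filter P? (x ∷ xs) f with does (P? x)
... | true  = K.+-cong (K.sym (K.*-identityˡ _)) (∑-filter P? xs f)
... | false = K.trans (∑-filter P? xs f) (K.trans (K.sym (K.+-identityˡ _))
                (K.+-congʳ (K.sym (K.zeroˡ _))))

∑-upTo-head : ∀ n (f : ℕ → RatFun) → ∑ (upTo (suc n)) f ≈ f 0 + ∑ (upTo n) (f ∘ suc)
∑-upTo-head n f = K.+-congˡ (K.reflexive (≡.trans
  (≡.cong (λ xs → ∑ xs f) (≡.sym (Listₚ.map-upTo suc n))) (∑-map suc (upTo n) f)))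

∑-upTo-last : ∀ n (f : ℕ → RatFun) → ∑ (upTo (suc n)) f ≈ ∑ (upTo n) f + f n
∑-upTo-last n f = K.trans (K.reflexive (≡.cong (λ xs → ∑ xs f) (≡.sym (Listₚ.upTo-∷ʳ n))))
  (K.trans (∑-++ (upTo n) (n ∷ []) f) (K.+-congˡ (K.+-identityʳ _)))

fromℕ-+ : ∀ m n → fromℕ (m ℕ.+ n) ≈ fromℕ m + fromℕ n
fromℕ-+ = ×-homo-+ 1#

fromℕ-* : ∀ m n → fromℕ (m ℕ.* n) ≈ fromℕ m * fromℕ n
fromℕ-* = ×1-homo-*

fromℕ-length : (xs : List X) → fromℕ (length xs) ≈ ∑ xs (λ _ → 1#)
fromℕ-length []       = K.refl
fromℕ-length (x ∷ xs) = K.+-congˡ (fromℕ-length xs)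

_≟ₗ_ : (a b : List ℕ) → Dec (a ≡ b)
_≟ₗ_ = Listₚ.≡-dec ℕₚ._≟_

indicator-yes : {P : Set} (P? : Dec P) → P → indicator P? ≈ 1#
indicator-yes (yes _) p = K.refl
indicator-yes (no ¬p) p = contradiction p ¬p

indicator-yes-* : {P : Set} (P? : Dec P) → P → ∀ x → indicator P? * x ≈ x
indicator-yes-* P? p x = K.trans (K.*-congʳ (indicator-yes P? p)) (K.*-identityˡ x)

indicator-no-* : {P : Set} (P? : Dec P) → ¬ P → ∀ x → indicator P? * x ≈ 0#
indicator-no-* P? ¬p x = K.trans (K.*-congʳ (indicator-no P? ¬p)) (K.zeroˡ x)

*-≈0 : ∀ x {y} → y ≈ 0# → x * y ≈ 0#
*-≈0 x e = K.trans (K.*-congˡ e) (K.zeroʳ x)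

indicator-⇔ : {P Q : Set} (P? : Dec P) (Q? : Dec Q) → (P → Q) → (Q → P) → indicator P? ≈ indicator Q?
indicator-⇔ P? (yes q) to from = indicator-yes P? (from q)
indicator-⇔ P? (no ¬q) to from = indicator-no P? (¬q ∘ to)

indicator-*-cong : {P : Set} (P? : Dec P) {x y : RatFun} → (P → x ≈ y) →
                   indicator P? * x ≈ indicator P? * y
indicator-*-cong (yes p) e = K.*-congˡ (e p)
indicator-*-cong (no ¬p) e = K.trans (K.zeroˡ _) (K.sym (K.zeroˡ _))

-- Worpitzky's identity and Stirling numbers

fromℚᵘ-homo-* : ∀ p q → fromℚᵘ p ℚ.* fromℚᵘ q ≡ fromℚᵘ (p ℚᵘ.* q)
fromℚᵘ-homo-* p q = ℚₚ.toℚᵘ-injective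
  (ℚᵘₚ.≃-trans (ℚₚ.toℚᵘ-homo-* (fromℚᵘ p) (fromℚᵘ q))
  (ℚᵘₚ.≃-trans (ℚᵘₚ.*-cong (ℚₚ.toℚᵘ-fromℚᵘ p) (ℚₚ.toℚᵘ-fromℚᵘ q))
  (ℚᵘₚ.≃-sym (ℚₚ.toℚᵘ-fromℚᵘ (p ℚᵘ.* q)))))

fromℚᵘ-homo-+ : ∀ p q → fromℚᵘ p ℚ.+ fromℚᵘ q ≡ fromℚᵘ (p ℚᵘ.+ q)
fromℚᵘ-homo-+ p q = ℚₚ.toℚᵘ-injective
  (ℚᵘₚ.≃-trans (ℚₚ.toℚᵘ-homo-+ (fromℚᵘ p) (fromℚᵘ q))
  (ℚᵘₚ.≃-trans (ℚᵘₚ.+-cong (ℚₚ.toℚᵘ-fromℚᵘ p) (ℚₚ.toℚᵘ-fromℚᵘ q))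
  (ℚᵘₚ.≃-sym (ℚₚ.toℚᵘ-fromℚᵘ (p ℚᵘ.+ q)))))

-- `fromℕ` adds up copies of `1#`, whereas the factor 1/n! of `binomial` is a rational constant;
-- here the two meet. `mkℚᵘ` stores the denominator minus one, so `mkℚᵘ (+ k) 0` is k/1.
fromℕ-constant : ∀ k → fromℕ k ≈ constant (fromℚᵘ (mkℚᵘ (+ k) 0))
fromℕ-constant zero    = polynomial-cong (coeffs λ { zero → refl ; (suc _) → refl })
fromℕ-constant (suc k) = K.trans (K.+-congˡ (fromℕ-constant k))
  (K.trans (K.sym (polynomial-+ 1ₚ _)) (polynomial-cong (∷-cong
    (≡.trans (fromℚᵘ-homo-+ (mkℚᵘ (+ 1) 0) (mkℚᵘ (+ k) 0))
      (ℚₚ.fromℚᵘ-cong {mkℚᵘ (+ 1) 0 ℚᵘ.+ mkℚᵘ (+ k) 0} {mkℚᵘ (+ suc k) 0}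
        (*≡* (≡.cong (λ i → (+ 1 ℤ.+ i) ℤ.* + 1) (ℤₚ.*-identityʳ (+ k))))))
    ≈ₚ-refl)))

constant-1/n*n : ∀ n .{{_ : NonZero n}} → constant (+ 1 ℚ./ n) * fromℕ n ≈ 1#
constant-1/n*n (suc n) = K.trans (K.*-congˡ (fromℕ-constant (suc n)))
  (K.trans (K.sym (constant-* _ _)) (polynomial-cong (∷-cong
    (≡.trans (fromℚᵘ-homo-* (mkℚᵘ (+ 1) n) (mkℚᵘ (+ suc n) 0))
      (ℚₚ.fromℚᵘ-cong {mkℚᵘ (+ 1) n ℚᵘ.* mkℚᵘ (+ suc n) 0} {ℚᵘ.1ℚᵘ}
        (*≡* (≡.trans (ℤₚ.*-identityʳ _) (≡.trans (ℤₚ.*-identityˡ (+ suc n)) (≡.sym (≡.trans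
          (ℤₚ.*-identityˡ _) (≡.cong +_ (ℕₚ.*-identityʳ (suc n))))))))))
    ≈ₚ-refl)))

!*binomial : ∀ x n → fromℕ (n !) * binomial x n ≈ falling x n
!*binomial x n = begin
  fromℕ (n !) * (constant c * falling x n)
    ≈⟨ solve 3 (λ a b d → a :* (b :* d) := (b :* a) :* d) K.refl (fromℕ (n !)) (constant c) (falling x n) ⟩
  constant c * fromℕ (n !) * falling x n ≈⟨ K.*-congʳ (constant-1/n*n (n !) {{n ℕₚ.!≢0}}) ⟩
  1# * falling x n  ≈⟨ K.*-identityˡ _ ⟩
  falling x n ∎
  where c = ℚ._/_ (+ 1) (n !) {{n ℕₚ.!≢0}}

falling-cong : ∀ {x y} n → x ≈ y → falling x n ≈ falling y n
falling-cong zero    e = K.refl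
falling-cong (suc n) e = K.*-cong (falling-cong n e) (K.+-congʳ e)

∑-pick : ∀ n (g : ℕ → RatFun) {j} → j < n → ∑ (upTo n) (λ k → indicator (j ℕₚ.≟ k) * g k) ≈ g j
∑-pick (suc n) g {j} j<n = K.trans (∑-upTo-head n (λ k → indicator (j ℕₚ.≟ k) * g k)) (rest j j<n)
  where
  rest : ∀ j → j < suc n → indicator (j ℕₚ.≟ 0) * g 0 +
         ∑ (upTo n) (λ k → indicator (j ℕₚ.≟ suc k) * g (suc k)) ≈ g j
  rest zero    _         = K.trans
    (K.+-cong (K.*-identityˡ _) (∑-zero (upTo n) λ k _ → K.zeroˡ _)) (K.+-identityʳ _)
  rest (suc j) (s≤s j<n) = K.trans
    (K.+-cong (K.zeroˡ _) (∑-cong (upTo n) λ k → K.*-congʳ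
      (indicator-⇔ (suc j ℕₚ.≟ suc k) (j ℕₚ.≟ k) ℕₚ.suc-injective (≡.cong suc))))
    (K.trans (K.+-identityˡ _) (∑-pick n (g ∘ suc) j<n))

-- Exchanging the two sums turns counts weighted by `g k` into a sum over the objects themselves.
-- The hypothesis holds as soon as each `t x` occurs exactly once in `ks`.
∑-by-statistic : (t : X → ℕ) (xs : List X) (ks : List ℕ) (g : ℕ → RatFun) →
  (∀ x → x ∈ xs → ∑ ks (λ k → indicator (t x ℕₚ.≟ k) * g k) ≈ g (t x)) →
  ∑ ks (λ k → fromℕ (length (filter (λ x → t x ℕₚ.≟ k) xs)) * g k) ≈ ∑ xs (g ∘ t)
∑-by-statistic t xs ks g pick = begin
  ∑ ks (λ k → fromℕ (length (filter (λ x → t x ℕₚ.≟ k) xs)) * g k)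
    ≈⟨ (∑-cong ks λ k → begin
      fromℕ (length (filter (λ x → t x ℕₚ.≟ k) xs)) * g k
        ≈⟨ K.*-congʳ (K.trans (fromℕ-length (filter (λ x → t x ℕₚ.≟ k) xs))
             (K.trans (∑-filter (λ x → t x ℕₚ.≟ k) xs _) (∑-cong xs λ x → K.*-identityʳ _))) ⟩
      ∑ xs (λ x → indicator (t x ℕₚ.≟ k)) * g k ≈⟨ K.*-comm _ _ ⟩
      g k * ∑ xs (λ x → indicator (t x ℕₚ.≟ k)) ≈⟨ *-∑ (g k) xs _ ⟩
      ∑ xs (λ x → g k * indicator (t x ℕₚ.≟ k)) ≈⟨ (∑-cong xs λ x → K.*-comm _ _) ⟩
      ∑ xs (λ x → indicator (t x ℕₚ.≟ k) * g k) ∎) ⟩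
  ∑ ks (λ k → ∑ xs (λ x → indicator (t x ℕₚ.≟ k) * g k)) ≈⟨ ∑-swap ks xs _ ⟩
  ∑ xs (λ x → ∑ ks (λ k → indicator (t x ℕₚ.≟ k) * g k)) ≈⟨ ∑-cong-∈ xs pick ⟩
  ∑ xs (g ∘ t) ∎

descents-≤ : ∀ y ys → descents (y ∷ ys) ≤ length ys
descents-≤ y []       = z≤n
descents-≤ y (z ∷ zs) with z <ᵇ y
... | true  = s≤s (descents-≤ z zs)
... | false = ℕₚ.m≤n⇒m≤1+n (descents-≤ z zs)

<ᵇ-yes : ∀ {m n} → m < n → (m <ᵇ n) ≡ true
<ᵇ-yes {m} {n} m<n with m <ᵇ n | ℕₚ.<⇒<ᵇ m<n
... | true | _ = refl

<ᵇ-no : ∀ {m n} → n ≤ m → (m <ᵇ n) ≡ false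
<ᵇ-no {m} {n} n≤m with m <ᵇ n in eq
... | false = refl
... | true  = contradiction (ℕₚ.<ᵇ⇒< m n (≡.subst T (≡.sym eq) _)) (ℕₚ.≤⇒≯ n≤m)

-- Inserting a letter above all others keeps the number of descents if it goes into a descent or to
-- the end, and raises it by one elsewhere.
∑-insertions-after : ∀ {x} (g : ℕ → RatFun) y ys → All (_< x) (y ∷ ys) →
  ∑ (insertions x ys) (λ π → g (descents (y ∷ π)))
    ≈ fromℕ (suc (descents (y ∷ ys))) * g (descents (y ∷ ys))
      + fromℕ (length ys ∸ descents (y ∷ ys)) * g (suc (descents (y ∷ ys)))
∑-insertions-after {x} g y [] (y<x ∷ []) rewrite <ᵇ-no (ℕₚ.<⇒≤ y<x) = begin
  g 0 + 0#                     ≈⟨ K.+-cong (K.sym (K.*-identityˡ _)) (K.sym (K.zeroˡ _)) ⟩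
  1# * g 0 + 0# * g 1          ≈⟨ K.+-congʳ (K.*-congʳ (K.sym (K.+-identityʳ 1#))) ⟩
  (1# + 0#) * g 0 + 0# * g 1   ∎
∑-insertions-after {x} g y (z ∷ zs) (y<x ∷ z<x ∷ zs<x)
  rewrite <ᵇ-no (ℕₚ.<⇒≤ y<x) | <ᵇ-yes z<x
        | ∑-map (z ∷_) (insertions x zs) (λ π → g (descents (y ∷ π)))
  with z <ᵇ y
... | true  = begin
  g (suc e) + ∑ (insertions x zs) (λ π → g (suc (descents (z ∷ π))))
    ≈⟨ K.+-congˡ (∑-insertions-after (g ∘ suc) z zs (z<x ∷ zs<x)) ⟩
  g (suc e) + (fromℕ (suc e) * g (suc e) + r)
    ≈⟨ solve 4 (λ o a u r → u :+ ((o :+ a) :* u :+ r) := (u :+ (o :+ a) :* u) :+ r)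
         K.refl 1# (fromℕ e) (g (suc e)) r ⟩
  (g (suc e) + fromℕ (suc e) * g (suc e)) + r
    ≈⟨ K.+-congʳ (K.+-congʳ (K.sym (K.*-identityˡ _))) ⟩
  (1# * g (suc e) + fromℕ (suc e) * g (suc e)) + r
    ≈⟨ K.+-congʳ (K.sym (K.distribʳ _ _ _)) ⟩
  fromℕ (suc (suc e)) * g (suc e) + r ∎
  where
  e = descents (z ∷ zs)
  r = fromℕ (length zs ∸ e) * g (suc (suc e))
... | false rewrite ℕₚ.+-∸-assoc 1 (descents-≤ z zs) = begin
  g (suc e) + ∑ (insertions x zs) (λ π → g (descents (z ∷ π)))
    ≈⟨ K.+-congˡ (∑-insertions-after g z zs (z<x ∷ zs<x)) ⟩
  g (suc e) + (r + fromℕ a * g (suc e))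
    ≈⟨ solve 3 (λ u r a → u :+ (r :+ a) := r :+ (u :+ a)) K.refl (g (suc e)) r _ ⟩
  r + (g (suc e) + fromℕ a * g (suc e))
    ≈⟨ K.+-congˡ (K.+-congʳ (K.sym (K.*-identityˡ _))) ⟩
  r + (1# * g (suc e) + fromℕ a * g (suc e))
    ≈⟨ K.+-congˡ (K.sym (K.distribʳ _ _ _)) ⟩
  r + fromℕ (suc a) * g (suc e) ∎
  where
  e = descents (z ∷ zs)
  a = length zs ∸ e
  r = fromℕ (suc e) * g e

-- In front of a nonempty list the large letter creates a descent; every other place comes after the
-- head and is covered by `∑-insertions-after`.
∑-insertions : ∀ {x} (g : ℕ → RatFun) π → All (_< x) π →
  ∑ (insertions x π) (g ∘ descents)
    ≈ fromℕ (suc (descents π)) * g (descents π) + fromℕ (length π ∸ descents π) * g (suc (descents π))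
∑-insertions g [] [] = K.+-cong (K.trans (K.sym (K.*-identityˡ _)) (K.*-congʳ (K.sym (K.+-identityʳ 1#))))
                                (K.sym (K.zeroˡ _))
∑-insertions {x} g (y ∷ ys) (y<x ∷ ys<x)
  rewrite <ᵇ-yes y<x | ∑-map (y ∷_) (insertions x ys) (g ∘ descents)
        | ℕₚ.+-∸-assoc 1 (descents-≤ y ys) = begin
  g (suc e) + ∑ (insertions x ys) (λ π → g (descents (y ∷ π)))
    ≈⟨ K.+-congˡ (∑-insertions-after g y ys (y<x ∷ ys<x)) ⟩
  g (suc e) + (r + fromℕ a * g (suc e))
    ≈⟨ solve 3 (λ u r a → u :+ (r :+ a) := r :+ (u :+ a)) K.refl (g (suc e)) r _ ⟩
  r + (g (suc e) + fromℕ a * g (suc e))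
    ≈⟨ K.+-congˡ (K.+-congʳ (K.sym (K.*-identityˡ _))) ⟩
  r + (1# * g (suc e) + fromℕ a * g (suc e))
    ≈⟨ K.+-congˡ (K.sym (K.distribʳ _ _ _)) ⟩
  r + fromℕ (suc a) * g (suc e) ∎
  where
  e = descents (y ∷ ys)
  a = length ys ∸ e
  r = fromℕ (suc e) * g e

x-y+y : ∀ x y → (x - y) + y ≈ x
x-y+y x y = K.trans (K.+-assoc x (- y) y) (K.trans (K.+-congˡ (K.-‿inverseˡ y)) (K.+-identityʳ x))

-- The definition splits off the last factor. Splitting off the first exposes `falling y n`, the
-- factor shared by both terms of the recurrence for Worpitzky's identity.
falling-suc : ∀ y n → falling (y + 1#) (suc n) ≈ (y + 1#) * falling y n
falling-suc y zero    = begin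
  1# * (y + 1# - 0#)  ≈⟨ K.*-comm _ _ ⟩
  (y + 1# - 0#) * 1#  ≈⟨ K.*-congʳ (K.trans (K.sym (K.+-identityʳ _)) (x-y+y _ 0#)) ⟩
  (y + 1#) * 1#       ∎
falling-suc y (suc n) = begin
  falling (y + 1#) (suc n) * (y + 1# - fromℕ (suc n))
    ≈⟨ K.*-cong (falling-suc y n) shift ⟩
  (y + 1#) * falling y n * (y - fromℕ n)
    ≈⟨ K.*-assoc _ _ _ ⟩
  (y + 1#) * falling y (suc n) ∎
  where
  shift : y + 1# - fromℕ (suc n) ≈ y - fromℕ n
  shift = ∙-cancelʳ _ _ _ (begin
    y + 1# - fromℕ (suc n) + fromℕ (suc n)  ≈⟨ x-y+y _ _ ⟩
    y + 1#                                  ≈⟨ K.+-congʳ (K.sym (x-y+y y (fromℕ n))) ⟩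
    y - fromℕ n + fromℕ n + 1#              ≈⟨ K.trans (K.+-assoc _ _ _) (K.+-congˡ (K.+-comm _ _)) ⟩
    y - fromℕ n + fromℕ (suc n)             ∎)

-- With n = d + m, both terms contain `falling (x + fromℕ d) n`, and the cofactors add up:
-- (d+1)(x-m) + m(x+d+1) = (n+1)x. Taking m as a variable avoids truncated subtraction.
falling-recurrence : ∀ x d m →
  fromℕ (suc d) * falling (x + fromℕ d) (suc (d ℕ.+ m))
    + fromℕ m * falling (x + fromℕ (suc d)) (suc (d ℕ.+ m))
    ≈ fromℕ (suc (d ℕ.+ m)) * x * falling (x + fromℕ d) (d ℕ.+ m)
falling-recurrence x d m = begin
  fromℕ (suc d) * (F * (y - fromℕ n)) + fromℕ m * falling (x + fromℕ (suc d)) (suc n)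
    ≈⟨ K.+-cong (K.*-congˡ (K.*-congˡ y-n)) (K.*-congˡ (K.trans
         (falling-cong (suc n) (K.trans (K.+-congˡ (K.+-comm _ _)) (K.sym (K.+-assoc x (fromℕ d) 1#))))
         (falling-suc y n))) ⟩
  fromℕ (suc d) * (F * u) + fromℕ m * ((x + fromℕ d + 1#) * F)
    -- The solver works in semirings, so x is rewritten as u + m with u = x - m.
    ≈⟨ K.+-congˡ (K.*-congˡ (K.*-congʳ (K.+-congʳ (K.+-congʳ (K.sym (x-y+y x (fromℕ m))))))) ⟩
  fromℕ (suc d) * (F * u) + fromℕ m * ((u + fromℕ m + fromℕ d + 1#) * F)
    ≈⟨ solve 5 (λ o d m u f → (o :+ d) :* (f :* u) :+ m :* ((u :+ m :+ d :+ o) :* f)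
                  := (o :+ (d :+ m)) :* (u :+ m) :* f) K.refl 1# (fromℕ d) (fromℕ m) u F ⟩
  (1# + (fromℕ d + fromℕ m)) * (u + fromℕ m) * F
    ≈⟨ K.*-congʳ (K.*-cong (K.+-congˡ (K.sym (fromℕ-+ d m))) (x-y+y x (fromℕ m))) ⟩
  fromℕ (suc n) * x * F ∎
  where
  n = d ℕ.+ m
  y = x + fromℕ d
  F = falling y n
  u = x - fromℕ m
  y-n : y - fromℕ n ≈ u
  y-n = ∙-cancelʳ _ _ _ (begin
    y - fromℕ n + fromℕ n          ≈⟨ x-y+y _ _ ⟩
    x + fromℕ d                    ≈⟨ K.+-congʳ (K.sym (x-y+y x (fromℕ m))) ⟩
    u + fromℕ m + fromℕ d          ≈⟨ K.trans (K.+-assoc _ _ _) (K.+-congˡ (K.+-comm _ _)) ⟩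
    u + (fromℕ d + fromℕ m)        ≈⟨ K.+-congˡ (K.sym (fromℕ-+ d m)) ⟩
    u + fromℕ n                    ∎)

All-concatMap⁺ : {B : Set} {P : B → Set} {Q : X → Set} {f : X → List B} {xs : List X} →
                 All Q xs → (∀ {x} → Q x → All P (f x)) → All P (concatMap f xs)
All-concatMap⁺ qs h = Allₚ.concat⁺ (Allₚ.map⁺ (All.map h qs))

Arrangement : ℕ → List ℕ → Set
Arrangement n π = All (_< n) π × length π ≡ n

insertions-arrangement : ∀ {P : X → Set} {x} → P x → ∀ π → All P π →
  All (λ π′ → All P π′ × length π′ ≡ suc (length π)) (insertions x π)
insertions-arrangement px []       []         = (px ∷ [] , refl) ∷ []
insertions-arrangement px (y ∷ ys) (py ∷ pys) = (px ∷ py ∷ pys , refl) ∷ Allₚ.map⁺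
  (All.map (λ (a , e) → py ∷ a , ≡.cong suc e) (insertions-arrangement px ys pys))

permutations-arrangement : ∀ n → All (Arrangement n) (permutations (downFrom n))
permutations-arrangement zero    = ([] , refl) ∷ []
permutations-arrangement (suc n) = All-concatMap⁺ (permutations-arrangement n) λ {π} (a , e) →
  All.map (λ (b , f) → b , ≡.trans f (≡.cong suc e))
    (insertions-arrangement (ℕₚ.n<1+n n) π (All.map ℕₚ.m<n⇒m<1+n a))

descents-≤-length : ∀ π → descents π ≤ length π
descents-≤-length []       = z≤n
descents-≤-length (y ∷ ys) = ℕₚ.m≤n⇒m≤1+n (descents-≤ y ys)

-- The empty permutation has zero descents while `upTo 0` has no entry, hence the assumption on n.
descents-< : ∀ {n} π → length π ≡ n → 1 ≤ n → descents π < n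
descents-< (y ∷ ys) refl _ = s≤s (descents-≤ y ys)
descents-< []       refl ()

∑-permutations-falling : ∀ x n →
  ∑ (permutations (downFrom n)) (λ π → falling (x + fromℕ (descents π)) n) ≈ fromℕ (n !) * x ^ n
∑-permutations-falling x zero    = K.sym (K.*-identityʳ _)
∑-permutations-falling x (suc n) = begin
  ∑ (permutations (downFrom (suc n))) (g ∘ descents)
    ≈⟨ ∑-concatMap (insertions n) perms _ ⟩
  ∑ perms (λ π → ∑ (insertions n π) (g ∘ descents))
    ≈⟨ (∑-cong-∈ perms λ π π∈ → step π (All.lookup (permutations-arrangement n) π∈)) ⟩
  ∑ perms (λ π → fromℕ (suc n) * x * falling (x + fromℕ (descents π)) n)
    ≈⟨ *-∑ (fromℕ (suc n) * x) perms _ ⟨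
  fromℕ (suc n) * x * ∑ perms (λ π → falling (x + fromℕ (descents π)) n)
    ≈⟨ K.*-congˡ (∑-permutations-falling x n) ⟩
  fromℕ (suc n) * x * (fromℕ (n !) * x ^ n)
    ≈⟨ solve 4 (λ a b c d → a :* b :* (c :* d) := (a :* c) :* (b :* d))
         K.refl (fromℕ (suc n)) x (fromℕ (n !)) (x ^ n) ⟩
  (fromℕ (suc n) * fromℕ (n !)) * (x * x ^ n)
    ≈⟨ K.*-congʳ (K.sym (fromℕ-* (suc n) (n !))) ⟩
  fromℕ (suc n !) * x ^ suc n ∎
  where
  perms = permutations (downFrom n)
  g : ℕ → RatFun
  g d = falling (x + fromℕ d) (suc n)
  step : ∀ π → Arrangement n π → ∑ (insertions n π) (g ∘ descents)
                                   ≈ fromℕ (suc n) * x * falling (x + fromℕ (descents π)) n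
  step π (π<n , refl) = K.trans (∑-insertions g π π<n)
    -- `m` is a truncated difference; since descents never exceed the length, d + m is the length
    -- again.
    (≡.subst (λ n → fromℕ (suc d) * falling (x + fromℕ d) (suc n)
                      + fromℕ m * falling (x + fromℕ (suc d)) (suc n)
                    ≈ fromℕ (suc n) * x * falling (x + fromℕ d) n)
      (ℕₚ.m+[n∸m]≡n (descents-≤-length π)) (falling-recurrence x d m))
    where
    d = descents π
    m = length π ∸ d

worpitzky : ∀ x n → 1 ≤ n →
  ∑ (upTo n) (λ k → fromℕ (n !) * fromℕ (eulerian n k) * binomial (x + fromℕ k) n)
    ≈ fromℕ (n !) * x ^ n
worpitzky x n 1≤n = begin
  ∑ (upTo n) (λ k → fromℕ (n !) * fromℕ (eulerian n k) * binomial (x + fromℕ k) n)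
    ≈⟨ (∑-cong (upTo n) λ k → K.trans
         (solve 3 (λ a b c → a :* b :* c := b :* (a :* c)) K.refl
           (fromℕ (n !)) (fromℕ (eulerian n k)) (binomial (x + fromℕ k) n))
         (K.*-congˡ (!*binomial (x + fromℕ k) n))) ⟩
  ∑ (upTo n) (λ k → fromℕ (eulerian n k) * falling (x + fromℕ k) n)
    ≈⟨ (∑-by-statistic descents perms (upTo n) (λ k → falling (x + fromℕ k) n) λ π π∈ →
         ∑-pick n (λ k → falling (x + fromℕ k) n)
           (descents-< π (proj₂ (All.lookup (permutations-arrangement n) π∈)) 1≤n)) ⟩
  ∑ perms (λ π → falling (x + fromℕ (descents π)) n) ≈⟨ ∑-permutations-falling x n ⟩
  fromℕ (n !) * x ^ n ∎
  where
  perms = permutations (downFrom n)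

∑-additions : (g : ℕ → RatFun) (x : X) (bs : List (List X)) →
  ∑ (additions x bs) (g ∘ length) ≈ fromℕ (length bs) * g (length bs)
∑-additions g x []       = K.sym (K.zeroˡ _)
∑-additions g x (b ∷ bs) = begin
  u + ∑ (map (b ∷_) (additions x bs)) (g ∘ length)
    ≈⟨ K.+-cong (K.sym (K.*-identityˡ u)) (K.trans (K.reflexive (∑-map (b ∷_) (additions x bs) (g ∘ length)))
         (∑-additions (g ∘ suc) x bs)) ⟩
  1# * u + fromℕ (length bs) * u ≈⟨ K.distribʳ _ _ _ ⟨
  fromℕ (suc (length bs)) * u ∎
  where u = g (suc (length bs))

additions-length : (x : X) (bs : List (List X)) → All (λ cs → length cs ≡ length bs) (additions x bs)
additions-length x []       = []
additions-length x (b ∷ bs) = refl ∷ Allₚ.map⁺ (All.map (≡.cong suc) (additions-length x bs))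

setPartitions-length : (xs : List X) → All (λ bs → length bs ≤ length xs) (setPartitions xs)
setPartitions-length []       = z≤n ∷ []
setPartitions-length (x ∷ xs) = All-concatMap⁺ (setPartitions-length xs) λ {bs} le →
  s≤s le ∷ All.map (λ e → ℕₚ.m≤n⇒m≤1+n (≡.subst (_≤ length xs) (≡.sym e) le)) (additions-length x bs)

-- Lets the sum over k start at 1 instead of 0.
setPartitions-nonempty : (x : X) (xs : List X) → All (λ bs → 1 ≤ length bs) (setPartitions (x ∷ xs))
setPartitions-nonempty x xs = All-concatMap⁺ {Q = λ _ → ⊤}
  (All.universal (λ _ → tt) (setPartitions xs)) λ {bs} _ →
  s≤s z≤n ∷ nonempty bs
  where
  nonempty : ∀ bs → All (λ cs → 1 ≤ length cs) (additions x bs)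
  nonempty []       = []
  nonempty (b ∷ bs) = All.map (λ e → ≡.subst (1 ≤_) (≡.sym e) (s≤s z≤n)) (additions-length x (b ∷ bs))

-- The new element forms a block of its own or joins one of the m blocks present, and (y)ₘ₊₁ + m
-- (y)ₘ = y (y)ₘ for falling factorials.
∑-setPartitions-falling : ∀ y (xs : List X) →
  ∑ (setPartitions xs) (λ bs → falling y (length bs)) ≈ y ^ length xs
∑-setPartitions-falling y []       = K.+-identityʳ 1#
∑-setPartitions-falling y (x ∷ xs) = begin
  ∑ (setPartitions (x ∷ xs)) (λ bs → falling y (length bs))
    ≈⟨ ∑-concatMap _ (setPartitions xs) _ ⟩
  ∑ (setPartitions xs) (λ bs → falling y (suc (length bs)) + ∑ (additions x bs) (λ cs → falling y (length cs)))
    ≈⟨ (∑-cong (setPartitions xs) λ bs → step bs) ⟩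
  ∑ (setPartitions xs) (λ bs → y * falling y (length bs)) ≈⟨ *-∑ y (setPartitions xs) _ ⟨
  y * ∑ (setPartitions xs) (λ bs → falling y (length bs)) ≈⟨ K.*-congˡ (∑-setPartitions-falling y xs) ⟩
  y ^ suc (length xs) ∎
  where
  step : ∀ bs → falling y (suc (length bs)) + ∑ (additions x bs) (λ cs → falling y (length cs))
                  ≈ y * falling y (length bs)
  step bs = begin
    F * (y - m) + ∑ (additions x bs) (λ cs → falling y (length cs))
      ≈⟨ K.+-congˡ (∑-additions (falling y) x bs) ⟩
    F * (y - m) + m * F
      ≈⟨ solve 3 (λ f u m → f :* u :+ m :* f := (u :+ m) :* f) K.refl F (y - m) m ⟩
    (y - m + m) * F ≈⟨ K.*-congʳ (x-y+y y m) ⟩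
    y * F ∎
    where
    F = falling y (length bs)
    m = fromℕ (length bs)

falling-stirling : ∀ x n → 1 ≤ n →
  ∑ (map suc (upTo n)) (λ k → fromℕ (n !) * fromℕ (stirling n k) * binomial x k * fromℕ (k !))
    ≈ fromℕ (n !) * x ^ n
falling-stirling x n@(suc n-1) _ = begin
  ∑ ks (λ k → fromℕ (n !) * fromℕ (stirling n k) * binomial x k * fromℕ (k !))
    ≈⟨ (∑-cong ks λ k → K.trans
         (solve 4 (λ a b c d → a :* b :* c :* d := a :* (b :* (d :* c))) K.refl
           (fromℕ (n !)) (fromℕ (stirling n k)) (binomial x k) (fromℕ (k !)))
         (K.*-congˡ (K.*-congˡ (!*binomial x k)))) ⟩
  ∑ ks (λ k → fromℕ (n !) * (fromℕ (stirling n k) * falling x k)) ≈⟨ *-∑ (fromℕ (n !)) ks _ ⟨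
  fromℕ (n !) * ∑ ks (λ k → fromℕ (stirling n k) * falling x k)
    ≈⟨ K.*-congˡ (∑-by-statistic length blocks ks (falling x) λ bs bs∈ →
         pick (length bs) (All.lookup (setPartitions-nonempty n-1 (downFrom n-1)) bs∈)
           (≡.subst (length bs ≤_) (Listₚ.length-downFrom n)
             (All.lookup (setPartitions-length (downFrom n)) bs∈))) ⟩
  fromℕ (n !) * ∑ blocks (λ bs → falling x (length bs)) ≈⟨ K.*-congˡ (∑-setPartitions-falling x (downFrom n)) ⟩
  fromℕ (n !) * x ^ length (downFrom n)
    ≈⟨ K.reflexive (≡.cong (λ m → fromℕ (n !) * x ^ m) (Listₚ.length-downFrom n)) ⟩
  fromℕ (n !) * x ^ n ∎
  where
  ks = map suc (upTo n)
  blocks = setPartitions (downFrom n)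
  pick : ∀ j → 1 ≤ j → j ≤ n → ∑ ks (λ k → indicator (j ℕₚ.≟ k) * falling x k) ≈ falling x j
  pick (suc j) _ j<n = K.trans (K.reflexive (∑-map suc (upTo n) _))
    (K.trans (∑-cong (upTo n) λ k → K.*-congʳ
      (indicator-⇔ (suc j ℕₚ.≟ suc k) (j ℕₚ.≟ k) ℕₚ.suc-injective (≡.cong suc)))
    (∑-pick n (falling x ∘ suc) j<n))

-- Adding a box and removing a horizontal strip

-- Junk value: the empty list counts as having first row 0.
first : List ℕ → ℕ
first []      = 0
first (x ∷ _) = x

Linked-∷ : ∀ {x l} → first l ≤ x → Linked _≥_ l → Linked _≥_ (x ∷ l)
Linked-∷ {l = []}    _ _ = [-]
Linked-∷ {l = _ ∷ _} p r = p ∷ r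

Linked-first : ∀ {x l} → Linked _≥_ (x ∷ l) → first l ≤ x
Linked-first {l = []}    _       = z≤n
Linked-first {l = _ ∷ _} (p ∷ _) = p

Linked-tail : ∀ {x l} → Linked _≥_ (x ∷ l) → Linked _≥_ l
Linked-tail {l = []}    _       = []
Linked-tail {l = _ ∷ _} (_ ∷ r) = r

bump : List ℕ → List ℕ
bump []       = 1 ∷ []
bump (x ∷ xs) = suc x ∷ xs

-- The partitions obtained by adding a box to l, where the first row may grow up to b only;
-- in raise-lower the box is not added to the first row.
mutual
  raise : ℕ → List ℕ → List (List ℕ)
  raise b l = (if does (first l ℕₚ.<? b) then bump l ∷ [] else []) ++ raise-lower l

  raise-lower : List ℕ → List (List ℕ)
  raise-lower []       = []
  raise-lower (x ∷ xs) = map (x ∷_) (raise x xs)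

up : List ℕ → List (List ℕ)
up l = raise (suc (first l)) l

-- On functions the order is reversed: `D (U F)` removes the strip first and adds the box
-- afterwards. `D` takes strips of every size; the support of `F` selects one.
D U : (List ℕ → RatFun) → List ℕ → RatFun
D F l = ∑ (interlacing l) F
U F l = ∑ (up l) F

∑-raise : ∀ b l F → ∑ (raise b l) F ≈ indicator (first l ℕₚ.<? b) * F (bump l) + ∑ (raise-lower l) F
∑-raise b l F with does (first l ℕₚ.<? b)
... | true  = K.+-congʳ (K.sym (K.*-identityˡ _))
... | false = K.trans (K.sym (K.+-identityˡ _)) (K.+-congʳ (K.sym (K.zeroˡ _)))

-- The case distinction on `ls` lets the `first` local to `interlacing` reduce.
D-∷ : ∀ F l ls → D F (l ∷ ls) ≈ ∑ (upTo (suc l ∸ first ls)) (λ j → D (λ m → F (first ls ℕ.+ j ∷ m)) ls)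
D-∷ F l []       = K.trans
  (∑-cartesianProductWith _∷_ (map (0 ℕ.+_) (upTo (suc l))) (interlacing []) F)
  (K.reflexive (∑-map (0 ℕ.+_) (upTo (suc l)) _))
D-∷ F l (a ∷ ls) = K.trans
  (∑-cartesianProductWith _∷_ (map (a ℕ.+_) (upTo (suc l ∸ a))) (interlacing (a ∷ ls)) F)
  (K.reflexive (∑-map (a ℕ.+_) (upTo (suc l ∸ a)) _))

D-∷-+ : ∀ F {l ls} d → first ls ℕ.+ d ≡ l →
        D F (l ∷ ls) ≈ ∑ (upTo (suc d)) (λ j → D (λ m → F (first ls ℕ.+ j ∷ m)) ls)
D-∷-+ F {_} {ls} d refl = K.trans (D-∷ F (first ls ℕ.+ d) ls)
  (K.reflexive (≡.cong (λ k → ∑ (upTo k) (λ j → D (λ m → F (first ls ℕ.+ j ∷ m)) ls))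
    (≡.trans (≡.cong (_∸ first ls) (≡.sym (ℕₚ.+-suc (first ls) d))) (ℕₚ.m+n∸m≡n (first ls) (suc d)))))

raise-lower-first : ∀ l → All (λ m → first m ≡ first l) (raise-lower l)
raise-lower-first []       = []
raise-lower-first (x ∷ xs) = Allₚ.map⁺ (All.universal (λ _ → refl) (raise x xs))

∑-above : ∀ a d (A : ℕ → RatFun) →
  ∑ (upTo (suc d)) (λ j → indicator (a ℕₚ.<? a ℕ.+ j) * A j) ≈ ∑ (upTo d) (A ∘ suc)
∑-above a d A = begin
  ∑ (upTo (suc d)) (λ j → indicator (a ℕₚ.<? a ℕ.+ j) * A j)
    ≈⟨ ∑-upTo-head d (λ j → indicator (a ℕₚ.<? a ℕ.+ j) * A j) ⟩
  indicator (a ℕₚ.<? a ℕ.+ 0) * A 0 + ∑ (upTo d) (λ j → indicator (a ℕₚ.<? a ℕ.+ suc j) * A (suc j))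
    ≈⟨ K.+-cong
         (indicator-no-* (a ℕₚ.<? a ℕ.+ 0) (ℕₚ.<-irrefl (≡.sym (ℕₚ.+-identityʳ a))) _)
         (∑-cong (upTo d) λ j → indicator-yes-* (a ℕₚ.<? a ℕ.+ suc j) (ℕₚ.m<m+n a (s≤s z≤n)) _) ⟩
  0# + ∑ (upTo d) (A ∘ suc) ≈⟨ K.+-identityˡ _ ⟩
  ∑ (upTo d) (A ∘ suc) ∎

-- The first-row bookkeeping of U D = D U + D, where `A j` collects the results with first row a+j,
-- or the like after a box is added. If a+d < b, both sides are A₀ + 2(A₁ + ... + A_d) + A_{d+1};
-- otherwise a+d = b and both are A₁ + ... + A_d.
balance : ∀ {a d b} (A : ℕ → RatFun) → a ℕ.+ d ≤ b →
  indicator (a ℕ.+ d ℕₚ.<? b) * ∑ (upTo (suc (suc d))) A + ∑ (upTo d) (A ∘ suc)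
    ≈ ∑ (upTo (suc d)) (λ j → indicator (a ℕ.+ j ℕₚ.<? b) * A (suc j))
      + indicator (a ℕ.+ d ℕₚ.<? b) * ∑ (upTo (suc d)) A
balance {a} {d} {b} A l≤b = go (a ℕ.+ d ℕₚ.<? b)
  where
  i = indicator (a ℕ.+ d ℕₚ.<? b)
  B : ℕ → RatFun
  B j = indicator (a ℕ.+ j ℕₚ.<? b) * A (suc j)
  S = ∑ (upTo (suc d)) (A ∘ suc)

  B≈A : ∀ j → a ℕ.+ j < b → A (suc j) ≈ B j
  B≈A j j<b = K.sym (indicator-yes-* (a ℕ.+ j ℕₚ.<? b) j<b _)

  go : Dec (a ℕ.+ d < b) →
       i * ∑ (upTo (suc (suc d))) A + ∑ (upTo d) (A ∘ suc) ≈ ∑ (upTo (suc d)) B + i * ∑ (upTo (suc d)) A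
  go (yes l<b) = begin
    i * ∑ (upTo (suc (suc d))) A + ∑ (upTo d) (A ∘ suc)
      ≈⟨ K.+-congʳ (K.trans (i* _) (∑-upTo-head (suc d) A)) ⟩
    A 0 + S + ∑ (upTo d) (A ∘ suc)
      ≈⟨ solve 3 (λ a s t → a :+ s :+ t := s :+ (a :+ t)) K.refl (A 0) S (∑ (upTo d) (A ∘ suc)) ⟩
    S + (A 0 + ∑ (upTo d) (A ∘ suc))
      ≈⟨ K.+-cong
           (∑-cong-∈ (upTo (suc d)) λ j j∈ →
             B≈A j (ℕₚ.≤-<-trans (ℕₚ.+-monoʳ-≤ a (ℕ.s≤s⁻¹ (∈-upTo⁻ j∈))) l<b))
           (K.sym (K.trans (i* _) (∑-upTo-head d A))) ⟩
    ∑ (upTo (suc d)) B + i * ∑ (upTo (suc d)) A ∎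
    where
    i* : ∀ x → i * x ≈ x
    i* x = indicator-yes-* (a ℕ.+ d ℕₚ.<? b) l<b x
  go (no l≮b) = begin
    i * ∑ (upTo (suc (suc d))) A + ∑ (upTo d) (A ∘ suc)
      ≈⟨ K.trans (K.+-congʳ (i* _)) (K.+-identityˡ _) ⟩
    ∑ (upTo d) (A ∘ suc)
      ≈⟨ (∑-cong-∈ (upTo d) λ j j∈ → B≈A j (ℕₚ.<-≤-trans (ℕₚ.+-monoʳ-< a (∈-upTo⁻ j∈)) l≤b)) ⟩
    ∑ (upTo d) B          ≈⟨ K.+-identityʳ _ ⟨
    ∑ (upTo d) B + 0#     ≈⟨ K.+-congˡ (i* _) ⟨
    ∑ (upTo d) B + B d    ≈⟨ ∑-upTo-last d B ⟨
    ∑ (upTo (suc d)) B    ≈⟨ K.trans (K.+-congˡ (i* _)) (K.+-identityʳ _) ⟨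
    ∑ (upTo (suc d)) B + i * ∑ (upTo (suc d)) A ∎
    where
    i* : ∀ x → i * x ≈ 0#
    i* x = indicator-no-* (a ℕ.+ d ℕₚ.<? b) l≮b x

-- A box added to the second row raises the lower limit of the first row from a to a+1 and so
-- excludes j = 0. That is the same as forbidding the second row to outgrow a+j: the row above takes
-- the role of the bound.
∑-raise-lower-D : ∀ F {l ls} d → first ls ℕ.+ d ≡ l →
  ∑ (raise-lower (l ∷ ls)) (D F)
    ≈ ∑ (upTo (suc d)) (λ j → ∑ (raise (first ls ℕ.+ j) ls) (D (λ m → F (first ls ℕ.+ j ∷ m))))
∑-raise-lower-D F {_} {ls} d refl = begin
  ∑ (map (l ∷_) (raise l ls)) (D F) ≡⟨ ∑-map (l ∷_) (raise l ls) (D F) ⟩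
  ∑ (raise l ls) (λ m → D F (l ∷ m)) ≈⟨ ∑-raise l ls (λ m → D F (l ∷ m)) ⟩
  indicator (a ℕₚ.<? l) * D F (l ∷ bump ls) + ∑ (raise-lower ls) (λ m → D F (l ∷ m))
    ≈⟨ K.+-cong (top d) (begin
         ∑ (raise-lower ls) (λ m → D F (l ∷ m))
           ≈⟨ (∑-cong-∈ (raise-lower ls) λ m m∈ → lower m (All.lookup (raise-lower-first ls) m∈)) ⟩
         ∑ (raise-lower ls) (λ m → ∑ (upTo (suc d)) (λ j → D (G j) m))
           ≈⟨ ∑-swap (raise-lower ls) (upTo (suc d)) _ ⟩
         ∑ (upTo (suc d)) (λ j → ∑ (raise-lower ls) (D (G j))) ∎) ⟩
  ∑ (upTo (suc d)) (λ j → indicator (a ℕₚ.<? a ℕ.+ j) * D (G j) (bump ls))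
      + ∑ (upTo (suc d)) (λ j → ∑ (raise-lower ls) (D (G j)))
    ≈⟨ ∑-+ (upTo (suc d)) _ _ ⟨
  ∑ (upTo (suc d)) (λ j → indicator (a ℕₚ.<? a ℕ.+ j) * D (G j) (bump ls) + ∑ (raise-lower ls) (D (G j)))
    ≈⟨ (∑-cong (upTo (suc d)) λ j → K.sym (∑-raise (a ℕ.+ j) ls (D (G j)))) ⟩
  ∑ (upTo (suc d)) (λ j → ∑ (raise (a ℕ.+ j) ls) (D (G j))) ∎
  where
  a = first ls
  l = a ℕ.+ d
  G : ℕ → List ℕ → RatFun
  G j m = F (a ℕ.+ j ∷ m)

  lower : ∀ m → first m ≡ a → D F (l ∷ m) ≈ ∑ (upTo (suc d)) (λ j → D (G j) m)
  lower m e = K.trans (D-∷-+ F {ls = m} d (≡.cong (ℕ._+ d) e)) (K.reflexive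
    (≡.cong (λ x → ∑ (upTo (suc d)) (λ j → D (λ k → F (x ℕ.+ j ∷ k)) m)) e))

  first-bump : ∀ l → first (bump l) ≡ suc (first l)
  first-bump []      = refl
  first-bump (_ ∷ _) = refl

  top : ∀ d → indicator (a ℕₚ.<? a ℕ.+ d) * D F (a ℕ.+ d ∷ bump ls)
              ≈ ∑ (upTo (suc d)) (λ j → indicator (a ℕₚ.<? a ℕ.+ j) * D (G j) (bump ls))
  top zero    = K.trans
    (indicator-no-* (a ℕₚ.<? a ℕ.+ 0) (ℕₚ.<-irrefl (≡.sym (ℕₚ.+-identityʳ a))) _)
    (K.sym (∑-above a 0 (λ j → D (G j) (bump ls))))
  top (suc d) = K.trans
    (indicator-yes-* (a ℕₚ.<? a ℕ.+ suc d) (ℕₚ.m<m+n a (s≤s z≤n)) _)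
    (K.trans (D-∷-+ F {ls = bump ls} d (≡.trans (≡.cong (ℕ._+ d) (first-bump ls)) (≡.sym (ℕₚ.+-suc a d))))
    (K.trans (∑-cong (upTo (suc d)) λ j → K.reflexive (≡.cong (λ x → D (λ k → F (x ∷ k)) (bump ls))
      (≡.trans (≡.cong (ℕ._+ j) (first-bump ls)) (≡.sym (ℕₚ.+-suc a j)))))
    (K.sym (∑-above a (suc d) (λ j → D (G j) (bump ls))))))

D-+ : ∀ F G l → D (λ m → F m + G m) l ≈ D F l + D G l
D-+ F G l = ∑-+ (interlacing l) F G

-- The bounded form of U D = D U + D, which can be proved row by row.
raise-D : ∀ {F} → Stable F → ∀ b l → Linked _≥_ l → first l ≤ b →
  ∑ (raise b l) (D F) ≈ D (λ m → ∑ (raise b m) F) l + indicator (first l ℕₚ.<? b) * D F l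
raise-D {F} st zero    [] _ _ = K.sym (K.trans (K.+-congʳ (K.+-identityʳ 0#))
  (K.trans (K.+-identityˡ _) (K.zeroˡ _)))
raise-D {F} st (suc b) [] _ _ = begin
  F (0 ∷ []) + (F (1 ∷ []) + 0#) + 0#
    -- Removing the only box leaves a zero row, not the empty list; stability identifies the two.
    ≈⟨ K.+-congʳ (K.+-congʳ (st [])) ⟩
  F [] + (F (1 ∷ []) + 0#) + 0#
    ≈⟨ solve 3 (λ a c o → a :+ c :+ o := c :+ (a :+ o)) K.refl (F []) (F (1 ∷ []) + 0#) 0# ⟩
  F (1 ∷ []) + 0# + (F [] + 0#)
    ≈⟨ K.+-cong (K.sym (K.+-identityʳ _)) (K.sym (K.*-identityˡ _)) ⟩
  F (1 ∷ []) + 0# + 0# + 1# * (F [] + 0#) ∎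
raise-D {F} st b (l ∷ ls) dec l≤b = begin
  ∑ (raise b (l ∷ ls)) (D F)
    ≈⟨ ∑-raise b (l ∷ ls) (D F) ⟩
  i * D F (suc l ∷ ls) + ∑ (raise-lower (l ∷ ls)) (D F)
    ≈⟨ K.+-cong (K.*-congˡ (D-∷-+ F {ls = ls} (suc d) (≡.trans (ℕₚ.+-suc a d) (≡.cong suc a+d≡l))))
         (K.trans (∑-raise-lower-D F {ls = ls} d a+d≡l) (∑-cong (upTo (suc d)) λ j →
           raise-D (λ m → st (a ℕ.+ j ∷ m)) (a ℕ.+ j) ls (Linked-tail dec) (ℕₚ.m≤m+n a j))) ⟩
  i * ∑ (upTo (suc (suc d))) A + ∑ (upTo (suc d)) (λ j → Q j + indicator (a ℕₚ.<? a ℕ.+ j) * A j)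
    ≈⟨ K.+-congˡ (K.trans (∑-+ (upTo (suc d)) Q _) (K.+-congˡ (∑-above a d A))) ⟩
  i * ∑ (upTo (suc (suc d))) A + (∑ (upTo (suc d)) Q + ∑ (upTo d) (A ∘ suc))
    ≈⟨ solve 3 (λ x y z → x :+ (y :+ z) := y :+ (x :+ z)) K.refl _ (∑ (upTo (suc d)) Q) _ ⟩
  ∑ (upTo (suc d)) Q + (i * ∑ (upTo (suc (suc d))) A + ∑ (upTo d) (A ∘ suc))
    -- The `Q j`, with the box below the first row, occur on both sides; the rest concerns the first
    -- row only.
    ≈⟨ K.+-congˡ balanced ⟩
  ∑ (upTo (suc d)) Q + (∑ (upTo (suc d)) B + i * ∑ (upTo (suc d)) A)
    ≈⟨ solve 3 (λ x y z → x :+ (y :+ z) := (y :+ x) :+ z) K.refl (∑ (upTo (suc d)) Q) _ _ ⟩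
  (∑ (upTo (suc d)) B + ∑ (upTo (suc d)) Q) + i * ∑ (upTo (suc d)) A
    ≈⟨ K.+-cong (K.sym right) (K.*-congˡ (K.sym (D-∷-+ F {ls = ls} d a+d≡l))) ⟩
  D (λ m → ∑ (raise b m) F) (l ∷ ls) + i * D F (l ∷ ls) ∎
  where
  a = first ls
  d = l ∸ a
  a+d≡l : a ℕ.+ d ≡ l
  a+d≡l = ℕₚ.m+[n∸m]≡n (Linked-first dec)
  i = indicator (l ℕₚ.<? b)
  A Q B : ℕ → RatFun
  A j = D (λ m → F (a ℕ.+ j ∷ m)) ls
  Q j = D (λ m → ∑ (raise (a ℕ.+ j) m) (λ k → F (a ℕ.+ j ∷ k))) ls
  B j = indicator (a ℕ.+ j ℕₚ.<? b) * A (suc j)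
  balanced : i * ∑ (upTo (suc (suc d))) A + ∑ (upTo d) (A ∘ suc) ≈ ∑ (upTo (suc d)) B + i * ∑ (upTo (suc d)) A
  balanced = ≡.subst (λ l → indicator (l ℕₚ.<? b) * ∑ (upTo (suc (suc d))) A + ∑ (upTo d) (A ∘ suc)
                              ≈ ∑ (upTo (suc d)) B + indicator (l ℕₚ.<? b) * ∑ (upTo (suc d)) A)
    a+d≡l (balance {a} A (≡.subst (_≤ b) (≡.sym a+d≡l) l≤b))
  right : D (λ m → ∑ (raise b m) F) (l ∷ ls) ≈ ∑ (upTo (suc d)) B + ∑ (upTo (suc d)) Q
  right = begin
    D (λ m → ∑ (raise b m) F) (l ∷ ls)
      ≈⟨ D-∷-+ (λ m → ∑ (raise b m) F) {ls = ls} d a+d≡l ⟩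
    ∑ (upTo (suc d)) (λ j → D (λ m → ∑ (raise b (a ℕ.+ j ∷ m)) F) ls)
      ≈⟨ (∑-cong (upTo (suc d)) λ j → begin
        D (λ m → ∑ (raise b (a ℕ.+ j ∷ m)) F) ls
          ≈⟨ (∑-cong (interlacing ls) λ m → K.trans (∑-raise b (a ℕ.+ j ∷ m) F)
               (K.+-cong (K.*-congˡ (K.reflexive (≡.cong (λ x → F (x ∷ m)) (≡.sym (ℕₚ.+-suc a j)))))
                         (K.reflexive (∑-map (a ℕ.+ j ∷_) (raise (a ℕ.+ j) m) F)))) ⟩
        D (λ m → indicator (a ℕ.+ j ℕₚ.<? b) * F (a ℕ.+ suc j ∷ m)
               + ∑ (raise (a ℕ.+ j) m) (λ k → F (a ℕ.+ j ∷ k))) ls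
          ≈⟨ D-+ (λ m → indicator (a ℕ.+ j ℕₚ.<? b) * F (a ℕ.+ suc j ∷ m)) _ ls ⟩
        D (λ m → indicator (a ℕ.+ j ℕₚ.<? b) * F (a ℕ.+ suc j ∷ m)) ls + Q j
          ≈⟨ K.+-congʳ (K.sym (*-∑ _ (interlacing ls) _)) ⟩
        B j + Q j ∎) ⟩
    ∑ (upTo (suc d)) (λ j → B j + Q j) ≈⟨ ∑-+ (upTo (suc d)) B Q ⟩
    ∑ (upTo (suc d)) B + ∑ (upTo (suc d)) Q ∎

infix 4 _≺_
data _≺_ : List ℕ → List ℕ → Set where
  []  : [] ≺ []
  row : ∀ {m l ms ls} → first ls ≤ m → m ≤ l → ms ≺ ls → m ∷ ms ≺ l ∷ ls

a+j≤l : ∀ a l {j} → j < suc l ∸ a → a ℕ.+ j ≤ l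
a+j≤l zero    l       j< = ℕ.s≤s⁻¹ j<
a+j≤l (suc a) zero {j} j< = contradiction (≡.subst (j <_) (ℕₚ.0∸n≡0 a) j<) ℕₚ.n≮0
a+j≤l (suc a) (suc l) j< = s≤s (a+j≤l a l j<)

∈-interlacing⁻ : ∀ l {m} → m ∈ interlacing l → m ≺ l
∈-interlacing⁻ []       (here refl) = []
∈-interlacing⁻ (l ∷ []) m∈ with ∈-cartesianProductWith⁻ _∷_ (map (0 ℕ.+_) (upTo (suc l))) (interlacing []) m∈
... | _ , _ , x∈ , ms∈ , refl with ∈-map⁻ (0 ℕ.+_) x∈
... | j , j∈ , refl = row z≤n (ℕ.s≤s⁻¹ (∈-upTo⁻ j∈)) (∈-interlacing⁻ [] ms∈)
∈-interlacing⁻ (l ∷ a ∷ ls) m∈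
  with ∈-cartesianProductWith⁻ _∷_ (map (a ℕ.+_) (upTo (suc l ∸ a))) (interlacing (a ∷ ls)) m∈
... | _ , _ , x∈ , ms∈ , refl with ∈-map⁻ (a ℕ.+_) x∈
... | j , j∈ , refl = row (ℕₚ.m≤m+n a j) (a+j≤l a l (∈-upTo⁻ j∈)) (∈-interlacing⁻ (a ∷ ls) ms∈)

∈-interlacing⁺ : ∀ {l m} → m ≺ l → m ∈ interlacing l
∈-interlacing⁺ [] = here refl
∈-interlacing⁺ (row {m} {l} {ls = []} a≤m m≤l ms≺ls) = ∈-cartesianProductWith⁺ _∷_
  (∈-map⁺ (0 ℕ.+_) (∈-upTo⁺ (s≤s m≤l))) (∈-interlacing⁺ ms≺ls)
∈-interlacing⁺ (row {m} {l} {ls = a ∷ ls} a≤m m≤l ms≺ls) = ∈-cartesianProductWith⁺ _∷_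
  (≡.subst (_∈ map (a ℕ.+_) (upTo (suc l ∸ a))) (ℕₚ.m+[n∸m]≡n a≤m)
    (∈-map⁺ (a ℕ.+_) (∈-upTo⁺ (ℕₚ.∸-monoˡ-< (s≤s m≤l) a≤m)))) (∈-interlacing⁺ ms≺ls)

-- Expansion of h₁ⁿ in Schur functions

paths : ℕ → List (List ℕ)
paths zero    = [] ∷ []
paths (suc n) = concatMap up (paths n)

-- A partition λ occurs in `paths n` once for each way to build it box by box, so this is ∑ f^λ
-- F(λ).
E : ℕ → (List ℕ → RatFun) → RatFun
E n F = ∑ (paths n) F

IsPartition : List ℕ → Set
IsPartition l = Linked _≥_ l × All (0 <_) l

raise-partition : ∀ b l → IsPartition l → first l ≤ b →
  All (λ m → first m ≤ b × IsPartition m × sum m ≡ suc (sum l)) (raise b l)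
raise-partition b l (dec , pos) l≤b = Allₚ.++⁺ top (lower l dec pos l≤b)
  where
  bump-partition : ∀ l → IsPartition l → IsPartition (bump l) × sum (bump l) ≡ suc (sum l)
  bump-partition []       _             = ([-] , s≤s z≤n ∷ []) , refl
  bump-partition (x ∷ xs) (dec , _ ∷ p) =
    (Linked-∷ (ℕₚ.m≤n⇒m≤1+n (Linked-first dec)) (Linked-tail dec) , s≤s z≤n ∷ p) , refl

  first-bump≤ : ∀ l → first l < b → first (bump l) ≤ b
  first-bump≤ []      p = p
  first-bump≤ (_ ∷ _) p = p

  top : All _ (if first l <ᵇ b then bump l ∷ [] else [])
  top with first l <ᵇ b | ℕₚ.<ᵇ⇒< (first l) b
  ... | true  | l<b = (first-bump≤ l (l<b _) , bump-partition l (dec , pos)) ∷ []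
  ... | false | _   = []

  lower : ∀ l → Linked _≥_ l → All (0 <_) l → first l ≤ b →
          All (λ m → first m ≤ b × IsPartition m × sum m ≡ suc (sum l)) (raise-lower l)
  lower []       _   _          _   = []
  lower (x ∷ xs) dec (x>0 ∷ xs>0) x≤b = Allₚ.map⁺ (All.map
    (λ (m≤x , (dec′ , pos′) , e) →
      x≤b , (Linked-∷ m≤x dec′ , x>0 ∷ pos′) , ≡.trans (≡.cong (x ℕ.+_) e) (ℕₚ.+-suc x (sum xs)))
    (raise-partition x xs (Linked-tail dec , xs>0) (Linked-first dec)))

paths-partition : ∀ n → All (λ l → IsPartition l × sum l ≡ n) (paths n)
paths-partition zero    = (([] , []) , refl) ∷ []
paths-partition (suc n) = All-concatMap⁺ (paths-partition n) λ {l} (part , e) →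
  All.map (λ (_ , part′ , e′) → part′ , ≡.trans e′ (≡.cong suc e))
    (raise-partition (suc (first l)) l part (ℕₚ.n≤1+n _))

type-partition : ∀ {l} → IsPartition l → type l ≡ l
type-partition {l} (dec , pos) rewrite Listₚ.filter-all (0 ℕₚ.<?_) pos =
  ListEq.≋⇒≡ (Sortedₚ.↗↭↗⇒≋ (DecTotalOrder.totalOrder ≥-decTotalOrder)
    (sort-↗ l) dec (Perm.↭⇒↭ₛ (sort-↭ l)))

E-cong : ∀ n {F G} → (∀ l → IsPartition l → sum l ≡ n → F l ≈ G l) → E n F ≈ E n G
E-cong n e = ∑-cong-∈ (paths n) λ l l∈ → let (part , s) = All.lookup (paths-partition n) l∈ in e l part s

E-suc : ∀ n F → E (suc n) F ≈ E n (U F)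
E-suc n F = ∑-concatMap up (paths n) F

raise-sum : ∀ b l → All (λ m → sum m ≡ suc (sum l)) (raise b l)
raise-sum b l = Allₚ.++⁺ top (lower l)
  where
  sum-bump : ∀ l → sum (bump l) ≡ suc (sum l)
  sum-bump []       = refl
  sum-bump (_ ∷ _)  = refl
  top : All _ (if first l <ᵇ b then bump l ∷ [] else [])
  top with first l <ᵇ b
  ... | true  = sum-bump l ∷ []
  ... | false = []
  lower : ∀ l → All (λ m → sum m ≡ suc (sum l)) (raise-lower l)
  lower []       = []
  lower (x ∷ xs) = Allₚ.map⁺ (All.map
    (λ e → ≡.trans (≡.cong (x ℕ.+_) e) (ℕₚ.+-suc x (sum xs))) (raise-sum x xs))

Supported : ℕ → (List ℕ → RatFun) → Set
Supported d F = ∀ l → sum l ≢ d → F l ≈ 0#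

U-supported : ∀ {d F} → Supported (suc d) F → Supported d (U F)
U-supported sp l l≢d = ∑-zero (up l) λ m m∈ → sp m λ e →
  l≢d (ℕₚ.suc-injective (≡.trans (≡.sym (All.lookup (raise-sum (suc (first l)) l) m∈)) e))

U-zero : ∀ {F} → Supported 0 F → ∀ l → U F l ≈ 0#
U-zero sp l = ∑-zero (up l) λ m m∈ → sp m λ e →
  contradiction (≡.trans (≡.sym (All.lookup (raise-sum (suc (first l)) l) m∈)) e) ℕₚ.1+n≢0

raise-stable : ∀ {F} → Stable F → ∀ b l → ∑ (raise b (l ∷ʳ 0)) F ≈ ∑ (raise b l) F
-- A missing row and a zero row both become a row with one box, and nothing can be added below a
-- zero row.
raise-stable {F} st b []       = K.trans (∑-raise b (0 ∷ []) F) (K.sym (∑-raise b [] F))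
raise-stable {F} st b (x ∷ xs) = begin
  ∑ (raise b (x ∷ xs ∷ʳ 0)) F
    ≈⟨ ∑-raise b (x ∷ xs ∷ʳ 0) F ⟩
  indicator (x ℕₚ.<? b) * F (suc x ∷ xs ∷ʳ 0) + ∑ (map (x ∷_) (raise x (xs ∷ʳ 0))) F
    ≈⟨ K.+-congˡ (K.reflexive (∑-map (x ∷_) (raise x (xs ∷ʳ 0)) F)) ⟩
  indicator (x ℕₚ.<? b) * F (suc x ∷ xs ∷ʳ 0) + ∑ (raise x (xs ∷ʳ 0)) (λ m → F (x ∷ m))
    ≈⟨ K.+-cong (K.*-congˡ (st (suc x ∷ xs))) (raise-stable (λ m → st (x ∷ m)) x xs) ⟩
  indicator (x ℕₚ.<? b) * F (suc x ∷ xs) + ∑ (raise x xs) (λ m → F (x ∷ m))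
    ≈⟨ K.+-congˡ (K.reflexive (∑-map (x ∷_) (raise x xs) F)) ⟨
  indicator (x ℕₚ.<? b) * F (suc x ∷ xs) + ∑ (map (x ∷_) (raise x xs)) F
    ≈⟨ ∑-raise b (x ∷ xs) F ⟨
  ∑ (raise b (x ∷ xs)) F ∎

first-∷ʳ0 : ∀ l → first (l ∷ʳ 0) ≡ first l
first-∷ʳ0 []      = refl
first-∷ʳ0 (_ ∷ _) = refl

U-stable : ∀ {F} → Stable F → Stable (U F)
U-stable {F} st l = K.trans (raise-stable st (suc (first (l ∷ʳ 0))) l)
  (K.reflexive (≡.cong (λ x → ∑ (raise (suc x) l) F) (first-∷ʳ0 l)))

D-stable : ∀ {F} → Stable F → Stable (D F)
D-stable st []               = K.+-congʳ (st [])
D-stable {F} st (l ∷ ls) = begin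
  D F (l ∷ ls ∷ʳ 0)
    ≈⟨ D-∷ F l (ls ∷ʳ 0) ⟩
  ∑ (upTo (suc l ∸ first (ls ∷ʳ 0))) (λ j → D (λ m → F (first (ls ∷ʳ 0) ℕ.+ j ∷ m)) (ls ∷ʳ 0))
    ≡⟨ ≡.cong (λ a → ∑ (upTo (suc l ∸ a)) (λ j → D (λ m → F (a ℕ.+ j ∷ m)) (ls ∷ʳ 0))) (first-∷ʳ0 ls) ⟩
  ∑ (upTo (suc l ∸ first ls)) (λ j → D (λ m → F (first ls ℕ.+ j ∷ m)) (ls ∷ʳ 0))
    ≈⟨ (∑-cong (upTo (suc l ∸ first ls)) λ j → D-stable (λ m → st (first ls ℕ.+ j ∷ m)) ls) ⟩
  ∑ (upTo (suc l ∸ first ls)) (λ j → D (λ m → F (first ls ℕ.+ j ∷ m)) ls)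
    ≈⟨ D-∷ F l ls ⟨
  D F (l ∷ ls) ∎

≺-first : ∀ {m l} → m ≺ l → first m ≤ first l
≺-first []            = z≤n
≺-first (row _ m≤l _) = m≤l

raise-full : ∀ {b} l F → first l < b → ∑ (raise b l) F ≈ U F l
raise-full {b} l F l<b = K.trans (∑-raise b l F)
  (K.trans (K.+-congʳ (K.*-congʳ (indicator-⇔ (first l ℕₚ.<? b) (first l ℕₚ.<? suc (first l))
    (λ _ → ℕₚ.n<1+n _) (λ _ → l<b))))
  (K.sym (∑-raise (suc (first l)) l F)))

-- With b one above the first row the bound is vacuous, for l and for every m interlacing with l, as
-- the first row of m is no longer.
U-D : ∀ {F} → Stable F → ∀ l → Linked _≥_ l → U (D F) l ≈ D (U F) l + D F l
U-D {F} st l dec = K.trans (raise-D st (suc (first l)) l dec (ℕₚ.n≤1+n _))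
  (K.+-cong
    (∑-cong-∈ (interlacing l) λ m m∈ → raise-full m F (s≤s (≺-first (∈-interlacing⁻ l m∈))))
    (indicator-yes-* (first l ℕₚ.<? suc (first l)) (ℕₚ.n<1+n _) _))

pascal : ∀ n k → fromℕ (n C k) + fromℕ (n C suc k) ≈ fromℕ (suc n C suc k)
pascal n k = K.trans (K.sym (fromℕ-+ (n C k) (n C suc k)))
  (K.reflexive (≡.cong fromℕ (nCk+nC[k+1]≡[n+1]C[k+1] n k)))

-- For d ≤ n this says that the adjoint of multiplication by h_{n-d} sends h₁ⁿ to (n choose d) h₁^d.
-- Moving one `U` past `D` yields Pascal's rule, because `U F` is supported one degree lower and
-- `E d (U F)` is `E (suc d) F`.
E-D : ∀ n d {F} → Stable F → Supported d F → E n (D F) ≈ fromℕ (n C d) * E d F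
E-D zero zero {F} st sp = K.sym (K.trans (K.*-congʳ (K.+-identityʳ 1#))
  (K.trans (K.*-identityˡ _) (K.sym (K.+-identityʳ _))))
E-D zero (suc d) {F} st sp = K.trans
  (K.trans (K.+-identityʳ _) (K.trans (K.+-identityʳ _) (sp [] λ ())))
  (K.sym (K.trans (K.*-congʳ (K.reflexive (≡.cong fromℕ (k>n⇒nCk≡0 {0} {suc d} (s≤s z≤n))))) (K.zeroˡ _)))
E-D (suc n) d {F} st sp = begin
  E (suc n) (D F)                ≈⟨ E-suc n (D F) ⟩
  E n (U (D F))                  ≈⟨ E-cong n (λ l (dec , _) _ → U-D st l dec) ⟩
  E n (λ l → D (U F) l + D F l)  ≈⟨ ∑-+ (paths n) (D (U F)) (D F) ⟩
  E n (D (U F)) + E n (D F)      ≈⟨ K.+-congˡ (E-D n d st sp) ⟩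
  E n (D (U F)) + fromℕ (n C d) * E d F ≈⟨ final d sp ⟩
  fromℕ (suc n C d) * E d F ∎
  where
  final : ∀ d → Supported d F → E n (D (U F)) + fromℕ (n C d) * E d F ≈ fromℕ (suc n C d) * E d F
  final zero    sp = K.trans (K.+-congʳ (∑-zero (paths n) λ l _ → ∑-zero (interlacing l) λ m _ → U-zero sp m))
    (K.+-identityˡ _)
  final (suc d) sp = begin
    E n (D (U F)) + fromℕ (n C suc d) * E (suc d) F
      ≈⟨ K.+-congʳ (K.trans (E-D n d (U-stable st) (U-supported sp)) (K.*-congˡ (K.sym (E-suc d F)))) ⟩
    fromℕ (n C d) * E (suc d) F + fromℕ (n C suc d) * E (suc d) F
      ≈⟨ K.distribʳ _ _ _ ⟨
    (fromℕ (n C d) + fromℕ (n C suc d)) * E (suc d) F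
      ≈⟨ K.*-congʳ (pascal n d) ⟩
    fromℕ (suc n C suc d) * E (suc d) F ∎

-- Kostka numbers as functions of the shape, and the coefficients of h₁ⁿ

κ : List ℕ → List ℕ → RatFun
κ v l = fromℕ (length (chains l v))

κ-supported : ∀ v → Supported (sum v) (κ v)
κ-supported v l l≢v = K.reflexive (≡.cong (fromℕ ∘ length) (chains-size l v l≢v))

length-concatMap : {A B : Set} (g : A → List B) (xs : List A) →
  fromℕ (length (concatMap g xs)) ≈ ∑ xs (λ x → fromℕ (length (g x)))
length-concatMap g xs = K.trans (fromℕ-length (concatMap g xs))
  (K.trans (∑-concatMap g xs _) (∑-cong xs λ x → K.sym (fromℕ-length (g x))))

κ-∷ : ∀ w v l → sum l ≡ w ℕ.+ sum v → κ (w ∷ v) l ≈ D (κ v) l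
κ-∷ w v l e = begin
  κ (w ∷ v) l
    ≈⟨ length-concatMap _ ms ⟩
  ∑ ms (λ m → fromℕ (length (map (l ∷_) (chains m v))))
    ≈⟨ (∑-cong ms λ m → K.reflexive (≡.cong fromℕ (Listₚ.length-map (l ∷_) (chains m v)))) ⟩
  ∑ ms (κ v)
    ≈⟨ ∑-filter (λ m → sum m ℕ.+ w ℕₚ.≟ sum l) (interlacing l) (κ v) ⟩
  ∑ (interlacing l) (λ m → indicator (sum m ℕ.+ w ℕₚ.≟ sum l) * κ v m)
    ≈⟨ ∑-cong (interlacing l) automatic ⟩
  D (κ v) l ∎
  where
  ms = filter (λ m → sum m ℕ.+ w ℕₚ.≟ sum l) (interlacing l)
  automatic : ∀ m → indicator (sum m ℕ.+ w ℕₚ.≟ sum l) * κ v m ≈ κ v m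
  automatic m with sum m ℕₚ.≟ sum v
  ... | yes m≡v = indicator-yes-* (sum m ℕ.+ w ℕₚ.≟ sum l)
    (≡.trans (≡.cong (ℕ._+ w) m≡v) (≡.trans (ℕₚ.+-comm (sum v) w) (≡.sym e))) _
  ... | no m≢v  = K.trans (K.*-congˡ (κ-supported v m m≢v)) (K.trans (K.zeroʳ _) (K.sym (κ-supported v m m≢v)))

sum-∷ʳ0 : ∀ l → sum (l ∷ʳ 0) ≡ sum l
sum-∷ʳ0 []       = refl
sum-∷ʳ0 (x ∷ xs) = ≡.cong (x ℕ.+_) (sum-∷ʳ0 xs)

κ-[] : ∀ l → κ [] l ≈ indicator (sum l ℕₚ.≟ 0)
κ-[] l with does (sum l ℕₚ.≟ 0)
... | true  = K.+-identityʳ 1#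
... | false = K.refl

κ-stable : ∀ v → Stable (κ v)
κ-stable []      l = K.trans (κ-[] (l ∷ʳ 0)) (K.trans
  (K.reflexive (≡.cong (λ n → indicator (n ℕₚ.≟ 0)) (sum-∷ʳ0 l)))
  (K.sym (κ-[] l)))
κ-stable (w ∷ v) l with sum l ℕₚ.≟ w ℕ.+ sum v
... | yes e  = K.trans (κ-∷ w v (l ∷ʳ 0) (≡.trans (sum-∷ʳ0 l) e))
  (K.trans (D-stable (κ-stable v) l) (K.sym (κ-∷ w v l e)))
... | no l≢v = K.trans (κ-supported (w ∷ v) (l ∷ʳ 0) (l≢v ∘ ≡.trans (≡.sym (sum-∷ʳ0 l))))
  (K.sym (κ-supported (w ∷ v) l l≢v))

H : ℕ → Series
H n = series (h (1^ n))

⊛-*ʳ : ∀ {f g} c v → (f ⊛ (λ b → c * g b)) v ≈ c * (f ⊛ g) v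
⊛-*ʳ {f} {g} c []      = solve 3 (λ f c g → f :* (c :* g) := c :* (f :* g)) K.refl (f []) c (g [])
⊛-*ʳ {f} {g} c (a ∷ v) = K.trans
  (∑-cong (upTo (suc a)) λ i → ⊛-*ʳ c v) (K.sym (*-∑ c (upTo (suc a)) _))

⊛-zeroˡ : ∀ {f g} v → (∀ b → f b ≈ 0#) → (f ⊛ g) v ≈ 0#
⊛-zeroˡ v z = ⊛-zero v λ b _ _ → inj₁ (z b)

⊛-identityˡ : ∀ g v → ((λ b → indicator (sum b ℕₚ.≟ 0)) ⊛ g) v ≈ g v
⊛-identityˡ g []      = K.*-identityˡ _
⊛-identityˡ g (a ∷ v) = begin
  ∑ (upTo (suc a)) f          ≈⟨ ∑-upTo-head a f ⟩
  f 0 + ∑ (upTo a) (f ∘ suc)  ≈⟨ K.+-cong (⊛-identityˡ (λ c → g (a ∷ c)) v)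
                                  (∑-zero (upTo a) λ i _ → ⊛-zeroˡ v λ _ → K.refl) ⟩
  g (a ∷ v) + 0#              ≈⟨ K.+-identityʳ _ ⟩
  g (a ∷ v) ∎
  where
  f : ℕ → RatFun
  f i = ((λ b → indicator (sum (i ∷ b) ℕₚ.≟ 0)) ⊛ (λ c → g (a ∸ i ∷ c))) v

-- The coefficients of h₁ without the sorting in `type`, so that they reduce on `i ∷ b`.
c₁ : Series
c₁ b = indicator (sum b ℕₚ.≟ 1)

H-suc : ∀ n v → H (suc n) v ≈ (c₁ ⊛ H n) v
H-suc n = ⊛-cong (λ b → K.reflexive (≡.cong (λ k → indicator (k ℕₚ.≟ 1)) (sum-type b))) (λ _ → K.refl)

-- The binomial theorem for (x₁ + (x₂ + x₃ + ...))ⁿ. In the induction one more factor h₁ contributes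
-- either x₁, the term `f 1`, or another variable, the term `f 0`; Pascal's rule merges them.
H-∷ : ∀ n w v → H n (w ∷ v) ≈ fromℕ (n C w) * H (n ∸ w) v
H-∷ zero    zero    v = K.sym (K.trans (K.*-congʳ (K.+-identityʳ 1#)) (K.*-identityˡ _))
H-∷ zero    (suc w) v = K.trans
  (δ-vanishes [] (type (suc w ∷ v)) (≡.subst (0 <_) (≡.sym (sum-type (suc w ∷ v))) (s≤s z≤n)))
  (K.sym (K.trans (K.*-congʳ (K.reflexive (≡.cong fromℕ (k>n⇒nCk≡0 {0} {suc w} (s≤s z≤n))))) (K.zeroˡ _)))
H-∷ (suc n) zero    v = begin
  H (suc n) (0 ∷ v)                           ≈⟨ H-suc n (0 ∷ v) ⟩
  (c₁ ⊛ (λ c → H n (0 ∷ c))) v + 0#           ≈⟨ K.+-identityʳ _ ⟩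
  (c₁ ⊛ (λ c → H n (0 ∷ c))) v                ≈⟨ ⊛-cong (λ _ → K.refl) (H-∷ n 0) v ⟩
  (c₁ ⊛ (λ c → fromℕ (n C 0) * H n c)) v      ≈⟨ ⊛-*ʳ _ v ⟩
  fromℕ (n C 0) * (c₁ ⊛ H n) v                ≈⟨ K.*-congˡ (H-suc n v) ⟨
  fromℕ (suc n C 0) * H (suc n) v             ∎
H-∷ (suc n) (suc w) v = begin
  H (suc n) (suc w ∷ v)
    ≈⟨ H-suc n (suc w ∷ v) ⟩
  ∑ (upTo (suc (suc w))) f
    ≈⟨ K.trans (∑-upTo-head (suc w) f) (K.+-congˡ (∑-upTo-head w (f ∘ suc))) ⟩
  f 0 + (f 1 + ∑ (upTo w) (f ∘ suc ∘ suc))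
    ≈⟨ K.+-cong zeroth (K.trans (K.+-cong oneth
         (∑-zero (upTo w) λ i _ → ⊛-zeroˡ v λ _ → K.refl)) (K.+-identityʳ _)) ⟩
  fromℕ (n C suc w) * H (n ∸ w) v + fromℕ (n C w) * H (n ∸ w) v
    ≈⟨ K.trans (K.+-comm _ _) (K.sym (K.distribʳ _ _ _)) ⟩
  (fromℕ (n C w) + fromℕ (n C suc w)) * H (n ∸ w) v
    ≈⟨ K.*-congʳ (pascal n w) ⟩
  fromℕ (suc n C suc w) * H (n ∸ w) v ∎
  where
  f : ℕ → RatFun
  f i = ((λ b → c₁ (i ∷ b)) ⊛ (λ c → H n (suc w ∸ i ∷ c))) v

  -- For w ≥ n the two truncated degrees may differ, but then the binomial coefficient is zero.
  truncation : fromℕ (n C suc w) * H (suc (n ∸ suc w)) v ≈ fromℕ (n C suc w) * H (n ∸ w) v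
  truncation with suc w ℕₚ.≤? n
  ... | yes w<n = K.*-congˡ (K.reflexive (≡.cong (λ k → H k v) (≡.sym (ℕₚ.+-∸-assoc 1 w<n))))
  ... | no  w≮n = K.trans (K.trans (K.*-congʳ C≈0) (K.zeroˡ _)) (K.sym (K.trans (K.*-congʳ C≈0) (K.zeroˡ _)))
    where C≈0 = K.reflexive (≡.cong fromℕ (k>n⇒nCk≡0 (ℕₚ.≰⇒> w≮n)))

  zeroth : f 0 ≈ fromℕ (n C suc w) * H (n ∸ w) v
  zeroth = begin
    (c₁ ⊛ (λ c → H n (suc w ∷ c))) v                         ≈⟨ ⊛-cong (λ _ → K.refl) (H-∷ n (suc w)) v ⟩
    (c₁ ⊛ (λ c → fromℕ (n C suc w) * H (n ∸ suc w) c)) v     ≈⟨ ⊛-*ʳ _ v ⟩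
    fromℕ (n C suc w) * (c₁ ⊛ H (n ∸ suc w)) v               ≈⟨ K.*-congˡ (H-suc (n ∸ suc w) v) ⟨
    fromℕ (n C suc w) * H (suc (n ∸ suc w)) v                ≈⟨ truncation ⟩
    fromℕ (n C suc w) * H (n ∸ w) v                          ∎

  oneth : f 1 ≈ fromℕ (n C w) * H (n ∸ w) v
  oneth = K.trans (⊛-cong
      (λ b → indicator-⇔ (suc (sum b) ℕₚ.≟ 1) (sum b ℕₚ.≟ 0) ℕₚ.suc-injective (≡.cong suc)) (λ _ → K.refl) v)
    (K.trans (⊛-identityˡ (λ c → H n (w ∷ c)) v) (H-∷ n w v))

-- Both sides X satisfy X(w ∷ v) = (w+|v| choose w) X(v).
E-κ : ∀ v → E (sum v) (κ v) ≈ H (sum v) v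
E-κ []      = K.trans (K.+-identityʳ _) (K.trans (K.+-identityʳ _)
  (K.sym (indicator-yes ([] ≟ₗ (type [])) (≡.sym (type-partition ([] , []))))))
E-κ (w ∷ v) = begin
  E n (κ (w ∷ v))                     ≈⟨ E-cong n (λ l _ e → κ-∷ w v l e) ⟩
  E n (D (κ v))                       ≈⟨ E-D n (sum v) (κ-stable v) (κ-supported v) ⟩
  fromℕ (n C sum v) * E (sum v) (κ v) ≈⟨ K.*-cong (K.reflexive (≡.cong fromℕ (≡.trans
                                           (≡.cong (n C_) (≡.sym n∸w))
                                           (≡.sym (nCk≡nC[n∸k] (ℕₚ.m≤m+n w (sum v)))))))
                                           (E-κ v) ⟩
  fromℕ (n C w) * H (sum v) v         ≡⟨ ≡.cong (λ k → fromℕ (n C w) * H k v) n∸w ⟨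
  fromℕ (n C w) * H (n ∸ w) v         ≈⟨ H-∷ n w v ⟨
  H n (w ∷ v)                         ∎
  where
  n = w ℕ.+ sum v
  n∸w : n ∸ w ≡ sum v
  n∸w = ℕₚ.m+n∸m≡n w (sum v)

-- Removing one box, and standard tableaux

≺-sum : ∀ {m l} → m ≺ l → sum m ≤ sum l
≺-sum []              = z≤n
≺-sum (row _ m≤l m≺l) = ℕₚ.+-mono-≤ m≤l (≺-sum m≺l)

-- Rows may shrink to 0 but are kept, as in `interlacing`, so results agree with partitions only up
-- to trailing zeros.
down : List ℕ → List (List ℕ)
down []       = []
down (y ∷ ys) = (if does (first ys ℕₚ.<? y) then (pred y ∷ ys) ∷ [] else []) ++ map (y ∷_) (down ys)

∑-down : ∀ y ys F → ∑ (down (y ∷ ys)) F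
                      ≈ indicator (first ys ℕₚ.<? y) * F (pred y ∷ ys) + ∑ (down ys) (λ m → F (y ∷ m))
∑-down y ys F with does (first ys ℕₚ.<? y)
... | true  = K.+-cong (K.sym (K.*-identityˡ _)) (K.reflexive (∑-map (y ∷_) (down ys) F))
... | false = K.trans (K.reflexive (∑-map (y ∷_) (down ys) F))
  (K.trans (K.sym (K.+-identityˡ _)) (K.+-congʳ (K.sym (K.zeroˡ _))))

down-decreasing : ∀ l → Linked _≥_ l →
  All (λ m → first m ≤ first l × Linked _≥_ m × suc (sum m) ≡ sum l) (down l)
down-decreasing []       _   = []
down-decreasing (y ∷ ys) dec = Allₚ.++⁺ top (Allₚ.map⁺ (All.map
  (λ (m≤ , dec′ , e) → ℕₚ.≤-refl , Linked-∷ (ℕₚ.≤-trans m≤ (Linked-first dec)) dec′ ,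
    ≡.trans (≡.sym (ℕₚ.+-suc y _)) (≡.cong (y ℕ.+_) e)) (down-decreasing ys (Linked-tail dec))))
  where
  shrink : ∀ {y} → first ys < y → pred y ≤ y × Linked _≥_ (pred y ∷ ys) × suc (sum (pred y ∷ ys)) ≡ sum (y ∷ ys)
  shrink (s≤s ys≤y) = ℕₚ.n≤1+n _ , Linked-∷ ys≤y (Linked-tail dec) , refl
  top : All (λ m → first m ≤ y × Linked _≥_ m × suc (sum m) ≡ sum (y ∷ ys))
            (if first ys <ᵇ y then (pred y ∷ ys) ∷ [] else [])
  top with first ys <ᵇ y | ℕₚ.<ᵇ⇒< (first ys) y
  ... | true  | lt = shrink (lt _) ∷ []
  ... | false | _  = []

-- Only the empty strip leaves the size unchanged.
D-top : ∀ {F} l → Linked _≥_ l → (∀ m → sum m < sum l → F m ≈ 0#) → D F l ≈ F l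
D-top     []       _   _ = K.+-identityʳ _
D-top {F} (l ∷ ls) dec z = begin
  D F (l ∷ ls)
    ≈⟨ D-∷-+ F {ls = ls} d a+d≡l ⟩
  ∑ (upTo (suc d)) A     ≈⟨ ∑-upTo-last d A ⟩
  ∑ (upTo d) A + A d     ≈⟨ K.+-cong
    (∑-zero (upTo d) λ j j∈ → ∑-zero (interlacing ls) λ m m∈ → z (a ℕ.+ j ∷ m)
      (ℕₚ.+-mono-<-≤ (≡.subst (a ℕ.+ j <_) a+d≡l (ℕₚ.+-monoʳ-< a (∈-upTo⁻ j∈))) (≺-sum (∈-interlacing⁻ ls m∈))))
    (K.reflexive (≡.cong (λ x → D (λ m → F (x ∷ m)) ls) a+d≡l)) ⟩
  0# + D (λ m → F (l ∷ m)) ls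
    ≈⟨ K.trans (K.+-identityˡ _) (D-top ls (Linked-tail dec) λ m lt → z (l ∷ m) (ℕₚ.+-monoʳ-< l lt)) ⟩
  F (l ∷ ls) ∎
  where
  a = first ls
  d = l ∸ a
  a+d≡l : a ℕ.+ d ≡ l
  a+d≡l = ℕₚ.m+[n∸m]≡n (Linked-first dec)
  A : ℕ → RatFun
  A j = D (λ m → F (a ℕ.+ j ∷ m)) ls

-- Only strips of one box survive: either the first row loses the box and `D-top` fixes all rows
-- below, or it stays and the box comes from below.
D-down : ∀ {F} l → Linked _≥_ l → (∀ m → suc (sum m) ≢ sum l → F m ≈ 0#) → D F l ≈ ∑ (down l) F
D-down     []       _   z = K.trans (K.+-identityʳ _) (z [] λ ())
D-down {F} (l ∷ ls) dec z = begin
  D F (l ∷ ls)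
    ≈⟨ D-∷-+ F {ls = ls} d a+d≡l ⟩
  ∑ (upTo (suc d)) A     ≈⟨ ∑-upTo-last d A ⟩
  ∑ (upTo d) A + A d     ≈⟨ K.+-cong (shorter d a+d≡l z)
    (K.trans (K.reflexive (≡.cong (λ x → D (λ m → F (x ∷ m)) ls) a+d≡l))
      (D-down ls (Linked-tail dec) λ m ne → z (l ∷ m)
        (ne ∘ ℕₚ.+-cancelˡ-≡ l _ _ ∘ ≡.trans (ℕₚ.+-suc l (sum m))))) ⟩
  indicator (a ℕₚ.<? l) * F (pred l ∷ ls) + ∑ (down ls) (λ m → F (l ∷ m))
    ≈⟨ ∑-down l ls F ⟨
  ∑ (down (l ∷ ls)) F ∎
  where
  a = first ls
  d = l ∸ a
  a+d≡l : a ℕ.+ d ≡ l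
  a+d≡l = ℕₚ.m+[n∸m]≡n (Linked-first dec)
  A : ℕ → RatFun
  A j = D (λ m → F (a ℕ.+ j ∷ m)) ls

  shorter : ∀ d {l} → a ℕ.+ d ≡ l → (∀ m → suc (sum m) ≢ l ℕ.+ sum ls → F m ≈ 0#) →
            ∑ (upTo d) A ≈ indicator (a ℕₚ.<? l) * F (pred l ∷ ls)
  shorter zero    refl _ = K.sym (indicator-no-* (a ℕₚ.<? a ℕ.+ 0) (ℕₚ.<-irrefl (≡.sym (ℕₚ.+-identityʳ a))) _)
  shorter (suc d) refl z rewrite ℕₚ.+-suc a d = begin
    ∑ (upTo (suc d)) A  ≈⟨ ∑-upTo-last d A ⟩
    ∑ (upTo d) A + A d  ≈⟨ K.+-cong
      (∑-zero (upTo d) λ j j∈ → ∑-zero (interlacing ls) λ m m∈ → z (a ℕ.+ j ∷ m)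
        (ℕₚ.<⇒≢ (s≤s (ℕₚ.+-mono-<-≤ (ℕₚ.+-monoʳ-< a (∈-upTo⁻ j∈)) (≺-sum (∈-interlacing⁻ ls m∈))))))
      (D-top ls (Linked-tail dec) λ m lt → z (a ℕ.+ d ∷ m) (ℕₚ.<⇒≢ (s≤s (ℕₚ.+-monoʳ-< (a ℕ.+ d) lt)))) ⟩
    0# + F (a ℕ.+ d ∷ ls)  ≈⟨ K.+-identityˡ _ ⟩
    F (a ℕ.+ d ∷ ls)       ≈⟨ K.*-identityˡ _ ⟨
    1# * F (a ℕ.+ d ∷ ls)
      ≈⟨ K.*-congʳ (K.sym (indicator-yes (a ℕₚ.<? suc (a ℕ.+ d)) (s≤s (ℕₚ.m≤m+n a d)))) ⟩
    indicator (a ℕₚ.<? suc (a ℕ.+ d)) * F (a ℕ.+ d ∷ ls) ∎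

-- Equality up to trailing zeros.
δ₀ : List ℕ → List ℕ → RatFun
δ₀ []       m        = indicator (sum m ℕₚ.≟ 0)
δ₀ (x ∷ xs) []       = indicator (sum (x ∷ xs) ℕₚ.≟ 0)
δ₀ (x ∷ xs) (y ∷ ys) = indicator (x ℕₚ.≟ y) * δ₀ xs ys

δ₀-[]ʳ : ∀ l → δ₀ l [] ≈ indicator (sum l ℕₚ.≟ 0)
δ₀-[]ʳ []      = K.refl
δ₀-[]ʳ (_ ∷ _) = K.refl

δ₀-0∷[] : ∀ m → δ₀ (0 ∷ []) m ≈ δ₀ [] m
δ₀-0∷[] []           = K.refl
δ₀-0∷[] (zero ∷ ys)  = K.*-identityˡ _
δ₀-0∷[] (suc y ∷ ys) = K.zeroˡ _

δ₀-first : ∀ l m → first l < first m → δ₀ l m ≈ 0#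
δ₀-first []      (y ∷ ys) lt = indicator-no (sum (y ∷ ys) ℕₚ.≟ 0) λ e →
  ℕₚ.<-irrefl (≡.sym (ℕₚ.m+n≡0⇒m≡0 y e)) lt
δ₀-first (x ∷ _) (y ∷ _)  lt = indicator-no-* (x ℕₚ.≟ y) (ℕₚ.<⇒≢ lt) _

δ₀-positive : ∀ {a b} → All (0 <_) a → All (0 <_) b → δ₀ a b ≈ δ a b
δ₀-positive {[]}           {[]}          _         _         = K.refl
δ₀-positive {[]}           {zero ∷ ys}   _         (() ∷ _)
δ₀-positive {zero ∷ xs}    {[]}          (() ∷ _)  _
δ₀-positive {[]}           {suc y ∷ ys}  _         (_ ∷ _)       = K.refl
δ₀-positive {suc x ∷ xs}   {[]}          (_ ∷ _)   _         = K.refl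
δ₀-positive {x ∷ xs}       {y ∷ ys}      (_ ∷ pxs) (_ ∷ pys) = K.trans (K.*-congˡ (δ₀-positive pxs pys)) split
  where
  split : indicator (x ℕₚ.≟ y) * δ xs ys ≈ δ (x ∷ xs) (y ∷ ys)
  split with x ℕₚ.≟ y
  ... | yes refl = K.trans (indicator-yes-* (x ℕₚ.≟ x) refl _)
    (indicator-⇔ (xs ≟ₗ ys) ((x ∷ xs) ≟ₗ (x ∷ ys))
                     (≡.cong (x ∷_)) Listₚ.∷-injectiveʳ)
  ... | no x≢y   = K.trans (indicator-no-* (x ℕₚ.≟ y) x≢y _)
    (K.sym (indicator-no ((x ∷ xs) ≟ₗ (y ∷ ys))
                     (x≢y ∘ Listₚ.∷-injectiveˡ)))

-- Adding a box and removing a box are transposes of each other. Since the first row of m is within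
-- the bound, `raise` never forbids the box that leads from r to m; one row further down, the common
-- first row serves as the new bound.
raise-down : ∀ b r m → Linked _≥_ r → Linked _≥_ m → first r ≤ b → first m ≤ b →
             ∑ (raise b r) (λ l → δ₀ l m) ≈ ∑ (down m) (δ₀ r)
raise-down b r [] _ _ _ _ = ∑-zero (raise b r) λ l l∈ → K.trans (δ₀-[]ʳ l)
  (indicator-no (sum l ℕₚ.≟ 0) λ e → ℕₚ.1+n≢0 (≡.trans (≡.sym (All.lookup (raise-sum b r) l∈)) e))
raise-down b r (y ∷ ys) decʳ decᵐ r≤b y≤b = by-first-row r decʳ r≤b
  where
  nonempty : ∀ x xs → Linked _≥_ (x ∷ xs) → x ≤ b →
             ∑ (raise b (x ∷ xs)) (λ l → δ₀ l (y ∷ ys)) ≈ ∑ (down (y ∷ ys)) (δ₀ (x ∷ xs))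
  nonempty x xs dec x≤b = begin
    ∑ (raise b (x ∷ xs)) (λ l → δ₀ l (y ∷ ys))
      ≈⟨ ∑-raise b (x ∷ xs) (λ l → δ₀ l (y ∷ ys)) ⟩
    indicator (x ℕₚ.<? b) * (indicator (suc x ℕₚ.≟ y) * δ₀ xs ys)
      + ∑ (map (x ∷_) (raise x xs)) (λ l → δ₀ l (y ∷ ys))
      ≈⟨ K.+-cong (top y y≤b) (begin
           ∑ (map (x ∷_) (raise x xs)) (λ l → δ₀ l (y ∷ ys))
             ≡⟨ ∑-map (x ∷_) (raise x xs) (λ l → δ₀ l (y ∷ ys)) ⟩
           ∑ (raise x xs) (λ l → indicator (x ℕₚ.≟ y) * δ₀ l ys)
             ≈⟨ *-∑ _ (raise x xs) _ ⟨
           indicator (x ℕₚ.≟ y) * ∑ (raise x xs) (λ l → δ₀ l ys)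
             ≈⟨ indicator-*-cong (x ℕₚ.≟ y) (λ e → raise-down x xs ys (Linked-tail dec) (Linked-tail decᵐ)
                  (Linked-first dec) (≡.subst (first ys ≤_) (≡.sym e) (Linked-first decᵐ))) ⟩
           indicator (x ℕₚ.≟ y) * ∑ (down ys) (δ₀ xs)
             ≈⟨ *-∑ _ (down ys) _ ⟩
           ∑ (down ys) (λ m → δ₀ (x ∷ xs) (y ∷ m)) ∎) ⟩
    indicator (first ys ℕₚ.<? y) * δ₀ (x ∷ xs) (pred y ∷ ys) + ∑ (down ys) (λ m → δ₀ (x ∷ xs) (y ∷ m))
      ≈⟨ ∑-down y ys (δ₀ (x ∷ xs)) ⟨
    ∑ (down (y ∷ ys)) (δ₀ (x ∷ xs)) ∎
    where
    top : ∀ y → y ≤ b → indicator (x ℕₚ.<? b) * (indicator (suc x ℕₚ.≟ y) * δ₀ xs ys)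
                          ≈ indicator (first ys ℕₚ.<? y) * (indicator (x ℕₚ.≟ pred y) * δ₀ xs ys)
    top zero    _   = K.trans (*-≈0 _ (K.zeroˡ _)) (K.sym (K.zeroˡ _))
    top (suc y) y<b = begin
      indicator (x ℕₚ.<? b) * (indicator (suc x ℕₚ.≟ suc y) * δ₀ xs ys)
        ≈⟨ K.*-congˡ (K.*-congʳ (indicator-⇔ (suc x ℕₚ.≟ suc y) (x ℕₚ.≟ y) ℕₚ.suc-injective (≡.cong suc))) ⟩
      indicator (x ℕₚ.<? b) * (indicator (x ℕₚ.≟ y) * δ₀ xs ys)
        ≈⟨ solve 3 (λ a b c → a :* (b :* c) := b :* (a :* c))
             K.refl (indicator (x ℕₚ.<? b)) (indicator (x ℕₚ.≟ y)) (δ₀ xs ys) ⟩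
      indicator (x ℕₚ.≟ y) * (indicator (x ℕₚ.<? b) * δ₀ xs ys)
        ≈⟨ indicator-*-cong (x ℕₚ.≟ y) same ⟩
      indicator (x ℕₚ.≟ y) * (indicator (first ys ℕₚ.<? suc y) * δ₀ xs ys)
        ≈⟨ solve 3 (λ a b c → b :* (a :* c) := a :* (b :* c))
             K.refl (indicator (first ys ℕₚ.<? suc y)) (indicator (x ℕₚ.≟ y)) (δ₀ xs ys) ⟩
      indicator (first ys ℕₚ.<? suc y) * (indicator (x ℕₚ.≟ y) * δ₀ xs ys) ∎
      where
      same : x ≡ y → indicator (x ℕₚ.<? b) * δ₀ xs ys ≈ indicator (first ys ℕₚ.<? suc y) * δ₀ xs ys
      same refl with first ys ℕₚ.≤? x
      ... | yes ys≤x = K.*-congʳ (indicator-⇔ (x ℕₚ.<? b) (first ys ℕₚ.<? suc x) (λ _ → s≤s ys≤x) (λ _ → y<b))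
      -- The second row of m then exceeds x, hence also the second row of r, and the remaining rows
      -- cannot agree.
      ... | no  ys≰x = K.trans (*-≈0 _ δ₀≈0) (K.sym (*-≈0 _ δ₀≈0))
        where δ₀≈0 = δ₀-first xs ys (ℕₚ.≤-<-trans (Linked-first dec) (ℕₚ.≰⇒> ys≰x))

  by-first-row : ∀ r → Linked _≥_ r → first r ≤ b →
                 ∑ (raise b r) (λ l → δ₀ l (y ∷ ys)) ≈ ∑ (down (y ∷ ys)) (δ₀ r)
  by-first-row (x ∷ xs) dec x≤b = nonempty x xs dec x≤b
  -- An empty r behaves as a single zero row: both sums expand to the same terms.
  by-first-row []       _   0≤b = begin
    ∑ (raise b []) (λ l → δ₀ l (y ∷ ys))       ≈⟨ ∑-raise b [] (λ l → δ₀ l (y ∷ ys)) ⟩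
    _                                          ≈⟨ ∑-raise b (0 ∷ []) (λ l → δ₀ l (y ∷ ys)) ⟨
    ∑ (raise b (0 ∷ [])) (λ l → δ₀ l (y ∷ ys)) ≈⟨ nonempty 0 [] [-] 0≤b ⟩
    ∑ (down (y ∷ ys)) (δ₀ (0 ∷ []))            ≈⟨ ∑-cong (down (y ∷ ys)) δ₀-0∷[] ⟩
    ∑ (down (y ∷ ys)) (δ₀ [])                  ∎

U-δ₀ : ∀ r m → Linked _≥_ r → Linked _≥_ m → U (λ l → δ₀ l m) r ≈ ∑ (down m) (δ₀ r)
U-δ₀ r m decʳ decᵐ = K.trans (K.sym (raise-full {b} r (λ l → δ₀ l m) (ℕₚ.m≤m⊔n (suc (first r)) (first m))))
  (raise-down b r m decʳ decᵐ (ℕₚ.<⇒≤ (ℕₚ.m≤m⊔n (suc (first r)) (first m))) (ℕₚ.m≤n⊔m (suc (first r)) (first m)))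
  -- Large enough to leave `raise` on r unrestricted and to bound m as well.
  where b = suc (first r) ℕ.⊔ first m

sum-replicate-1 : ∀ n → sum (replicate n 1) ≡ n
sum-replicate-1 zero    = refl
sum-replicate-1 (suc n) = ≡.cong suc (sum-replicate-1 n)

-- Transposing the last `U` turns the multiplicity of m in `paths n` into a sum over shapes with one
-- box less. On functions of that degree `down` agrees with `D`, which is the recursion of the
-- Kostka numbers of weight 1ⁿ.
E-δ₀ : ∀ n m → Linked _≥_ m → sum m ≡ n → E n (λ l → δ₀ l m) ≈ κ (replicate n 1) m
E-δ₀ zero    m dec e = K.trans (K.+-identityʳ _) (K.sym (κ-[] m))
E-δ₀ (suc n) m dec e = begin
  E (suc n) (λ l → δ₀ l m)                   ≈⟨ E-suc n (λ l → δ₀ l m) ⟩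
  E n (U (λ l → δ₀ l m))                     ≈⟨ E-cong n (λ r (decʳ , _) _ → U-δ₀ r m decʳ dec) ⟩
  E n (λ r → ∑ (down m) (δ₀ r))              ≈⟨ ∑-swap (paths n) (down m) δ₀ ⟩
  ∑ (down m) (λ l → E n (λ r → δ₀ r l))
    ≈⟨ (∑-cong-∈ (down m) λ l l∈ → let (_ , dec′ , e′) = All.lookup (down-decreasing m dec) l∈ in
         E-δ₀ n l dec′ (ℕₚ.suc-injective (≡.trans e′ e))) ⟩
  ∑ (down m) (κ (replicate n 1))
    ≈⟨ D-down m dec (λ l ne → κ-supported (replicate n 1) l λ l≡ →
         ne (≡.trans (≡.cong suc (≡.trans l≡ (sum-replicate-1 n))) (≡.sym e))) ⟨
  D (κ (replicate n 1)) m
    ≈⟨ κ-∷ 1 (replicate n 1) m (≡.trans e (≡.cong suc (≡.sym (sum-replicate-1 n)))) ⟨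
  κ (replicate (suc n) 1) m ∎

-- Schur functions span

-- Triangularity only asks whether a Kostka number vanishes, so a chain is replaced by an inductive
-- witness. As in `chains`, the weight is in reverse order.
data Tableau : List ℕ → List ℕ → Set where
  empty : ∀ {l} → sum l ≡ 0 → Tableau l []
  strip : ∀ {l m w v} → m ≺ l → sum m ℕ.+ w ≡ sum l → Tableau m v → Tableau l (w ∷ v)

chain⇒Tableau : ∀ l v {c} → c ∈ chains l v → Tableau l v
chain⇒Tableau l []      c∈ with sum l ℕₚ.≟ 0 | c∈
... | yes e | _ = empty e
... | no ne | c∈′ = contradiction (≡.subst (_ ∈_) (chains-size l [] ne) c∈) λ ()
chain⇒Tableau l (w ∷ v) c∈
  with ∈-concatMap⁻ (λ m → map (l ∷_) (chains m v)) {filter (λ m → sum m ℕ.+ w ℕₚ.≟ sum l) (interlacing l)} c∈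
... | c∈′ with find c∈′
... | m , m∈ , c∈map with ∈-filter⁻ (λ m → sum m ℕ.+ w ℕₚ.≟ sum l) {xs = interlacing l} m∈ | ∈-map⁻ (l ∷_) c∈map
... | m∈int , e | _ , c′∈ , _ = strip (∈-interlacing⁻ l m∈int) e (chain⇒Tableau m v c′∈)

Tableau⇒chain : ∀ {l v} → Tableau l v → ∃ λ c → c ∈ chains l v
Tableau⇒chain {l} (empty e) rewrite dec-true (sum l ℕₚ.≟ 0) e = l ∷ [] , here refl
Tableau⇒chain {l} {w ∷ v} (strip {m = m} m≺l e t) with Tableau⇒chain t
... | c , c∈ = l ∷ c , ∈-concatMap⁺ (λ m → map (l ∷_) (chains m v))
  (lose
    (∈-filter⁺ (λ m → sum m ℕ.+ w ℕₚ.≟ sum l) (∈-interlacing⁺ m≺l) e) (∈-map⁺ (l ∷_) c∈))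

≺-∷ʳ0 : ∀ {m l} → m ≺ l → m ∷ʳ 0 ≺ l ∷ʳ 0
≺-∷ʳ0 []                            = row z≤n z≤n []
≺-∷ʳ0 (row {ls = ls} a≤m m≤l ms≺ls) = row (≡.subst (_≤ _) (≡.sym (first-∷ʳ0 ls)) a≤m) m≤l (≺-∷ʳ0 ms≺ls)

Tableau-∷ʳ0 : ∀ {l v} → Tableau l v → Tableau (l ∷ʳ 0) v
Tableau-∷ʳ0 {l} (empty e)               = empty (≡.trans (sum-∷ʳ0 l) e)
Tableau-∷ʳ0 {l} {w ∷ v} (strip {m = m} m≺l e t) = strip (≺-∷ʳ0 m≺l)
  (≡.trans (≡.cong (ℕ._+ w) (sum-∷ʳ0 m)) (≡.trans e (≡.sym (sum-∷ʳ0 l)))) (Tableau-∷ʳ0 t)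

∷ʳ0-≺ : ∀ l w → Linked _≥_ (l ∷ʳ w) → l ∷ʳ 0 ≺ l ∷ʳ w
∷ʳ0-≺ []       w _   = row z≤n z≤n []
∷ʳ0-≺ (x ∷ xs) w dec = row (Linked-first dec) ℕₚ.≤-refl (∷ʳ0-≺ xs w (Linked-tail dec))

Linked-init : ∀ l w → Linked _≥_ (l ∷ʳ w) → Linked _≥_ l
Linked-init []           w _         = []
Linked-init (x ∷ [])     w _         = [-]
Linked-init (x ∷ y ∷ xs) w (p ∷ dec) = p ∷ Linked-init (y ∷ xs) w dec

-- The tableau with all entries of row i equal to i.
Tableau-reverse : ∀ v → Linked _≥_ (reverse v) → Tableau (reverse v) v
Tableau-reverse []      _ = empty refl
Tableau-reverse (w ∷ v) dec rewrite Listₚ.unfold-reverse w v = strip (∷ʳ0-≺ (reverse v) w dec)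
  (≡.trans (≡.cong (ℕ._+ w) (sum-∷ʳ0 (reverse v)))
    (≡.sym (≡.trans (sum-++ (reverse v) (w ∷ [])) (≡.cong (sum (reverse v) ℕ.+_) (ℕₚ.+-identityʳ w)))))
  (Tableau-∷ʳ0 (Tableau-reverse v (Linked-init (reverse v) w dec)))

sum-take-drop : ∀ i l → sum (take i l) ℕ.+ sum (drop i l) ≡ sum l
sum-take-drop i l = ≡.trans (≡.sym (sum-++ (take i l) (drop i l))) (≡.cong sum (Listₚ.take++drop≡id i l))

≺-take : ∀ {m l} → m ≺ l → ∀ i → sum (take i m) ≤ sum (take i l)
≺-take m≺l             zero    = z≤n
≺-take []              (suc i) = z≤n
≺-take (row _ m≤l m≺l) (suc i) = ℕₚ.+-mono-≤ m≤l (≺-take m≺l i)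

≺-tail : ∀ {m l} → m ≺ l → sum (drop 1 l) ≤ sum m
≺-tail []                             = z≤n
≺-tail (row {ls = []} _ _ _)          = z≤n
≺-tail (row {ls = a ∷ ls} a≤m _ m≺l)  = ℕₚ.+-mono-≤ a≤m (≺-tail m≺l)

≺-drop : ∀ {m l} → m ≺ l → ∀ i → sum (drop (suc i) l) ≤ sum (drop i m)
≺-drop m≺l             zero    = ≺-tail m≺l
≺-drop []              (suc i) = z≤n
≺-drop (row _ _ m≺l)   (suc i) = ≺-drop m≺l i

-- Each strip accounts for at most one row: by `≺-drop`, the rows of l after the first i+1 fit
-- inside the rows of m after the first i.
Tableau-rows : ∀ {l v} → Tableau l v → ∀ i → length v ≤ i → sum (drop i l) ≡ 0
Tableau-rows {l} (empty e) i _ = ℕₚ.m+n≡0⇒n≡0 (sum (take i l)) (≡.trans (sum-take-drop i l) e)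
Tableau-rows (strip m≺l _ t) (suc i) (s≤s v≤i) =
  ℕₚ.n≤0⇒n≡0 (≡.subst (_ ≤_) (Tableau-rows t i v≤i) (≺-drop m≺l i))

Tableau-sum : ∀ {l v} → Tableau l v → sum l ≡ sum v
Tableau-sum (empty e) = e
Tableau-sum {v = w ∷ v} (strip {m = m} _ e t) =
  ≡.trans (≡.sym e) (≡.trans (ℕₚ.+-comm (sum m) w) (≡.cong (w ℕ.+_) (Tableau-sum t)))

take-∷ʳ : ∀ i l (w : ℕ) → i ≤ length l → take i (l ∷ʳ w) ≡ take i l
take-∷ʳ zero    l       w _         = refl
take-∷ʳ (suc i) (x ∷ l) w (s≤s i≤) = ≡.cong (x ∷_) (take-∷ʳ i l w i≤)

-- If i is less than the number of letters, the last strip does not affect the weight prefix and its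
-- removal only shrinks the rows. Otherwise `Tableau-rows` puts all of l into its first i rows, and
-- both sides are the full size.
Tableau-dominance : ∀ {l v} → Tableau l v → ∀ i → sum (take i (reverse v)) ≤ sum (take i l)
Tableau-dominance (empty _) i = ℕₚ.≤-trans (ℕₚ.≤-reflexive (≡.cong sum (Listₚ.take-[] i))) z≤n
Tableau-dominance {l} {w ∷ v} t@(strip m≺l e t′) i with i ℕₚ.≤? length v
... | yes i≤v rewrite Listₚ.unfold-reverse w v
                    | take-∷ʳ i (reverse v) w (≡.subst (i ≤_) (≡.sym (Listₚ.length-reverse v)) i≤v) =
  ℕₚ.≤-trans (Tableau-dominance t′ i) (≺-take m≺l i)
... | no i≰v = ℕₚ.≤-trans (ℕₚ.m≤m+n _ _) (ℕₚ.≤-reflexive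
  (≡.trans (sum-take-drop i (reverse (w ∷ v)))
  (≡.trans (sum-↭ (Permₚ.↭-reverse (w ∷ v)))
  (≡.trans (≡.sym (Tableau-sum t))
  (≡.trans (≡.sym (sum-take-drop i l))
  (≡.trans (≡.cong (sum (take i l) ℕ.+_) (Tableau-rows t i (ℕₚ.≰⇒> i≰v))) (ℕₚ.+-identityʳ _)))))))

-- Strictly increasing in the dominance order, hence a measure for induction along it.
height : ℕ → List ℕ → ℕ
height zero    l = 0
height (suc k) l = sum (take (suc k) l) ℕ.+ height k l

height-mono : ∀ {l m} k → (∀ i → sum (take i l) ≤ sum (take i m)) → height k l ≤ height k m
height-mono zero    dom = z≤n
height-mono (suc k) dom = ℕₚ.+-mono-≤ (dom (suc k)) (height-mono k dom)

-- When every prefix sum is at least as large, the total fails to grow only if none of them changes.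
height-≡ : ∀ {l m} k → (∀ i → sum (take i l) ≤ sum (take i m)) → height k m ≤ height k l →
           ∀ i → i ≤ k → sum (take i l) ≡ sum (take i m)
height-≡ k       dom h zero    _   = refl
height-≡ {l} {m} (suc k) dom h (suc i) i≤k with ℕₚ.m≤n⇒m<n∨m≡n i≤k
... | inj₁ (s≤s i<k) = height-≡ k dom (ℕₚ.+-cancelˡ-≤ (sum (take (suc k) m)) _ _
  (ℕₚ.≤-trans h (ℕₚ.+-monoˡ-≤ _ (dom (suc k))))) (suc i) i<k
... | inj₂ refl = ℕₚ.≤-antisym (dom (suc k)) (ℕₚ.+-cancelʳ-≤ (height k l) _ _
  (ℕₚ.≤-trans (ℕₚ.+-monoʳ-≤ _ (height-mono k dom)) h))

take-sums-injective : ∀ {k l m} → All (0 <_) l → All (0 <_) m → length l ≤ k → length m ≤ k →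
  (∀ i → i ≤ k → sum (take i l) ≡ sum (take i m)) → l ≡ m
take-sums-injective [] [] _ _ _ = refl
take-sums-injective {suc k} [] (s≤s z≤n ∷ _) _ _ e with () ← e 1 (s≤s z≤n)
take-sums-injective {suc k} (s≤s z≤n ∷ _) [] _ _ e with () ← e 1 (s≤s z≤n)
take-sums-injective {suc k} {x ∷ xs} {y ∷ ys} (_ ∷ ps) (_ ∷ qs) (s≤s l≤k) (s≤s m≤k) e = ≡.cong₂ _∷_ x≡y
  (take-sums-injective ps qs l≤k m≤k λ i i≤k →
    ℕₚ.+-cancelˡ-≡ x _ _ (≡.trans (e (suc i) (s≤s i≤k)) (≡.cong (ℕ._+ sum (take i ys)) (≡.sym x≡y))))
  where
  x≡y : x ≡ y
  x≡y = ≡.trans (≡.sym (ℕₚ.+-identityʳ x)) (≡.trans (e 1 (s≤s z≤n)) (ℕₚ.+-identityʳ y))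

length≤sum : ∀ {l} → All (0 <_) l → length l ≤ sum l
length≤sum []       = z≤n
length≤sum (p ∷ ps) = ℕₚ.+-mono-≤ p (length≤sum ps)

-- Positive parts bound the length by the size, so the first `sum l` prefix sums determine the list;
-- equal heights would force equal lists.
Tableau-height : ∀ {l v} → All (0 <_) l → All (0 <_) (reverse v) → reverse v ≢ l → Tableau l v →
                 height (sum l) (reverse v) < height (sum l) l
Tableau-height {l} {v} pl pv v≢l t = ℕₚ.≰⇒> λ h → v≢l (take-sums-injective pv pl
  (≡.subst (length (reverse v) ≤_) (≡.trans (sum-↭ (Permₚ.↭-reverse v)) (≡.sym (Tableau-sum t))) (length≤sum pv))
  (length≤sum pl) (height-≡ (sum l) (Tableau-dominance t) h))

-- Expansion in monomial symmetric functions

type-isPartition : ∀ a → IsPartition (type a)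
type-isPartition a = sort-↗ _ , Permₚ.All-resp-↭ (Perm.↭-sym (sort-↭ _)) (Allₚ.all-filter (0 ℕₚ.<?_) a)

toPartition : ∀ {l} → IsPartition l → Partition
toPartition {l} (dec , pos) = record { parts = l ; decreasing = dec ; positive = pos }

isPartition : ∀ μ → IsPartition (parts μ)
isPartition μ = decreasing μ , positive μ

-- Each zero exponent is moved to the end by symmetry and dropped by stability.
filter-series : ∀ (g : Series) → Symmetric g → Stable g → ∀ a → g (filter (0 ℕₚ.<?_) a) ≈ g a
filter-series g sym st []          = K.refl
filter-series g sym st (zero ∷ a)  = K.trans (filter-series g sym st a)
  (K.trans (K.sym (st a)) (sym (Perm.↭-sym (Permₚ.∷↭∷ʳ 0 a))))
filter-series g sym st (suc x ∷ a) =
  filter-series (λ b → g (suc x ∷ b)) (λ r → sym (Perm.prep (suc x) r)) (λ b → st (suc x ∷ b)) a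

series-type : ∀ f a → series f (type a) ≈ series f a
series-type f a = K.trans (symmetric f (sort-↭ _)) (filter-series (series f) (symmetric f) (stable f) a)

-- A finite list easily seen to contain every partition of n; repetitions are harmless, as
-- `partitions` removes them.
compositions : ℕ → List (List ℕ)
compositions zero    = [] ∷ []
compositions (suc n) = concatMap (λ c → (1 ∷ c) ∷ bump c ∷ []) (compositions n)

∈-compositions : ∀ n {c} → All (0 <_) c → sum c ≡ n → c ∈ compositions n
∈-compositions zero    {[]}              _        _ = here refl
∈-compositions zero    {suc _ ∷ _}       _        ()
∈-compositions zero    {zero ∷ _}        (() ∷ _) _
∈-compositions (suc n) {zero ∷ c}        (() ∷ _) _
∈-compositions (suc n) {suc zero ∷ c}    (_ ∷ p)  e = ∈-concatMap⁺ _
  (lose (∈-compositions n p (ℕₚ.suc-injective e)) (here refl))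
∈-compositions (suc n) {suc (suc x) ∷ c} (_ ∷ p)  e = ∈-concatMap⁺ _
  (lose (∈-compositions n {suc x ∷ c} (s≤s z≤n ∷ p) (ℕₚ.suc-injective e)) (there (here refl)))

compositions-sum : ∀ n → All (λ c → sum c ≡ n) (compositions n)
compositions-sum zero    = refl ∷ []
compositions-sum (suc n) = All-concatMap⁺ (compositions-sum n) λ {c} e →
  ≡.cong suc e ∷ bumped c e ∷ []
  where
  bumped : ∀ c → sum c ≡ n → sum (bump c) ≡ suc n
  bumped []      e = ≡.cong suc e
  bumped (_ ∷ _) e = ≡.cong suc e

partitions : ℕ → List (List ℕ)
partitions n = deduplicate _≟ₗ_ (map type (compositions n))

∈-partitions : ∀ n a → sum a ≡ n → type a ∈ partitions n
∈-partitions n a e = ∈-deduplicate⁺ _≟ₗ_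
  (≡.subst (_∈ map type (compositions n)) (type-partition (type-isPartition a))
    (∈-map⁺ type (∈-compositions n (proj₂ (type-isPartition a)) (≡.trans (sum-type a) e))))

partitions-correct : ∀ n {l} → l ∈ partitions n → IsPartition l × sum l ≡ n
partitions-correct n l∈ with ∈-map⁻ type (∈-deduplicate⁻ _≟ₗ_ (map type (compositions n)) l∈)
... | c , c∈ , refl = type-isPartition c , ≡.trans (sum-type c) (All.lookup (compositions-sum n) c∈)

∑-δ : ∀ {xs} (g : List ℕ → RatFun) → Unique xs → ∀ {a} → a ∈ xs → ∑ xs (λ x → g x * δ x a) ≈ g a
∑-δ {x ∷ xs} g (x∉ ∷ u) (here refl) = K.trans
  (K.+-cong (K.trans (K.*-congˡ (indicator-yes (x ≟ₗ x) refl)) (K.*-identityʳ _))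
    (∑-zero xs λ y y∈ → K.trans (K.*-congˡ
      (indicator-no (y ≟ₗ x) (All.lookup x∉ y∈ ∘ ≡.sym))) (K.zeroʳ _)))
  (K.+-identityʳ _)
∑-δ {x ∷ xs} g (x∉ ∷ u) {a} (there a∈) = K.trans
  (K.+-cong (K.trans (K.*-congˡ
    (indicator-no (x ≟ₗ a) (All.lookup x∉ a∈))) (K.zeroʳ _)) (∑-δ g u a∈))
  (K.+-identityˡ _)

Homogeneous : ℕ → Sym → Set
Homogeneous n f = Supported n (series f)

-- The empty sum is a zero multiple of `1ₛ`, so compatibility with scalars alone sends it to `0#`.
∑ₛ : List X → (X → Sym) → Sym
∑ₛ []       g = 0# ·ₛ 1ₛ
∑ₛ (x ∷ xs) g = g x +ₛ ∑ₛ xs g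

series-∑ₛ : ∀ (xs : List X) g a → series (∑ₛ xs g) a ≈ ∑ xs (λ x → series (g x) a)
series-∑ₛ []       g a = K.zeroˡ _
series-∑ₛ (x ∷ xs) g a = K.+-congˡ (series-∑ₛ xs g a)

M : List ℕ → Sym
M a = combination (δ a) (sum a) (δ-vanishes a)

monomial-expansion : ∀ n f → Homogeneous n f → f ≈ₛ ∑ₛ (partitions n) (λ ν → series f ν ·ₛ M ν)
monomial-expansion n f hom a = K.sym (K.trans (series-∑ₛ (partitions n) (λ ν → series f ν ·ₛ M ν) a) expand)
  where
  expand : ∑ (partitions n) (λ ν → series f ν * δ ν (type a)) ≈ series f a
  expand with sum a ℕₚ.≟ n
  ... | yes e = K.trans
    (∑-δ (series f) (deduplicate-! _≟ₗ_ (map type (compositions n))) (∈-partitions n a e))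
    (series-type f a)
  ... | no ne = K.trans (∑-zero (partitions n) λ ν ν∈ → K.trans (K.*-congˡ
      (indicator-no (ν ≟ₗ (type a)) λ e → ne (≡.trans (≡.sym (sum-type a))
        (≡.trans (≡.cong sum (≡.sym e)) (proj₂ (partitions-correct n ν∈)))))) (K.zeroʳ _))
    (K.sym (hom a ne))

record Linear (φ : Sym → RatFun) : Set where
  field
    ≈ₛ-cong : ∀ {f g} → f ≈ₛ g → φ f ≈ φ g
    +-homo  : ∀ f g → φ (f +ₛ g) ≈ φ f + φ g
    ·-homo  : ∀ c f → φ (c ·ₛ f) ≈ c * φ f

  ∑-homo : (xs : List X) (g : X → Sym) → φ (∑ₛ xs g) ≈ ∑ xs (λ x → φ (g x))
  ∑-homo []       g = K.trans (·-homo 0# 1ₛ) (K.zeroˡ _)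
  ∑-homo (x ∷ xs) g = K.trans (+-homo (g x) (∑ₛ xs g)) (K.+-congˡ (∑-homo xs g))

-- A tableau makes the Kostka number positive, hence invertible in ℚ(α).
κ-cancel : ∀ {l v x} → Tableau l v → κ v l * x ≈ 0# → x ≈ 0#
κ-cancel {l} {v} {x} t e with chains l v | Tableau⇒chain t
... | c ∷ cs | _ = begin
  x                                     ≈⟨ K.*-identityˡ x ⟨
  1# * x                                ≈⟨ K.*-congʳ (constant-1/n*n k) ⟨
  constant (+ 1 ℚ./ k) * fromℕ k * x    ≈⟨ K.*-assoc _ _ _ ⟩
  constant (+ 1 ℚ./ k) * (fromℕ k * x)  ≈⟨ K.*-congˡ e ⟩
  constant (+ 1 ℚ./ k) * 0#             ≈⟨ K.zeroʳ _ ⟩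
  0#                                    ∎
  where k = suc (length cs)

s-homogeneous : ∀ μ → Homogeneous ∣ μ ∣ (s μ)
s-homogeneous μ a ne = κ-supported (reverse (type a)) (parts μ) λ e →
  ne (≡.sym (≡.trans e (≡.trans (sum-↭ (Permₚ.↭-reverse (type a))) (sum-type a))))

-- The spanning property in dual form; no coefficients of an expansion in Schur functions have to be
-- computed.
module SchurSpan {φ : Sym → RatFun} (linear : Linear φ) (n : ℕ)
                 (φ-s : ∀ μ → ∣ μ ∣ ≡ n → φ (s μ) ≈ 0#) where
  open Linear linear

  φ-expansion : ∀ f → Homogeneous n f → φ f ≈ ∑ (partitions n) (λ ν → series f ν * φ (M ν))
  φ-expansion f hom = K.trans (≈ₛ-cong (monomial-expansion n f hom))
    (K.trans (∑-homo (partitions n) (λ ν → series f ν ·ₛ M ν))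
      (∑-cong (partitions n) λ ν → ·-homo (series f ν) (M ν)))

  -- Induction along dominance, with k bounding the height. Every other m_ν that occurs in s_μ has
  -- smaller height, so φ already kills it, and 0 = φ(s_μ) is the diagonal Kostka number times
  -- φ(m_μ).
  φ-M : ∀ k μ → ∣ μ ∣ ≡ n → height n (parts μ) < k → φ (M (parts μ)) ≈ 0#
  φ-M (suc k) μ refl (s≤s h≤k) = κ-cancel diagonal (begin
    κ (reverse (parts μ)) (parts μ) * φ (M (parts μ))
      ≈⟨ ∑-δ g (deduplicate-! _≟ₗ_ (map type (compositions n)))
           (≡.subst (_∈ partitions n) (type-partition (isPartition μ)) (∈-partitions n (parts μ) refl)) ⟨
    ∑ (partitions n) (λ ν → g ν * δ ν (parts μ))
      ≈⟨ (∑-cong-∈ (partitions n) λ ν ν∈ → off-diagonal ν (partitions-correct n ν∈)) ⟩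
    ∑ (partitions n) (λ ν → series (s μ) ν * φ (M ν))
      ≈⟨ φ-expansion (s μ) (s-homogeneous μ) ⟨
    φ (s μ) ≈⟨ φ-s μ refl ⟩
    0# ∎)
    where
    g : List ℕ → RatFun
    g ν = κ (reverse ν) (parts μ) * φ (M ν)

    diagonal : Tableau (parts μ) (reverse (parts μ))
    diagonal = ≡.subst (λ l → Tableau l (reverse (parts μ))) (Listₚ.reverse-involutive (parts μ))
      (Tableau-reverse (reverse (parts μ))
        (≡.subst (Linked _≥_) (≡.sym (Listₚ.reverse-involutive (parts μ))) (decreasing μ)))

    smaller : ∀ ν → IsPartition ν → sum ν ≡ n → ν ≢ parts μ → g ν ≈ 0#
    smaller ν part e ν≢μ with chains (parts μ) (reverse ν) in eq
    ... | []     = K.zeroˡ _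
    ... | c ∷ cs = *-≈0 _ (φ-M k (toPartition part) e (ℕₚ.<-≤-trans
      (≡.subst (λ l → height n l < height n (parts μ)) (Listₚ.reverse-involutive ν)
        (Tableau-height (positive μ) (≡.subst (All (0 <_)) (≡.sym (Listₚ.reverse-involutive ν)) (proj₂ part))
          (ν≢μ ∘ ≡.trans (≡.sym (Listₚ.reverse-involutive ν)))
          (chain⇒Tableau (parts μ) (reverse ν) (≡.subst (c ∈_) (≡.sym eq) (here refl))))) h≤k))

    off-diagonal : ∀ ν → IsPartition ν × sum ν ≡ n → g ν * δ ν (parts μ) ≈ series (s μ) ν * φ (M ν)
    off-diagonal ν (part , e) = split (ν ≟ₗ (parts μ))
      where
      g≈ : g ν ≈ series (s μ) ν * φ (M ν)
      g≈ = K.reflexive (≡.cong (λ l → κ (reverse l) (parts μ) * φ (M ν)) (≡.sym (type-partition part)))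

      split : Dec (ν ≡ parts μ) → g ν * δ ν (parts μ) ≈ series (s μ) ν * φ (M ν)
      split (yes ν≡μ) = K.trans (K.*-congˡ (indicator-yes (ν ≟ₗ (parts μ)) ν≡μ))
        (K.trans (K.*-identityʳ _) g≈)
      split (no ν≢μ)  = K.trans (K.*-congʳ (smaller ν part e ν≢μ))
        (K.trans (K.zeroˡ _) (K.trans (K.sym (smaller ν part e ν≢μ)) g≈))

  vanishes : ∀ f → Homogeneous n f → φ f ≈ 0#
  vanishes f hom = K.trans (φ-expansion f hom) (∑-zero (partitions n) λ ν ν∈ →
    let (part , e) = partitions-correct n ν∈ in
    *-≈0 _ (φ-M (suc (height n ν)) (toPartition part) e (ℕₚ.n<1+n _)))

-- The Hall product with h₁ⁿ

H-supported : ∀ n → Supported n (H n)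
H-supported zero    []      ne = contradiction refl ne
H-supported (suc n) []      _  = K.trans (K.*-congʳ
  (K.reflexive (≡.cong (λ k → indicator (k ℕₚ.≟ 1)) (sum-type [])))) (K.zeroˡ _)
H-supported n       (w ∷ v) ne with w ℕₚ.≤? n
... | yes w≤n = K.trans (H-∷ n w v) (*-≈0 _ (H-supported (n ∸ w) v λ e →
  ne (≡.trans (≡.cong (w ℕ.+_) e) (ℕₚ.m+[n∸m]≡n w≤n))))
... | no  w≰n = K.trans (H-∷ n w v) (K.trans (K.*-congʳ
  (K.reflexive (≡.cong fromℕ (k>n⇒nCk≡0 (ℕₚ.≰⇒> w≰n))))) (K.zeroˡ _))

-- Sorting makes this total on lists, as `∑ₛ` requires; partitions are left unchanged.
sₗ : List ℕ → Sym
sₗ l = s (toPartition (type-isPartition l))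

-- In degree n each coefficient is an instance of `E-κ` at the reversed exponents, and the symmetry
-- of h₁ⁿ undoes the reversal. In other degrees both sides vanish.
h-1ⁿ-expansion : ∀ n → h (1^ n) ≈ₛ ∑ₛ (paths n) sₗ
h-1ⁿ-expansion n a = K.sym (begin
  series (∑ₛ (paths n) sₗ) a
    ≈⟨ series-∑ₛ (paths n) sₗ a ⟩
  E n (λ l → κ v (type l))
    ≈⟨ E-cong n (λ l part _ → K.reflexive (≡.cong (κ v) (type-partition part))) ⟩
  E n (κ v)
    ≈⟨ total ⟩
  H n a ∎)
  where
  v = reverse (type a)
  sum-v : sum v ≡ sum a
  sum-v = ≡.trans (sum-↭ (Permₚ.↭-reverse (type a))) (sum-type a)
  total : E n (κ v) ≈ H n a
  total with sum a ℕₚ.≟ n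
  ... | yes refl = begin
    E (sum a) (κ v)      ≡⟨ ≡.cong (λ k → E k (κ v)) sum-v ⟨
    E (sum v) (κ v)      ≈⟨ E-κ v ⟩
    H (sum v) v          ≡⟨ ≡.cong (λ k → H k v) sum-v ⟩
    H (sum a) v          ≈⟨ symmetric (h (1^ sum a)) (Permₚ.↭-reverse (type a)) ⟩
    H (sum a) (type a)   ≈⟨ series-type (h (1^ sum a)) a ⟩
    H (sum a) a          ∎
  ... | no ne    = K.trans
    (K.trans (E-cong n (λ l _ e → κ-supported v l λ e′ → ne (≡.trans (≡.sym sum-v) (≡.trans (≡.sym e′) e))))
      (∑-zero (paths n) λ _ _ → K.refl))
    (K.sym (H-supported n a ne))

replicate-∷ʳ : ∀ n (x : ℕ) → replicate n x ∷ʳ x ≡ x ∷ replicate n x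
replicate-∷ʳ zero    x = refl
replicate-∷ʳ (suc n) x = ≡.cong (x ∷_) (replicate-∷ʳ n x)

reverse-replicate : ∀ n (x : ℕ) → reverse (replicate n x) ≡ replicate n x
reverse-replicate zero    x = refl
reverse-replicate (suc n) x = ≡.trans (Listₚ.unfold-reverse x (replicate n x))
  (≡.trans (≡.cong (_∷ʳ x) (reverse-replicate n x)) (replicate-∷ʳ n x))

hall-s-h : ∀ {B} → IsHall B → ∀ n μ → ∣ μ ∣ ≡ n → ⟨ s μ , h (1^ n) ⟩[ B ] ≈ [m 1^ n ] (s μ)
hall-s-h {B} hall n μ e = begin
  ⟨ s μ , h (1^ n) ⟩[ B ]               ≈⟨ ⟪⟫-comm B (s μ) (h (1^ n)) ⟩
  ⟨ h (1^ n) , s μ ⟩[ B ]               ≈⟨ ⟪⟫-cong B {g = s μ} (h-1ⁿ-expansion n) (λ _ → K.refl) ⟩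
  ⟨ ∑ₛ (paths n) sₗ , s μ ⟩[ B ]        ≈⟨ ∑-homo (paths n) sₗ ⟩
  E n (λ l → ⟨ sₗ l , s μ ⟩[ B ])
    ≈⟨ E-cong n (λ l part _ → K.trans (hall (toPartition (type-isPartition l)) μ)
         (K.trans (K.reflexive (≡.cong (λ k → δ k (parts μ)) (type-partition part)))
           (K.sym (δ₀-positive (proj₂ part) (positive μ))))) ⟩
  -- Orthonormality has left the multiplicity of μ in `paths n`, that is f^μ.
  E n (λ l → δ₀ l (parts μ))            ≈⟨ E-δ₀ n (parts μ) (decreasing μ) e ⟩
  κ (replicate n 1) (parts μ)
    ≡⟨ ≡.cong (λ l → κ l (parts μ)) (≡.trans
         (≡.cong reverse (type-partition (isPartition (1^ n)))) (reverse-replicate n 1)) ⟨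
  [m 1^ n ] (s μ) ∎
  where
  linear : Linear (λ f → ⟨ f , s μ ⟩[ B ])
  linear = record
    { ≈ₛ-cong = λ e → ⟪⟫-cong B {g = s μ} e (λ _ → K.refl)
    ; +-homo  = λ f g → ⟪⟫-+ B f g (s μ)
    ; ·-homo  = λ c f → ⟪⟫-· B c f (s μ) }
  open Linear linear

-- The difference of the two functionals is linear and kills the Schur functions of degree n, so
-- `vanishes` applies to it.
hall-h : ∀ {B} → IsHall B → ∀ n f → Homogeneous n f → ⟨ f , h (1^ n) ⟩[ B ] ≈ [m 1^ n ] f
hall-h {B} hall n f hom = x∙y⁻¹≈ε⇒x≈y _ _ (vanishes f hom)
  where
  g = h (1^ n)
  φ : Sym → RatFun
  φ f = ⟨ f , g ⟩[ B ] - [m 1^ n ] f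

  linear : Linear φ
  linear = record
    { ≈ₛ-cong = λ e → K.+-cong (⟪⟫-cong B {g = g} e (λ _ → K.refl)) (K.-‿cong (e _))
    ; +-homo  = λ f f′ → K.trans (K.+-cong (⟪⟫-+ B f f′ g) (K.sym (⁻¹-∙-comm _ _)))
        (solve 4 (λ a b c d → (a :+ b) :+ (c :+ d) := (a :+ c) :+ (b :+ d)) K.refl
          ⟨ f , g ⟩[ B ] ⟨ f′ , g ⟩[ B ] (- [m 1^ n ] f) (- [m 1^ n ] f′))
    ; ·-homo  = λ c f → K.trans (K.+-cong (⟪⟫-· B c f g) (-‿distribʳ-* c ([m 1^ n ] f)))
        (K.sym (K.distribˡ c _ _)) }

  φ-s : ∀ μ → ∣ μ ∣ ≡ n → φ (s μ) ≈ 0#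
  φ-s μ e = K.trans (K.+-congʳ (hall-s-h {B} hall n μ e)) (K.-‿inverseʳ _)

  open SchurSpan linear n φ-s

-- The coefficient in the modified Jack functions

invert-α-fromℕ : ∀ k → invert-α (fromℕ k) ≈ fromℕ k
invert-α-fromℕ k = begin
  invert-α (fromℕ k)       ≈⟨ invert-α-cong (fromℕ-constant k) ⟩
  at-α⁻¹ (q ∷ []) * inverse (at-α⁻¹ 1ₚ) 1≉0 ≈⟨ K.*-congʳ (at-constant q) ⟩
  constant q * inverse (at-α⁻¹ 1ₚ) 1≉0       ≈⟨ K.*-cong (K.sym (fromℕ-constant k)) inverse-1 ⟩
  fromℕ k * 1#             ≈⟨ K.*-identityʳ _ ⟩
  fromℕ k                  ∎
  where
  q   = fromℚᵘ (mkℚᵘ (+ k) 0)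
  1≉0 = at-≉0 1ₚ≉0
  at-constant : ∀ q → at-α⁻¹ (q ∷ []) ≈ constant q
  at-constant q = K.trans (K.+-congˡ (K.zeroʳ α⁻¹)) (K.+-identityʳ _)
  inverse-1 : inverse (at-α⁻¹ 1ₚ) 1≉0 ≈ 1#
  inverse-1 = K.trans (K.sym (K.*-identityˡ _))
    (K.trans (K.*-congʳ (K.sym (at-constant _))) (*-inverse (at-α⁻¹ 1ₚ) 1≉0))

-- Dominance includes equality of sizes, so triangularity removes all coefficients of other degrees.
-- It speaks of partitions only; `series-type` carries it to arbitrary exponents.
J̃-homogeneous : ∀ {B J} → IsIntegralJack B J → ∀ μ → Homogeneous ∣ μ ∣ (J̃ J μ)
J̃-homogeneous {J = J} jack μ a ne = *-≈0 _ (invert-α-0# {series (J μ) a} (K.trans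
  (K.sym (series-type (J μ) a))
  (IsIntegralJack.triangular jack μ (toPartition (type-isPartition a))
    λ (e , _) → ne (≡.trans (≡.sym (sum-type a)) e))))

-- The normalization n! does not involve α and survives α ↦ 1/α; the power of α is the prefactor in
-- `J̃`.
J̃-normalized : ∀ {B J} → IsIntegralJack B J → ∀ μ → [m 1^ ∣ μ ∣ ] (J̃ J μ) ≈ fromℕ (∣ μ ∣ !) * α ^ ∣ μ ∣
J̃-normalized jack μ = K.trans (K.*-congˡ (K.trans (invert-α-cong (IsIntegralJack.normalized jack μ))
  (invert-α-fromℕ (∣ μ ∣ !)))) (K.*-comm _ _)

proposition3p1 : (⟪⟫α : ScalarProduct) → IsAlphaProduct ⟪⟫α →
    (J : Partition → Sym) → IsIntegralJack ⟪⟫α J →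
    (hall : ScalarProduct) → IsHall hall →
    (n : ℕ) → 1 ≤ n → (μ : Partition) → ∣ μ ∣ ≡ n →
    ([m 1^ n ] (J̃ J μ) ≈ ⟨ J̃ J μ , h (1^ n) ⟩[ hall ])
    × (⟨ J̃ J μ , h (1^ n) ⟩[ hall ] ≈ fromℕ (n !) * α ^ n)
    × (fromℕ (n !) * α ^ n
    ≈ ∑ (upTo n) (λ k → fromℕ (n !) * fromℕ (eulerian n k) * binomial (α + fromℕ k) n))
    × (∑ (upTo n) (λ k → fromℕ (n !) * fromℕ (eulerian n k) * binomial (α + fromℕ k) n)
    ≈ ∑ (map suc (upTo n)) (λ k → fromℕ (n !) * fromℕ (stirling n k) * binomial α k * fromℕ (k !)))
proposition3p1 ⟪⟫α _ J jack hall isHall _ 1≤n μ refl =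
    K.sym pairing
  , K.trans pairing (J̃-normalized jack μ)
  , K.sym (worpitzky α ∣ μ ∣ 1≤n)
  , K.trans (worpitzky α ∣ μ ∣ 1≤n) (K.sym (falling-stirling α ∣ μ ∣ 1≤n))
  where
  pairing : ⟨ J̃ J μ , h (1^ ∣ μ ∣) ⟩[ hall ] ≈ [m 1^ ∣ μ ∣ ] (J̃ J μ)
  pairing = hall-h {hall} isHall ∣ μ ∣ (J̃ J μ) (J̃-homogeneous jack μ)
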